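{- Let $n$ be a positive integer, let $r>0$, and let $G$ be an $n$-vertex graph with at most $r$ cherries. Then every locally $\left(\frac{n}{560\, r^{3/4}}\right)$-bounded coloring $c$ of $E(K_n)$ is $G$-proper.
   Context: A cherry in a graph is a path on three vertices (counted as a subgraph). An edge-coloring $c$ of $E(K_n)$ is locally $k$-bounded if for every vertex $v$ of $K_n$, no color appears on more than $k$ of the edges incident to $v$. A coloring $c$ of $E(K_n)$ is $G$-proper if there is a copy of $G$ in $K_n$ on which $c$ induces a proper edge-coloring, i.e., no two edges of the copy sharing a vertex have the same color. -}

module Defs where

open import Data.Nat using (ℕ; _+_; _*_; _<_)
open import Data.Bool using (Bool; true; false; if_then_else_; _∧_)
open import Data.Fin using (Fin; toℕ)
open import Data.List using (List; map; allFin)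
open import Data.Nat.ListAction using (sum)
open import Data.Integer using (+_)
open import Data.Rational using (ℚ; _/_; _≤_; Positive)
import Data.Rational as Q
open import Relation.Binary.PropositionalEquality using (_≡_; _≢_)
open import Relation.Binary.Definitions using (DecidableEquality)
open import Relation.Nullary.Decidable using (⌊_⌋; ¬?)
open import Data.Product using (Σ; _×_)
open import Function.Definitions using (Injective)

countF : ∀ {n} → (Fin n → Bool) → ℕ
countF {n} p = sum (map (λ i → if p i then 1 else 0) (allFin n))

record Graph (n : ℕ) : Set where
  field
    Adj     : Fin n → Fin n → Bool
    symm    : ∀ u v → Adj u v ≡ Adj v u
    irrefl  : ∀ v → Adj v v ≡ false
open Graph public

-- number of cherries (copies of the path on three vertices a - v - b):
-- such a subgraph is determined by its centre v and the unordered pair {a,b}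
-- of distinct neighbours of v; we count triples with toℕ a < toℕ b.
cherries : ∀ {n} → Graph n → ℕ
cherries {n} G =
  sum (map (λ v → sum (map (λ a → countF (λ b →
      ⌊ toℕ a Data.Nat.<? toℕ b ⌋ ∧ Adj G a v ∧ Adj G v b)) (allFin n))) (allFin n))

-- an edge-colouring of K_n with colours in C: a symmetric function on pairs
-- (values on the diagonal are irrelevant and never used)
record Coloring (n : ℕ) (C : Set) : Set where
  field
    col  : Fin n → Fin n → C
    csym : ∀ u v → col u v ≡ col v u
open Coloring public

colorDeg : ∀ {n C} → DecidableEquality C → Coloring n C → Fin n → C → ℕ
colorDeg {n} _≟C_ c v a =
  countF (λ u → ⌊ ¬? (u Data.Fin.≟ v) ⌋ ∧ ⌊ col c v u ≟C a ⌋)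

ℕtoℚ : ℕ → ℚ
ℕtoℚ m = (+ m) / 1

-- c is locally (n / (560 r^{3/4}))-bounded: every colour degree d satisfies
-- d ≤ n / (560 r^{3/4}), equivalently (560 d)^4 r^3 ≤ n^4 (all quantities ≥ 0).
pow4 : ℚ → ℚ
pow4 x = x Q.* x Q.* x Q.* x

LocallyBoundedBy : ∀ {n C} → DecidableEquality C → ℕ → ℚ → Coloring n C → Set
LocallyBoundedBy dec n r c =
  ∀ v a → pow4 (ℕtoℚ (560 * colorDeg dec c v a)) Q.* (r Q.* r Q.* r) ≤ pow4 (ℕtoℚ n)

GProper : ∀ {n C} → Graph n → Coloring n C → Set
GProper {n} G c =
  Σ (Fin n → Fin n) λ φ → Injective _≡_ _≡_ φ ×
    (∀ u v w → Adj G u v ≡ true → Adj G v w ≡ true → u ≢ w →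
       col c (φ u) (φ v) ≢ col c (φ v) (φ w))

{-# OPTIONS --safe #-}
module Submission where

-- Let R be the number of cherries and t a rounded-up fourth root of R³, so that
-- n ≥ 280 t k for some bound k on the colour degrees.  By Cauchy–Schwarz every
-- vertex is an end of at most 2t (ordered) cherries.  Only few vertices, at most
-- t^(1/3), are the centre of more than 2t of them; these high vertices are
-- embedded greedily, so that their images span a properly coloured clique and
-- their pairs have few monochromatic common neighbours altogether.  The other
-- vertices are embedded by a random bijection.  A bad event pins at most three of
-- them to given images; pinning one more vertex costs a factor of about 1/n, as a
-- transposition of images shows, even when one conditions on avoiding events that
-- share no vertex and no image with the pins (Lu and Székely).  Every event has
-- conflicting events of total probability at most 1/4, and the local lemma applies.
-- One kind of event needs care: with one high end, the image of the other end may
-- conflict with many events.  Forbidding the neighbours of high vertices the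
-- images that complete a monochromatic cherry with two high vertices makes these
-- events essentially disjoint for different high ends.

open import Defs
open import Data.Bool using (true; if_then_else_; _∧_)
import Data.Bool.Properties as Bₚ
open import Data.Fin using (Fin; toℕ)
import Data.Fin as F
open import Data.Fin.Permutation.Components using (transpose; transpose-inverse)
import Data.Fin.Properties as Fₚ
import Data.Integer as ℤ
import Data.Integer.Properties as ℤₚ
open import Data.List using (List; []; _∷_; _++_; map; concatMap; filter; length; allFin; cartesianProduct)
open import Data.List.Membership.Propositional using (_∈_; lose; find)
open import Data.List.Membership.Propositional.Properties
  using (∈-allFin; ∈-filter⁺; ∈-filter⁻; ∈-concatMap⁺; ∈-map⁺; ∈-++⁺ˡ; ∈-++⁺ʳ; ∈-cartesianProduct⁺)
open import Data.List.Properties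
  using (map-++; length-tabulate; filter-notAll; length-++; length-map; map-cong-local)
open import Data.List.Relation.Unary.All using (All; []; _∷_)
import Data.List.Relation.Unary.All as All
import Data.List.Relation.Unary.All.Properties as Allₚ
open import Data.List.Relation.Unary.AllPairs using ([]; _∷_)
open import Data.List.Relation.Unary.Any using (Any; here; there)
import Data.List.Relation.Unary.Any as Any
open import Data.List.Relation.Unary.Unique.Propositional using (Unique)
open import Data.List.Relation.Unary.Unique.Propositional.Properties using (allFin⁺; filter⁺)
open import Data.Nat
open import Data.Nat.Coprimality using (1-coprimeTo)
import Data.Nat.Coprimality as Coprimality
open import Data.Nat.DivMod using (/-monoˡ-≤; m*n/n≡m; m/n*n≤m)
open import Data.Nat.ListAction using (sum)
open import Data.Nat.ListAction.Properties using (sum-++)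
open import Data.Nat.Properties
open import Data.Nat.Tactic.RingSolver using (solve-∀)
open import Data.Product using (∃; _×_; _,_; proj₁; proj₂)
open import Data.Rational using (ℚ; Positive; mkℚ)
import Data.Rational as Q
import Data.Rational.Properties as Qₚ
open import Data.Sum using (_⊎_; inj₁; inj₂)
open import Data.Vec using (Vec; []; _∷_; lookup)
import Data.Vec as Vec
open import Data.Vec.Properties using (lookup-map; lookup∘tabulate)
open import Function using (_∘_; id)
open import Relation.Binary.Definitions using (DecidableEquality; tri<; tri≈; tri>)
open import Relation.Binary.PropositionalEquality hiding ([_])
open import Relation.Nullary using (¬_; Dec; yes; no; does; contradiction)
open import Relation.Nullary.Decidable
  using (_×-dec_; _⊎-dec_; _→-dec_; ¬?; ⌊_⌋; dec-true; dec-false)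
open import Relation.Unary using (Decidable)

-- Two loads compete at a pin. Events through a vertex u are governed by the cherries at u: at most
-- 2t as an end, but up to 2R as a centre, which is far too many; so vertices that centre many
-- cherries have to be placed in advance. Events through an image w may come from all 2R ordered
-- cherries, but fixing w saves a factor n, and R ≤ t² with 280tk ≤ n makes R·nk small against t·n².
-- Placing vertices in advance has its own price: a high end has no choice of image to average over,
-- so once the image of the other end is fixed only that of the centre varies.
--
-- Probabilities are kept as integer counts over the common denominator p³: an event with j pins
-- weighs p^(3 - j).
--
-- The constant: t is at most 2R^(3/4), so 560 = 2 · 280. The 12 in 12 · 16tkn² ≤ p³ is 4 from the
-- local lemma times at most three pins per event; with p ≥ 9n/10 this asks for n ≥ (192 / 0.729)
-- tk, and 280 suffices.

private variable
  A B D : Set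
  n : ℕ

-- Indicators and finite sums

∑ : List A → (A → ℕ) → ℕ
∑ xs f = sum (map f xs)

syntax ∑ xs (λ x → e) = ∑[ x ∈ xs ] e
infixr 8 ∑

⟦_⟧ : Dec A → ℕ
⟦ P? ⟧ = if does P? then 1 else 0

⟦⟧≤1 : (P? : Dec A) → ⟦ P? ⟧ ≤ 1
⟦⟧≤1 (yes _) = ≤-refl
⟦⟧≤1 (no _)  = z≤n

⟦⟧-yes : (P? : Dec A) → A → ⟦ P? ⟧ ≡ 1
⟦⟧-yes (yes _) _ = refl
⟦⟧-yes (no ¬p) p = contradiction p ¬p

⟦⟧-no : (P? : Dec A) → ¬ A → ⟦ P? ⟧ ≡ 0
⟦⟧-no (yes p) ¬p = contradiction p ¬p
⟦⟧-no (no _)  _  = refl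

⟦⟧-≤ : ∀ {m} (P? : Dec A) → (A → 1 ≤ m) → ⟦ P? ⟧ ≤ m
⟦⟧-≤ (yes p) h = h p
⟦⟧-≤ (no _)  _ = z≤n

⟦⟧-mono : (P? : Dec A) (Q? : Dec B) → (A → B) → ⟦ P? ⟧ ≤ ⟦ Q? ⟧
⟦⟧-mono P? Q? h = ⟦⟧-≤ P? (λ p → ≤-reflexive (sym (⟦⟧-yes Q? (h p))))

⟦⟧-⊎ : (P? : Dec A) (Q? : Dec B) (R? : Dec D) → (A → B ⊎ D) → ⟦ P? ⟧ ≤ ⟦ Q? ⟧ + ⟦ R? ⟧
⟦⟧-⊎ P? Q? R? h = ⟦⟧-≤ P? λ p → case′ (h p)
  where
  case′ : _ → 1 ≤ ⟦ Q? ⟧ + ⟦ R? ⟧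
  case′ (inj₁ q) = ≤-trans (≤-reflexive (sym (⟦⟧-yes Q? q))) (m≤m+n _ _)
  case′ (inj₂ r) = ≤-trans (≤-reflexive (sym (⟦⟧-yes R? r))) (m≤n+m _ _)

⟦⟧*-≤ : ∀ {a b} (P? : Dec A) → (A → a ≤ b) → ⟦ P? ⟧ * a ≤ b
⟦⟧*-≤ (yes p) h = ≤-trans (≤-reflexive (*-identityˡ _)) (h p)
⟦⟧*-≤ (no _)  _ = z≤n

⟦⟧*-cong : ∀ {a b} (P? : Dec A) → (A → a ≡ b) → ⟦ P? ⟧ * a ≡ ⟦ P? ⟧ * b
⟦⟧*-cong (yes p) h = cong (1 *_) (h p)
⟦⟧*-cong (no _)  _ = refl

⟦⟧*-mono : ∀ {a b} (P? : Dec A) → (A → a ≤ b) → ⟦ P? ⟧ * a ≤ ⟦ P? ⟧ * b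
⟦⟧*-mono (yes p) h = *-monoʳ-≤ 1 (h p)
⟦⟧*-mono (no _)  _ = z≤n

⟦⟧*≤ : ∀ (P? : Dec A) a → ⟦ P? ⟧ * a ≤ a
⟦⟧*≤ P? a = ⟦⟧*-≤ P? (λ _ → ≤-refl)

⟦⟧-pos : (P? : Dec A) → 0 < ⟦ P? ⟧ → A
⟦⟧-pos (yes p) _ = p

⟦⟧-× : (P? : Dec A) (Q? : Dec B) → ⟦ P? ×-dec Q? ⟧ ≡ ⟦ P? ⟧ * ⟦ Q? ⟧
⟦⟧-× (yes _) (yes _) = refl
⟦⟧-× (yes _) (no _)  = refl
⟦⟧-× (no _)  _       = refl

⟦⟧+¬ : (P? : Dec A) → ⟦ P? ⟧ + ⟦ ¬? P? ⟧ ≡ 1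
⟦⟧+¬ (yes _) = refl
⟦⟧+¬ (no _)  = refl

∑-cong : ∀ (xs : List A) {f g} → (∀ x → f x ≡ g x) → ∑ xs f ≡ ∑ xs g
∑-cong []       h = refl
∑-cong (x ∷ xs) h = cong₂ _+_ (h x) (∑-cong xs h)

∑-mono∈ : ∀ (xs : List A) {f g} → (∀ {x} → x ∈ xs → f x ≤ g x) → ∑ xs f ≤ ∑ xs g
∑-mono∈ []       h = z≤n
∑-mono∈ (x ∷ xs) h = +-mono-≤ (h (here refl)) (∑-mono∈ xs (h ∘ there))

∑-mono : ∀ (xs : List A) {f g} → (∀ x → f x ≤ g x) → ∑ xs f ≤ ∑ xs g
∑-mono xs h = ∑-mono∈ xs (λ {x} _ → h x)

∑-+ : ∀ (xs : List A) f g → ∑[ x ∈ xs ] (f x + g x) ≡ ∑ xs f + ∑ xs g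
∑-+ []       f g = refl
∑-+ (x ∷ xs) f g = trans (cong (f x + g x +_) (∑-+ xs f g)) (lem (f x) (g x) _ _)
  where
  lem : ∀ a b c d → a + b + (c + d) ≡ a + c + (b + d)
  lem = solve-∀

∑-*ˡ : ∀ (xs : List A) c f → ∑[ x ∈ xs ] (c * f x) ≡ c * ∑ xs f
∑-*ˡ []       c f = sym (*-zeroʳ c)
∑-*ˡ (x ∷ xs) c f = trans (cong (c * f x +_) (∑-*ˡ xs c f)) (sym (*-distribˡ-+ c (f x) _))

∑-*ʳ : ∀ (xs : List A) c f → ∑[ x ∈ xs ] (f x * c) ≡ ∑ xs f * c
∑-*ʳ xs c f = trans (∑-cong xs (λ x → *-comm (f x) c)) (trans (∑-*ˡ xs c f) (*-comm c _))

∑-const : ∀ (xs : List A) c → ∑[ _ ∈ xs ] c ≡ length xs * c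
∑-const []       c = refl
∑-const (_ ∷ xs) c = cong (c +_) (∑-const xs c)

∑-zero : ∀ (xs : List A) → ∑[ _ ∈ xs ] 0 ≡ 0
∑-zero xs = trans (∑-const xs 0) (*-zeroʳ (length xs))

∑-≤-const∈ : ∀ (xs : List A) {f} c → (∀ {x} → x ∈ xs → f x ≤ c) → ∑ xs f ≤ length xs * c
∑-≤-const∈ xs c h = ≤-trans (∑-mono∈ xs h) (≤-reflexive (∑-const xs c))

∑-≤-const : ∀ (xs : List A) {f} c → (∀ x → f x ≤ c) → ∑ xs f ≤ length xs * c
∑-≤-const xs c h = ∑-≤-const∈ xs c (λ {x} _ → h x)

∑-swap : ∀ (xs : List A) (ys : List B) (f : A → B → ℕ) →
         ∑[ x ∈ xs ] ∑[ y ∈ ys ] f x y ≡ ∑[ y ∈ ys ] ∑[ x ∈ xs ] f x y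
∑-swap []       ys f = sym (∑-zero ys)
∑-swap (x ∷ xs) ys f = trans (cong (∑ ys (f x) +_) (∑-swap xs ys f)) (sym (∑-+ ys (f x) _))

∑-++ : ∀ (xs ys : List A) f → ∑ (xs ++ ys) f ≡ ∑ xs f + ∑ ys f
∑-++ xs ys f = trans (cong sum (map-++ f xs ys)) (sum-++ (map f xs) (map f ys))

∑-concatMap : ∀ (xs : List A) (h : A → List B) f → ∑ (concatMap h xs) f ≡ ∑[ x ∈ xs ] ∑ (h x) f
∑-concatMap []       h f = refl
∑-concatMap (x ∷ xs) h f = trans (∑-++ (h x) _ f) (cong (∑ (h x) f +_) (∑-concatMap xs h f))

∑-map : ∀ (xs : List A) (h : A → B) f → ∑ (map h xs) f ≡ ∑ xs (f ∘ h)
∑-map []       h f = refl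
∑-map (x ∷ xs) h f = cong (f (h x) +_) (∑-map xs h f)

∑-filter : ∀ {P : A → Set} (P? : Decidable P) xs f →
           ∑ (filter P? xs) f ≡ ∑[ x ∈ xs ] (⟦ P? x ⟧ * f x)
∑-filter P? []       f = refl
∑-filter P? (x ∷ xs) f with P? x
... | yes _ = cong₂ _+_ (sym (*-identityˡ (f x))) (∑-filter P? xs f)
... | no _  = ∑-filter P? xs f

∑-filter≤ : ∀ {P : A → Set} (P? : Decidable P) xs f → ∑ (filter P? xs) f ≤ ∑ xs f
∑-filter≤ P? xs f = ≤-trans (≤-reflexive (∑-filter P? xs f)) (∑-mono xs (λ x → ⟦⟧*≤ (P? x) (f x)))

∈⇒≤∑ : ∀ {xs : List A} {x} f → x ∈ xs → f x ≤ ∑ xs f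
∈⇒≤∑ f (here refl) = m≤m+n _ _
∈⇒≤∑ {xs = y ∷ _} f (there p) = ≤-trans (∈⇒≤∑ f p) (m≤n+m _ (f y))

∑-pos : ∀ (xs : List A) {f} → 0 < ∑ xs f → ∃ λ x → 0 < f x
∑-pos (x ∷ xs) {f} h with f x in eq
... | suc m = x , subst (0 <_) (sym eq) (s≤s z≤n)
... | zero  = ∑-pos xs h

∑-average : ∀ (xs : List A) {f} c → ∑ xs f < length xs * c → ∃ λ x → f x < c
∑-average (x ∷ xs) {f} c h with f x <? c
... | yes q = x , q
... | no ¬q = ∑-average xs c
  (+-cancelˡ-< c _ _ (≤-<-trans (+-monoˡ-≤ _ (≮⇒≥ ¬q)) h))

∑-none : ∀ (xs : List A) {P : A → Set} (P? : Decidable P) → (∀ {x} → x ∈ xs → ¬ P x) → ∑[ x ∈ xs ] ⟦ P? x ⟧ ≡ 0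
∑-none []       P? h = refl
∑-none (x ∷ xs) P? h = cong₂ _+_ (⟦⟧-no (P? x) (h (here refl))) (∑-none xs P? (h ∘ there))

∑-≤1 : ∀ {xs : List A} {P : A → Set} (P? : Decidable P) → Unique xs →
       (∀ {x y} → x ∈ xs → y ∈ xs → P x → P y → x ≡ y) → ∑[ x ∈ xs ] ⟦ P? x ⟧ ≤ 1
∑-≤1 {xs = []}     P? _ h = z≤n
∑-≤1 {xs = x ∷ xs} P? (x∉ ∷ u) h with P? x
... | no _  = ∑-≤1 P? u (λ i j → h (there i) (there j))
... | yes p = s≤s (≤-reflexive (∑-none xs P? λ y∈ q →
    All.lookup x∉ y∈ (h (here refl) (there y∈) p q)))

Σᶠ : ∀ {n} → (Fin n → ℕ) → ℕ
Σᶠ {n} = ∑ (allFin n)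

syntax Σᶠ (λ i → e) = Σᶠ[ i ] e
infixr 8 Σᶠ

length-allFin : ∀ n → length (allFin n) ≡ n
length-allFin n = length-tabulate id

Σᶠ-≤-const : ∀ {f : Fin n → ℕ} c → (∀ i → f i ≤ c) → Σᶠ f ≤ n * c
Σᶠ-≤-const {n} c h = ≤-trans (∑-≤-const (allFin n) c h) (≤-reflexive (cong (_* c) (length-allFin n)))

Σᶠ-≤1 : {P : Fin n → Set} (P? : Decidable P) → (∀ {i j} → P i → P j → i ≡ j) → Σᶠ[ i ] ⟦ P? i ⟧ ≤ 1
Σᶠ-≤1 {n} P? h = ∑-≤1 P? (allFin⁺ n) (λ _ _ → h)

≤Σᶠ : ∀ (f : Fin n → ℕ) i → f i ≤ Σᶠ f
≤Σᶠ f i = ∈⇒≤∑ f (∈-allFin i)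

Σᶠ-pick : ∀ (f : Fin n → ℕ) {P : Fin n → Set} (P? : Decidable P) j → (∀ i → P i → i ≡ j) →
          Σᶠ[ i ] (⟦ P? i ⟧ * f i) ≤ f j
Σᶠ-pick {n} f P? j h = begin
  Σᶠ[ i ] (⟦ P? i ⟧ * f i)  ≡⟨ ∑-cong (allFin n) (λ i → ⟦⟧*-cong (P? i) (cong f ∘ h i)) ⟩
  Σᶠ[ i ] (⟦ P? i ⟧ * f j)  ≡⟨ ∑-*ʳ (allFin n) (f j) _ ⟩
  (Σᶠ[ i ] ⟦ P? i ⟧) * f j  ≤⟨ *-monoˡ-≤ (f j) (Σᶠ-≤1 P? (λ p q → trans (h _ p) (sym (h _ q)))) ⟩
  1 * f j                   ≡⟨ *-identityˡ (f j) ⟩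
  f j                       ∎
  where open ≤-Reasoning

-- Inserting the indicator of `σ i ≡ j` and swapping the sums reindexes without first showing that
-- an injective self-map is bijective.
Σᶠ-injection : ∀ (f : Fin n → ℕ) (σ : Fin n → Fin n) → (∀ {i j} → σ i ≡ σ j → i ≡ j) → Σᶠ (f ∘ σ) ≤ Σᶠ f
Σᶠ-injection {n} f σ inj = begin
  Σᶠ[ i ] f (σ i)                              ≤⟨ ∑-mono (allFin n) (λ i → ≤-trans
       (≤-reflexive (trans (sym (*-identityˡ _)) (cong (_* f (σ i)) (sym (⟦⟧-yes (σ i F.≟ σ i) refl)))))
       (≤Σᶠ (λ j → ⟦ σ i F.≟ j ⟧ * f j) (σ i))) ⟩
  Σᶠ[ i ] Σᶠ[ j ] (⟦ σ i F.≟ j ⟧ * f j)      ≡⟨ ∑-swap (allFin n) (allFin n) _ ⟩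
  Σᶠ[ j ] Σᶠ[ i ] (⟦ σ i F.≟ j ⟧ * f j)      ≡⟨ ∑-cong (allFin n) (λ j → ∑-*ʳ (allFin n) (f j) _) ⟩
  Σᶠ[ j ] ((Σᶠ[ i ] ⟦ σ i F.≟ j ⟧) * f j)    ≤⟨ ∑-mono (allFin n) (λ j → ≤-trans
       (*-monoˡ-≤ (f j) (Σᶠ-≤1 (λ i → σ i F.≟ j) (λ p q → inj (trans p (sym q)))))
       (≤-reflexive (*-identityˡ (f j)))) ⟩
  Σᶠ f                                         ∎
  where open ≤-Reasoning

-- The lopsided local lemma in counting form

module LocalLemma
  {Ω E : Set} (Ωs : List Ω)
  {Good : Ω → Set} (good? : Decidable Good)
  {Occ : E → Ω → Set} (occ? : ∀ e → Decidable (Occ e))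
  {Conf : E → E → Set} (conf? : ∀ e → Decidable (Conf e))
  (Valid : E → Set) (wt : E → ℕ) (q : ℕ) (q>0 : 0 < q)
  where

  Avoids : List E → Ω → Set
  Avoids S ω = All (λ e → ¬ Occ e ω) S

  avoids? : ∀ S → Decidable (Avoids S)
  avoids? S ω = All.all? (λ e → ¬? (occ? e ω)) S

  # : List E → ℕ
  # S = ∑[ ω ∈ Ωs ] ⟦ good? ω ×-dec avoids? S ω ⟧

  #occ : E → List E → ℕ
  #occ e S = ∑[ ω ∈ Ωs ] ⟦ occ? e ω ×-dec (good? ω ×-dec avoids? S ω) ⟧

  -- With `wt e` over `q` read as the probability of `e`, this is `q` times the total probability of
  -- the events of `S` in conflict with `e`.
  load : E → List E → ℕ
  load e S = ∑[ f ∈ S ] (⟦ conf? e f ⟧ * wt f)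

  Sparse : List E → Set
  Sparse S = ∀ {e} → Valid e → 4 * load e S ≤ q

  module _
    (valid⇒conf : ∀ {e} → Valid e → Conf e e)
    -- Stands in for independence: avoiding events without conflict with `e` does not push the
    -- probability of `e` above `wt e` over `q`.
    (negdep : ∀ {e S} → Valid e → All (¬_ ∘ Conf e) S → q * #occ e S ≤ wt e * # S)
    where

    indep : E → List E → List E
    indep e = filter (¬? ∘ conf? e)

    -- A pointwise union bound: `T` contains the events of `S` outside `P`, so an outcome avoiding
    -- `T` can fail to avoid `S` only through an event in `P`.
    avoids-split : ∀ {P : E → Set} (P? : Decidable P) S T {ω} →
      (∀ {f} → f ∈ S → ¬ P f → f ∈ T) → Avoids T ω →
      1 ≤ ⟦ avoids? S ω ⟧ + ∑[ f ∈ S ] (⟦ P? f ⟧ * ⟦ occ? f ω ⟧)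
    avoids-split P? []      T sub av = ≤-refl
    avoids-split P? (f ∷ S) T {ω} sub av = cases (occ? f ω) (P? f)
      where
      open ≤-Reasoning
      rest = ∑[ f ∈ S ] (⟦ P? f ⟧ * ⟦ occ? f ω ⟧)
      cases : Dec (Occ f ω) → Dec _ → 1 ≤ ⟦ avoids? (f ∷ S) ω ⟧ + (⟦ P? f ⟧ * ⟦ occ? f ω ⟧ + rest)
      cases (no ¬o) _ = begin
        1                             ≤⟨ avoids-split P? S T (sub ∘ there) av ⟩
        ⟦ avoids? S ω ⟧ + rest        ≤⟨ +-mono-≤ (⟦⟧-mono (avoids? S ω) (avoids? (f ∷ S) ω) (¬o ∷_)) (m≤n+m rest _) ⟩
        ⟦ avoids? (f ∷ S) ω ⟧ + (⟦ P? f ⟧ * ⟦ occ? f ω ⟧ + rest) ∎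
      cases (yes o) (no ¬p) = contradiction o (All.lookup av (sub (here refl) ¬p))
      cases (yes o) (yes p) = begin
        1                                    ≡⟨ sym (cong₂ _*_ (⟦⟧-yes (P? f) p) (⟦⟧-yes (occ? f ω) o)) ⟩
        ⟦ P? f ⟧ * ⟦ occ? f ω ⟧              ≤⟨ m≤m+n _ rest ⟩
        ⟦ P? f ⟧ * ⟦ occ? f ω ⟧ + rest       ≤⟨ m≤n+m _ ⟦ avoids? (f ∷ S) ω ⟧ ⟩
        ⟦ avoids? (f ∷ S) ω ⟧ + (⟦ P? f ⟧ * ⟦ occ? f ω ⟧ + rest) ∎

    #-indep-≤ : ∀ e S → # (indep e S) ≤ # S + ∑[ f ∈ S ] (⟦ conf? e f ⟧ * #occ f (indep e S))
    #-indep-≤ e S = begin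
      # S₂
        ≤⟨ ∑-mono Ωs pointwise ⟩
      ∑[ ω ∈ Ωs ] (⟦ good? ω ×-dec avoids? S ω ⟧ + ∑[ f ∈ S ] (⟦ conf? e f ⟧ * occ f ω))
        ≡⟨ ∑-+ Ωs _ _ ⟩
      # S + ∑[ ω ∈ Ωs ] ∑[ f ∈ S ] (⟦ conf? e f ⟧ * occ f ω)
        ≡⟨ cong (# S +_) (∑-swap Ωs S (λ ω f → ⟦ conf? e f ⟧ * occ f ω)) ⟩
      # S + ∑[ f ∈ S ] ∑[ ω ∈ Ωs ] (⟦ conf? e f ⟧ * occ f ω)
        ≡⟨ cong (# S +_) (∑-cong S (λ f → ∑-*ˡ Ωs ⟦ conf? e f ⟧ (occ f))) ⟩
      # S + ∑[ f ∈ S ] (⟦ conf? e f ⟧ * #occ f S₂) ∎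
      where
      open ≤-Reasoning
      S₂ : List E
      S₂ = indep e S
      occ : E → Ω → ℕ
      occ f ω = ⟦ occ? f ω ×-dec (good? ω ×-dec avoids? S₂ ω) ⟧
      pointwise : ∀ ω → ⟦ good? ω ×-dec avoids? S₂ ω ⟧
                ≤ ⟦ good? ω ×-dec avoids? S ω ⟧ + ∑[ f ∈ S ] (⟦ conf? e f ⟧ * occ f ω)
      pointwise ω = ⟦⟧-≤ (good? ω ×-dec avoids? S₂ ω) λ (g , av) → begin
        1 ≤⟨ avoids-split (conf? e) S S₂ (∈-filter⁺ (¬? ∘ conf? e)) av ⟩
        ⟦ avoids? S ω ⟧ + ∑[ f ∈ S ] (⟦ conf? e f ⟧ * ⟦ occ? f ω ⟧)
          ≤⟨ +-mono-≤ (⟦⟧-mono (avoids? S ω) (good? ω ×-dec avoids? S ω) (g ,_))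
               (∑-mono S (λ f → *-monoʳ-≤ ⟦ conf? e f ⟧
                 (⟦⟧-mono (occ? f ω) (occ? f ω ×-dec (good? ω ×-dec avoids? S₂ ω)) (_, g , av)))) ⟩
        ⟦ good? ω ×-dec avoids? S ω ⟧ + ∑[ f ∈ S ] (⟦ conf? e f ⟧ * occ f ω) ∎

    -- Conditionally on avoiding `S`, the probability of `e` at most doubles. Against the
    -- nonconflicting part `S₂` alone, `negdep` loses nothing; putting the conflicting events back
    -- removes at most half of `# S₂`, by the union bound and the induction hypothesis for `S₂`.
    #occ-bound : ∀ m S → length S ≤ m → All Valid S → Sparse S →
                 ∀ {e} → Valid e → q * #occ e S ≤ 2 * wt e * # S
    #occ-bound m S |S|≤m vS sp {e} ve = begin
      q * #occ e S       ≤⟨ *-monoʳ-≤ q (∑-mono Ωs (λ ω → ⟦⟧-mono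
                              (occ? e ω ×-dec (good? ω ×-dec avoids? S ω)) (occ? e ω ×-dec (good? ω ×-dec avoids? S₂ ω))
                              (λ (o , g , av) → o , g , Allₚ.filter⁺ (¬? ∘ conf? e) av))) ⟩
      q * #occ e S₂      ≤⟨ negdep ve (Allₚ.all-filter (¬? ∘ conf? e) S) ⟩
      wt e * # S₂        ≤⟨ *-monoʳ-≤ (wt e) half ⟩
      wt e * (2 * # S)   ≡⟨ assoc′ (wt e) (# S) ⟩
      2 * wt e * # S     ∎
      where
      open ≤-Reasoning
      S₂ : List E
      S₂ = indep e S
      assoc′ : ∀ a b → a * (2 * b) ≡ 2 * a * b
      assoc′ = solve-∀
      sparse₂ : Sparse S₂
      sparse₂ {e′} ve′ = ≤-trans (*-monoʳ-≤ 4 (∑-filter≤ (¬? ∘ conf? e) S _)) (sp ve′)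
      shrinks : ∀ {f} → f ∈ S → Conf e f → length S₂ < length S
      shrinks f∈S c = filter-notAll (¬? ∘ conf? e) S (lose f∈S (λ ¬c → ¬c c))
      -- The hypothesis is invoked only for an `f` in `S` that conflicts with `e`; such an `f` is
      -- missing from `S₂`, so `S₂` is shorter.
      smaller : ∀ m → length S ≤ m → ∀ {f} → f ∈ S → Conf e f → q * #occ f S₂ ≤ 2 * wt f * # S₂
      smaller zero    |S|≤0 f∈S c = contradiction (≤-trans (shrinks f∈S c) |S|≤0) λ ()
      smaller (suc m) |S|≤m f∈S c = #occ-bound m S₂ (s≤s⁻¹ (≤-trans (shrinks f∈S c) |S|≤m))
        (Allₚ.filter⁺ (¬? ∘ conf? e) vS) sparse₂ (All.lookup vS f∈S)
      conflicts : ℕ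
      conflicts = ∑[ f ∈ S ] (⟦ conf? e f ⟧ * #occ f S₂)
      conflicts≤ : 2 * (q * conflicts) ≤ q * # S₂
      -- The 4 of `Sparse` is spent here: 2 for the doubling in the induction hypothesis, 2 to keep
      -- at least half of `# S₂`.
      conflicts≤ = begin
        2 * (q * conflicts)                                     ≡⟨ cong (2 *_) (sym (∑-*ˡ S q _)) ⟩
        2 * (∑[ f ∈ S ] (q * (⟦ conf? e f ⟧ * #occ f S₂)))      ≤⟨ *-monoʳ-≤ 2 (∑-mono∈ S termwise) ⟩
        2 * (∑[ f ∈ S ] (⟦ conf? e f ⟧ * wt f * (2 * # S₂)))    ≡⟨ cong (2 *_) (∑-*ʳ S (2 * # S₂) _) ⟩
        2 * (load e S * (2 * # S₂))  ≡⟨ assoc₂ (load e S) (# S₂) ⟩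
        4 * load e S * # S₂          ≤⟨ *-monoˡ-≤ (# S₂) (sp ve) ⟩
        q * # S₂                                                ∎
        where
        assoc₂ : ∀ a b → 2 * (a * (2 * b)) ≡ 4 * a * b
        assoc₂ = solve-∀
        assoc₃ : ∀ a b c → a * (2 * b * c) ≡ a * b * (2 * c)
        assoc₃ = solve-∀
        assoc₄ : ∀ a b c → a * (b * c) ≡ b * (a * c)
        assoc₄ = solve-∀
        termwise : ∀ {f} → f ∈ S → q * (⟦ conf? e f ⟧ * #occ f S₂) ≤ ⟦ conf? e f ⟧ * wt f * (2 * # S₂)
        termwise {f} f∈S = begin
          q * (⟦ conf? e f ⟧ * #occ f S₂)       ≡⟨ assoc₄ q ⟦ conf? e f ⟧ (#occ f S₂) ⟩
          ⟦ conf? e f ⟧ * (q * #occ f S₂)       ≤⟨ ⟦⟧*-mono (conf? e f) (smaller m |S|≤m f∈S) ⟩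
          ⟦ conf? e f ⟧ * (2 * wt f * # S₂)     ≡⟨ assoc₃ ⟦ conf? e f ⟧ (wt f) (# S₂) ⟩
          ⟦ conf? e f ⟧ * wt f * (2 * # S₂)     ∎
      half : # S₂ ≤ 2 * # S
      half = *-cancelˡ-≤ q {{>-nonZero q>0}} (+-cancelʳ-≤ (q * # S₂) _ _ (begin
        q * # S₂ + q * # S₂              ≡⟨ dbl q (# S₂) ⟩
        2 * q * # S₂                     ≤⟨ *-monoʳ-≤ (2 * q) (#-indep-≤ e S) ⟩
        2 * q * (# S + conflicts)        ≡⟨ dist q (# S) conflicts ⟩
        q * (2 * # S) + 2 * (q * conflicts) ≤⟨ +-monoʳ-≤ _ conflicts≤ ⟩
        q * (2 * # S) + q * # S₂         ∎))
        where
        dbl : ∀ a b → a * b + a * b ≡ 2 * a * b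
        dbl = solve-∀
        dist : ∀ a b c → 2 * a * (b + c) ≡ a * (2 * b) + 2 * (a * c)
        dist = solve-∀

    -- Each further event removes at most half of the outcomes that are left: its conditional
    -- probability is at most 2 · `wt e` over `q`, hence at most 1/2.
    local-lemma : ∀ S → All Valid S → Sparse S → 0 < # [] → 0 < # S
    local-lemma []      _         _  pos = pos
    local-lemma (e ∷ S) (ve ∷ vS) sp pos = *-cancelˡ-< 2 0 _ (+-cancelʳ-< (# S) 0 _ (begin-strict
      # S                              <⟨ m<m+n (# S) (local-lemma S vS sparse′ pos) ⟩
      # S + # S                        ≤⟨ +-mono-≤ split split ⟩
      #′ + #occ e S + (#′ + #occ e S)  ≡⟨ rearr #′ (#occ e S) ⟩
      2 * #′ + 2 * #occ e S            ≤⟨ +-monoʳ-≤ (2 * #′) rare ⟩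
      2 * #′ + # S                     ∎))
      where
      open ≤-Reasoning
      #′ : ℕ
      #′ = # (e ∷ S)
      rearr : ∀ a b → a + b + (a + b) ≡ 2 * a + 2 * b
      rearr = solve-∀
      sparse′ : Sparse S
      sparse′ {e′} ve′ = ≤-trans (*-monoʳ-≤ 4 (m≤n+m (load e′ S) (⟦ conf? e′ e ⟧ * wt e))) (sp ve′)
      split : # S ≤ #′ + #occ e S
      split = ≤-trans (∑-mono Ωs pointwise) (≤-reflexive (∑-+ Ωs _ _))
        where
        pointwise : ∀ ω → ⟦ good? ω ×-dec avoids? S ω ⟧
                  ≤ ⟦ good? ω ×-dec avoids? (e ∷ S) ω ⟧ + ⟦ occ? e ω ×-dec (good? ω ×-dec avoids? S ω) ⟧
        pointwise ω = ⟦⟧-⊎ (good? ω ×-dec avoids? S ω) (good? ω ×-dec avoids? (e ∷ S) ω)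
                           (occ? e ω ×-dec (good? ω ×-dec avoids? S ω)) λ (g , av) → cases g av (occ? e ω)
          where
          cases : Good ω → Avoids S ω → Dec (Occ e ω) →
                  (Good ω × Avoids (e ∷ S) ω) ⊎ (Occ e ω × Good ω × Avoids S ω)
          cases g av (yes o) = inj₂ (o , g , av)
          cases g av (no ¬o) = inj₁ (g , ¬o ∷ av)
      -- An event conflicts with itself, so its own weight is part of its load.
      wt-small : 4 * wt e ≤ q
      wt-small = begin
        4 * wt e                        ≡⟨ cong (4 *_) (sym (*-identityˡ (wt e))) ⟩
        4 * (1 * wt e)                  ≡⟨ cong (λ z → 4 * (z * wt e)) (sym (⟦⟧-yes (conf? e e) (valid⇒conf ve))) ⟩
        4 * (⟦ conf? e e ⟧ * wt e)      ≤⟨ *-monoʳ-≤ 4 (m≤m+n (⟦ conf? e e ⟧ * wt e) (load e S)) ⟩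
        4 * load e (e ∷ S)              ≤⟨ sp ve ⟩
        q                               ∎
      rare : 2 * #occ e S ≤ # S
      rare = *-cancelˡ-≤ q {{>-nonZero q>0}} (begin
        q * (2 * #occ e S)    ≡⟨ assoc₁ q (#occ e S) ⟩
        2 * (q * #occ e S)    ≤⟨ *-monoʳ-≤ 2 (#occ-bound (length S) S ≤-refl vS sparse′ ve) ⟩
        2 * (2 * wt e * # S)  ≡⟨ assoc₂ (wt e) (# S) ⟩
        4 * wt e * # S        ≤⟨ *-monoˡ-≤ (# S) wt-small ⟩
        q * # S               ∎)
        where
        assoc₁ : ∀ a b → a * (2 * b) ≡ 2 * (a * b)
        assoc₁ = solve-∀
        assoc₂ : ∀ a b → 2 * (2 * a * b) ≡ 4 * a * b
        assoc₂ = solve-∀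

-- Transpositions, and the list of all maps

transpose-fst : ∀ (x y : Fin n) → transpose x y x ≡ y
transpose-fst x y rewrite dec-true (x F.≟ x) refl = refl

transpose-other : ∀ {x y z : Fin n} → z ≢ x → z ≢ y → transpose x y z ≡ z
transpose-other {x = x} {y} {z} z≢x z≢y
  rewrite dec-false (z F.≟ x) z≢x | dec-false (z F.≟ y) z≢y = refl

transpose-injective : ∀ (x y : Fin n) {i j} → transpose x y i ≡ transpose x y j → i ≡ j
transpose-injective x y {i} {j} eq =
  trans (sym (transpose-inverse y x)) (trans (cong (transpose y x) eq) (transpose-inverse y x))

-- Once the tail is placed, swapping `ψ a` with `x` sends `a` to `x` and disturbs no earlier image:
-- those differ from `ψ a` by injectivity and from `x` because the targets are distinct.
extend-injection : ∀ {hs xs : List (Fin n)} → Unique hs → Unique xs → length hs ≡ length xs →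
  ∃ λ (ψ : Fin n → Fin n) → (∀ {i j} → ψ i ≡ ψ j → i ≡ j) × map ψ hs ≡ xs
extend-injection {hs = []} {[]} _ _ _ = id , id , refl
extend-injection {hs = a ∷ hs} {x ∷ xs} (a∉ ∷ uh) (x∉ ∷ ux) eq
  with extend-injection uh ux (suc-injective eq)
... | ψ , inj , refl = transpose (ψ a) x ∘ ψ , inj ∘ transpose-injective (ψ a) x ,
  cong₂ _∷_ (transpose-fst (ψ a) x)
    (map-cong-local (All.tabulate λ i∈ → transpose-other
      (λ e → All.lookup a∉ i∈ (inj (sym e)))
      (λ e → All.lookup x∉ (∈-map⁺ ψ i∈) (sym e))))

allVecs : ∀ m → List (Vec (Fin n) m)
allVecs zero    = [] ∷ []
allVecs (suc m) = concatMap (λ i → map (i ∷_) (allVecs m)) (allFin _)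

∈-allVecs : ∀ {m} (v : Vec (Fin n) m) → v ∈ allVecs m
∈-allVecs []      = here refl
∈-allVecs (i ∷ v) = ∈-concatMap⁺ (λ i → map (i ∷_) (allVecs _)) (lose (∈-allFin i) (∈-map⁺ (i ∷_) (∈-allVecs v)))

∑-allVecs-suc : ∀ m (f : Vec (Fin n) (suc m) → ℕ) →
                ∑ (allVecs (suc m)) f ≡ Σᶠ[ i ] ∑[ v ∈ allVecs m ] f (i ∷ v)
∑-allVecs-suc {n} m f = trans (∑-concatMap (allFin n) (λ i → map (i ∷_) (allVecs m)) f)
                              (∑-cong (allFin n) (λ i → ∑-map (allVecs m) (i ∷_) f))

∑-allVecs-injection : ∀ m (f : Vec (Fin n) m → ℕ) (σ : Fin n → Fin n) → (∀ {i j} → σ i ≡ σ j → i ≡ j) →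
                      ∑ (allVecs m) (f ∘ Vec.map σ) ≤ ∑ (allVecs m) f
∑-allVecs-injection zero    f σ inj = ≤-refl
∑-allVecs-injection {n} (suc m) f σ inj = begin
  ∑ (allVecs (suc m)) (f ∘ Vec.map σ)                       ≡⟨ ∑-allVecs-suc m (f ∘ Vec.map σ) ⟩
  Σᶠ[ i ] ∑[ v ∈ allVecs m ] f (σ i ∷ Vec.map σ v)          ≤⟨ ∑-mono (allFin n) (λ i → ∑-allVecs-injection m (λ v → f (σ i ∷ v)) σ inj) ⟩
  Σᶠ[ i ] ∑[ v ∈ allVecs m ] f (σ i ∷ v)                    ≤⟨ Σᶠ-injection (λ i → ∑[ v ∈ allVecs m ] f (i ∷ v)) σ inj ⟩
  Σᶠ[ i ] ∑[ v ∈ allVecs m ] f (i ∷ v)                      ≡⟨ sym (∑-allVecs-suc m f) ⟩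
  ∑ (allVecs (suc m)) f                                     ∎
  where open ≤-Reasoning

-- Events that pin images of a random bijection

module Pins (n : ℕ) where

  Pin : Set
  Pin = Fin n × Fin n

  Embedding : Set
  Embedding = Vec (Fin n) n

  Inj : Embedding → Set
  Inj φ = ∀ i j → lookup φ i ≡ lookup φ j → i ≡ j

  inj? : Decidable Inj
  inj? φ = Fₚ.all? λ i → Fₚ.all? λ j → (lookup φ i F.≟ lookup φ j) →-dec (i F.≟ j)

  Holds : List Pin → Embedding → Set
  Holds P φ = All (λ (u , x) → lookup φ u ≡ x) P

  holds? : ∀ P → Decidable (Holds P)
  holds? P φ = All.all? (λ (u , x) → lookup φ u F.≟ x) P

  -- Wider than incompatibility: a shared pin is a conflict too. Thus a nonempty event conflicts
  -- with itself, and a transposition at a pin of `A` touches nothing that a nonconflicting event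
  -- mentions except its second image.
  Conf : List Pin → List Pin → Set
  Conf A B = Any (λ (u , x) → Any (λ (v , y) → u ≡ v ⊎ x ≡ y) B) A

  conf? : ∀ A → Decidable (Conf A)
  conf? A B = Any.any? (λ (u , x) → Any.any? (λ (v , y) → (u F.≟ v) ⊎-dec (x F.≟ y)) B) A

  Fresh : Fin n → List Pin → Set
  Fresh x P = All (λ (_ , y) → x ≢ y) P

  -- No pin of `P` is moved: its image is not `x`, which `u` occupies, and not `x′`, which is fresh.
  Holds-transpose : ∀ {P u x x′} φ → All (λ (v , _) → u ≢ v) P → Fresh x′ P → Inj φ →
    lookup φ u ≡ x → Holds P φ → Holds P (Vec.map (transpose x x′) φ)
  Holds-transpose φ [] [] inj eq [] = []
  Holds-transpose {P = (v , y) ∷ _} {u} {x} {x′} φ (u≢v ∷ ∉P) (x′≢y ∷ fr) inj eq (e ∷ hs) =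
    trans (lookup-map v _ φ) (trans (cong (transpose x x′) e) (transpose-other
      (λ y≡x → u≢v (inj u v (trans eq (trans (sym y≡x) (sym e))))) (x′≢y ∘ sym)))
    ∷ Holds-transpose φ ∉P fr inj eq hs

  -- After the swap `x′` sits at `u`, which `B` does not pin, and `B` does not name `x`; so the pins
  -- of `B` were already in place. Read contrapositively, the swap preserves avoidance of `B`.
  Holds-transpose⁻ : ∀ {B u x x′} φ → All (λ (v , y) → ¬ (u ≡ v ⊎ x ≡ y)) B → Inj φ →
    lookup φ u ≡ x → Holds B (Vec.map (transpose x x′) φ) → Holds B φ
  Holds-transpose⁻ φ [] inj eq [] = []
  Holds-transpose⁻ {B = (v , y) ∷ _} {u} {x} {x′} φ (¬c ∷ ¬cs) inj eq (e ∷ hs) =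
    trans (sym (transpose-inverse x′ x)) (trans (cong (transpose x′ x) e′) (transpose-other y≢x′ (λ y≡x → ¬c (inj₂ (sym y≡x)))))
    ∷ Holds-transpose⁻ φ ¬cs inj eq hs
    where
    e′ : transpose x x′ (lookup φ v) ≡ y
    e′ = trans (sym (lookup-map v _ φ)) e
    y≢x′ : y ≢ x′
    y≢x′ refl = ¬c (inj₁ (inj u v (trans eq (transpose-injective x x′
      (trans (transpose-fst x x′) (sym e′))))))

  Inj-transpose : ∀ x x′ φ → Inj φ → Inj (Vec.map (transpose x x′) φ)
  Inj-transpose x x′ φ inj i j e = inj i j (transpose-injective x x′
    (trans (sym (lookup-map i _ φ)) (trans e (lookup-map j _ φ))))

  fresh? : ∀ P → Decidable (λ x → Fresh x P)
  fresh? P x = All.all? (λ (_ , y) → ¬? (x F.≟ y)) P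

  fresh-count : ∀ P → n ∸ length P ≤ Σᶠ[ x ] ⟦ fresh? P x ⟧
  fresh-count P = m≤n+o⇒m∸n≤o n (length P) (begin
    n                                            ≡⟨ sym (trans (∑-const (allFin n) 1) (trans (*-identityʳ (length (allFin n))) (length-allFin n))) ⟩
    ∑[ _ ∈ allFin n ] 1                          ≤⟨ ∑-mono (allFin n) (pointwise P) ⟩
    Σᶠ[ x ] ((∑[ b ∈ P ] ⟦ x F.≟ proj₂ b ⟧) + ⟦ fresh? P x ⟧)
      ≡⟨ ∑-+ (allFin n) (λ x → ∑[ b ∈ P ] ⟦ x F.≟ proj₂ b ⟧) _ ⟩
    (Σᶠ[ x ] ∑[ b ∈ P ] ⟦ x F.≟ proj₂ b ⟧) + fresh
      ≡⟨ cong (_+ fresh) (∑-swap (allFin n) P (λ x b → ⟦ x F.≟ proj₂ b ⟧)) ⟩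
    (∑[ b ∈ P ] Σᶠ[ x ] ⟦ x F.≟ proj₂ b ⟧) + fresh
      ≤⟨ +-monoˡ-≤ fresh (∑-≤-const P 1 (λ b → Σᶠ-≤1 (λ x → x F.≟ proj₂ b) (λ p q → trans p (sym q)))) ⟩
    length P * 1 + fresh  ≡⟨ cong (_+ fresh) (*-identityʳ _) ⟩
    length P + fresh ∎)
    where
    open ≤-Reasoning
    fresh : ℕ
    fresh = Σᶠ[ x ] ⟦ fresh? P x ⟧
    pointwise : ∀ P x → 1 ≤ (∑[ b ∈ P ] ⟦ x F.≟ proj₂ b ⟧) + ⟦ fresh? P x ⟧
    pointwise []            x = ≤-refl
    pointwise ((u , y) ∷ P) x = cases (x F.≟ y)
      where
      rest : ℕ
      rest = ∑[ b ∈ P ] ⟦ x F.≟ proj₂ b ⟧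
      cases : Dec (x ≡ y) → 1 ≤ ⟦ x F.≟ y ⟧ + rest + ⟦ fresh? ((u , y) ∷ P) x ⟧
      cases (yes p) = begin
        1                    ≡⟨ sym (⟦⟧-yes (x F.≟ y) p) ⟩
        ⟦ x F.≟ y ⟧          ≤⟨ m≤m+n _ rest ⟩
        ⟦ x F.≟ y ⟧ + rest   ≤⟨ m≤m+n _ _ ⟩
        ⟦ x F.≟ y ⟧ + rest + ⟦ fresh? ((u , y) ∷ P) x ⟧ ∎
      cases (no ¬p) = begin
        1                           ≤⟨ pointwise P x ⟩
        rest + ⟦ fresh? P x ⟧       ≤⟨ +-mono-≤ (m≤n+m rest ⟦ x F.≟ y ⟧) (⟦⟧-mono (fresh? P x) (fresh? ((u , y) ∷ P) x) (¬p ∷_)) ⟩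
        ⟦ x F.≟ y ⟧ + rest + ⟦ fresh? ((u , y) ∷ P) x ⟧ ∎

  module _ {Q : Embedding → Set} (Q? : Decidable Q) where

    count : List Pin → ℕ
    count P = ∑[ φ ∈ allVecs n ] ⟦ holds? P φ ×-dec (inj? φ ×-dec Q? φ) ⟧

    Stable : Pin → Set
    Stable (u , x) = ∀ x′ φ → Inj φ → lookup φ u ≡ x → Q φ → Q (Vec.map (transpose x x′) φ)

    -- The transposition of `x` and `x′` carries the embeddings on the left injectively into those
    -- on the right, so a fresh image is at least as frequent as `x`.
    repin : ∀ {P u x x′} → All (λ (v , _) → u ≢ v) P → Stable (u , x) → Fresh x′ P →
            count ((u , x) ∷ P) ≤ count ((u , x′) ∷ P)
    repin {P} {u} {x} {x′} ∉P stable fr = begin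
      count ((u , x) ∷ P)                     ≤⟨ ∑-mono (allVecs n) (λ φ → ⟦⟧-mono (good? x φ) (good? x′ (Vec.map (transpose x x′) φ)) (moved φ)) ⟩
      ∑[ φ ∈ allVecs n ] new (Vec.map (transpose x x′) φ) ≤⟨ ∑-allVecs-injection n new (transpose x x′) (transpose-injective x x′) ⟩
      count ((u , x′) ∷ P)                    ∎
      where
      open ≤-Reasoning
      Good : Fin n → Embedding → Set
      Good y φ = Holds ((u , y) ∷ P) φ × Inj φ × Q φ
      good? : ∀ y φ → Dec (Good y φ)
      good? y φ = holds? ((u , y) ∷ P) φ ×-dec (inj? φ ×-dec Q? φ)
      new : Embedding → ℕ
      new φ = ⟦ good? x′ φ ⟧
      moved : ∀ φ → Good x φ → Good x′ (Vec.map (transpose x x′) φ)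
      moved φ (refl ∷ hP , inj , qφ) =
        trans (lookup-map u _ φ) (transpose-fst x x′) ∷ Holds-transpose φ ∉P fr inj refl hP ,
        Inj-transpose x x′ φ inj , stable x′ φ inj refl qφ

    pin-total : ∀ P u → Σᶠ[ x ] count ((u , x) ∷ P) ≤ count P
    pin-total P u = begin
      Σᶠ[ x ] count ((u , x) ∷ P)     ≡⟨ ∑-swap (allFin n) (allVecs n) (λ x φ → ⟦ good? x φ ⟧) ⟩
      ∑[ φ ∈ allVecs n ] Σᶠ[ x ] ⟦ good? x φ ⟧  ≤⟨ ∑-mono (allVecs n) at-most ⟩
      count P ∎
      where
      open ≤-Reasoning
      good? : ∀ x φ → Dec (Holds ((u , x) ∷ P) φ × Inj φ × Q φ)
      good? x φ = holds? ((u , x) ∷ P) φ ×-dec (inj? φ ×-dec Q? φ)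
      rest : Embedding → ℕ
      rest φ = ⟦ holds? P φ ×-dec (inj? φ ×-dec Q? φ) ⟧
      at-most : ∀ φ → Σᶠ[ x ] ⟦ good? x φ ⟧ ≤ rest φ
      at-most φ = begin
        Σᶠ[ x ] ⟦ good? x φ ⟧   ≤⟨ ∑-mono (allFin n) (λ x → ⟦⟧-≤ (good? x φ) λ { (e ∷ hP , r) →
            ≤-reflexive (sym (cong₂ _*_ (⟦⟧-yes (lookup φ u F.≟ x) e)
              (⟦⟧-yes (holds? P φ ×-dec (inj? φ ×-dec Q? φ)) (hP , r)))) }) ⟩
        Σᶠ[ x ] (⟦ lookup φ u F.≟ x ⟧ * rest φ)  ≤⟨ Σᶠ-pick (λ _ → rest φ) (λ x → lookup φ u F.≟ x) (lookup φ u) (λ _ → sym) ⟩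
        rest φ ∎

    -- At least n - |P| images are fresh, each is at least as frequent as `x` by `repin`, and all
    -- the frequencies together are at most `count P`.
    pin-step : ∀ {P u x} → All (λ (v , _) → u ≢ v) P → Stable (u , x) →
               (n ∸ length P) * count ((u , x) ∷ P) ≤ count P
    pin-step {P} {u} {x} ∉P stable = begin
      (n ∸ length P) * count ((u , x) ∷ P)                ≤⟨ *-monoˡ-≤ (count ((u , x) ∷ P)) (fresh-count P) ⟩
      (Σᶠ[ x′ ] ⟦ fresh? P x′ ⟧) * count ((u , x) ∷ P)    ≡⟨ sym (∑-*ʳ (allFin n) (count ((u , x) ∷ P)) _) ⟩
      Σᶠ[ x′ ] (⟦ fresh? P x′ ⟧ * count ((u , x) ∷ P))    ≤⟨ ∑-mono (allFin n) (λ x′ → ⟦⟧*-≤ (fresh? P x′) (repin ∉P stable)) ⟩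
      Σᶠ[ x′ ] count ((u , x′) ∷ P)                       ≤⟨ pin-total P u ⟩
      count P                                             ∎
      where open ≤-Reasoning

    -- The pins of `A` come off one at a time, each for a factor `p`. The room condition allows
    -- `suc n` because the head pin is placed with only |A| - 1 + |P| others present.
    pin-all : ∀ p A {P} → Unique (map proj₁ A) → All (λ (u , _) → All (λ (v , _) → u ≢ v) P) A →
              All Stable A → p + (length A + length P) ≤ suc n →
              p ^ length A * count (A ++ P) ≤ count P
    pin-all p []            {P} _ _ _ _ = ≤-reflexive (+-identityʳ _)
    pin-all p ((u , x) ∷ A) {P} (u∉A ∷ uniq) (u∉P ∷ ∉P) (st ∷ sts) room = begin
      p * p ^ length A * count ((u , x) ∷ A ++ P)       ≡⟨ comm p (p ^ length A) _ ⟩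
      p ^ length A * (p * count ((u , x) ∷ A ++ P))     ≤⟨ *-monoʳ-≤ (p ^ length A) (*-monoˡ-≤ _ p≤) ⟩
      p ^ length A * ((n ∸ length (A ++ P)) * count ((u , x) ∷ A ++ P))
        ≤⟨ *-monoʳ-≤ (p ^ length A) (pin-step (Allₚ.++⁺ (Allₚ.map⁻ u∉A) u∉P) st) ⟩
      p ^ length A * count (A ++ P)                     ≤⟨ pin-all p A uniq ∉P sts (≤-trans (+-monoʳ-≤ p (n≤1+n _)) room) ⟩
      count P                                           ∎
      where
      open ≤-Reasoning
      comm : ∀ a b c → a * b * c ≡ b * (a * c)
      comm = solve-∀
      p≤ : p ≤ n ∸ length (A ++ P)
      p≤ = m+n≤o⇒m≤o∸n p (subst (λ l → p + l ≤ n) (sym (length-++ A))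
             (s≤s⁻¹ (subst (_≤ suc n) (+-suc p _) room)))

  module _ (P₀ : List Pin) (p : ℕ) (p>0 : 0 < p) (room : p + (3 + length P₀) ≤ suc n) where

    Free : Fin n → Set
    Free u = All (λ (v , _) → u ≢ v) P₀

    record Valid (A : List Pin) : Set where
      constructor valid
      field
        nonempty : 1 ≤ length A
        short    : length A ≤ 3
        distinct : Unique (map proj₁ A)
        free     : All (Free ∘ proj₁) A

    -- The bound 1/p^|A| on the probability, times `p ^ 3`; valid events have at most three pins, so
    -- the subtraction does not truncate.
    weight : List Pin → ℕ
    weight A = p ^ (3 ∸ length A)

    incidence : Fin n → Fin n → List Pin → ℕ
    incidence u x B = ∑[ (v , y) ∈ B ] (⟦ u F.≟ v ⟧ + ⟦ x F.≟ y ⟧)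

    BaseGood : Embedding → Set
    BaseGood φ = Inj φ × Holds P₀ φ

    baseGood? : Decidable BaseGood
    baseGood? φ = inj? φ ×-dec holds? P₀ φ

    private
      module LL = LocalLemma (allVecs n) baseGood? holds? conf? Valid weight (p ^ 3)
                    (m^n>0 p {{>-nonZero p>0}} 3)

    open LL public using (Avoids)

    valid⇒conf : ∀ {A} → Valid A → Conf A A
    valid⇒conf {_ ∷ _} _ = here (here (inj₁ refl))

    Avoids-stable : ∀ {A S} → All (λ B → ¬ Conf A B) S →
                    All (Stable (LL.avoids? S)) A
    Avoids-stable {A} {S} ¬cs = All.tabulate λ {(u , x)} a∈ x′ φ inj eq av →
      All.zipWith (λ {B} (¬c , ¬h) h → ¬h (Holds-transpose⁻ φ
        (All.tabulate (λ b∈ clash → ¬c (lose a∈ (lose b∈ clash)))) inj eq h)) (¬cs , av)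

    -- By `Avoids-stable` the repinning argument stays inside the condition of avoiding `S`, so the
    -- pins of `A` cost `p` each under that condition as well.
    negative-dependence : ∀ {A S} → Valid A → All (λ B → ¬ Conf A B) S →
                          p ^ 3 * LL.#occ A S ≤ weight A * LL.# S
    negative-dependence {A} {S} (valid _ short dist free) ¬cs = begin
      p ^ 3 * LL.#occ A S                              ≡⟨ cong (λ e → p ^ e * LL.#occ A S) (sym (m∸n+n≡m short)) ⟩
      p ^ (3 ∸ length A + length A) * LL.#occ A S      ≡⟨ cong (_* LL.#occ A S) (^-distribˡ-+-* p (3 ∸ length A) (length A)) ⟩
      weight A * p ^ length A * LL.#occ A S            ≡⟨ *-assoc (weight A) _ _ ⟩
      weight A * (p ^ length A * LL.#occ A S)          ≤⟨ *-monoʳ-≤ (weight A) (begin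
          p ^ length A * LL.#occ A S                   ≤⟨ *-monoʳ-≤ (p ^ length A) (∑-mono (allVecs n) (λ φ → ⟦⟧-mono
                                                            (holds? A φ ×-dec (baseGood? φ ×-dec Q? φ))
                                                            (holds? (A ++ P₀) φ ×-dec (inj? φ ×-dec Q? φ))
                                                            (λ (hA , (inj , hP) , av) → Allₚ.++⁺ hA hP , inj , av))) ⟩
          p ^ length A * count Q? (A ++ P₀)            ≤⟨ pin-all Q? p A dist free (Avoids-stable {A} {S} ¬cs)
                                                            (≤-trans (+-monoʳ-≤ p (+-monoˡ-≤ (length P₀) short)) room) ⟩
          count Q? P₀                                  ≤⟨ ∑-mono (allVecs n) (λ φ → ⟦⟧-mono
                                                            (holds? P₀ φ ×-dec (inj? φ ×-dec Q? φ))
                                                            (baseGood? φ ×-dec Q? φ)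
                                                            (λ (hP , inj , av) → (inj , hP) , av)) ⟩
          LL.# S                                       ∎) ⟩
      weight A * LL.# S                                ∎
      where
      open ≤-Reasoning
      Q? : Decidable (Avoids S)
      Q? = LL.avoids? S

    load-≤ : ∀ A S → LL.load A S ≤ ∑[ (u , x) ∈ A ] ∑[ B ∈ S ] (weight B * incidence u x B)
    load-≤ A S = ≤-trans (∑-mono S pointwise) (≤-reflexive (sym (∑-swap A S (λ (u , x) B → weight B * incidence u x B))))
      where
      open ≤-Reasoning
      pointwise : ∀ B → ⟦ conf? A B ⟧ * weight B ≤ ∑[ (u , x) ∈ A ] (weight B * incidence u x B)
      pointwise B = begin
        ⟦ conf? A B ⟧ * weight B       ≡⟨ *-comm ⟦ conf? A B ⟧ (weight B) ⟩
        weight B * ⟦ conf? A B ⟧       ≤⟨ *-monoʳ-≤ (weight B) (⟦⟧-≤ (conf? A B) conf⇒) ⟩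
        weight B * (∑[ (u , x) ∈ A ] incidence u x B)  ≡⟨ sym (∑-*ˡ A (weight B) _) ⟩
        ∑[ (u , x) ∈ A ] (weight B * incidence u x B) ∎
        where
        clash⇒ : ∀ u x {v y} → u ≡ v ⊎ x ≡ y → 1 ≤ ⟦ u F.≟ v ⟧ + ⟦ x F.≟ y ⟧
        clash⇒ u x {v} {y} (inj₁ e) = ≤-trans (≤-reflexive (sym (⟦⟧-yes (u F.≟ v) e))) (m≤m+n _ _)
        clash⇒ u x {v} {y} (inj₂ e) = ≤-trans (≤-reflexive (sym (⟦⟧-yes (x F.≟ y) e))) (m≤n+m _ ⟦ u F.≟ v ⟧)
        conf⇒ : Conf A B → 1 ≤ ∑[ (u , x) ∈ A ] incidence u x B
        conf⇒ c with find c
        ... | (u , x) , a∈ , c′ with find c′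
        ...   | (v , y) , b∈ , e = begin
          1                              ≤⟨ clash⇒ u x e ⟩
          ⟦ u F.≟ v ⟧ + ⟦ x F.≟ y ⟧      ≤⟨ ∈⇒≤∑ (λ (v , y) → ⟦ u F.≟ v ⟧ + ⟦ x F.≟ y ⟧) b∈ ⟩
          incidence u x B                ≤⟨ ∈⇒≤∑ (λ (u , x) → incidence u x B) a∈ ⟩
          ∑[ (u , x) ∈ A ] incidence u x B ∎

    -- The 12 is 3 · 4: an event has at most three pins, and its load is at most the sum of the
    -- loads at its pins. The given `φ₀` shows that there are outcomes at all.
    embed : ∀ S → All Valid S →
            (∀ {u} → Free u → ∀ x → 12 * ∑[ B ∈ S ] (weight B * incidence u x B) ≤ p ^ 3) →
            ∀ φ₀ → BaseGood φ₀ → ∃ λ φ → BaseGood φ × Avoids S φ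
    embed S vS sparse φ₀ good₀ = φ , ⟦⟧-pos (baseGood? φ ×-dec LL.avoids? S φ) (proj₂ found)
      where
      open ≤-Reasoning
      sparse′ : LL.Sparse S
      sparse′ {A} (valid _ short _ free) = *-cancelˡ-≤ 3 (begin
        3 * (4 * LL.load A S)       ≡⟨ sym (*-assoc 3 4 (LL.load A S)) ⟩
        12 * LL.load A S            ≤⟨ *-monoʳ-≤ 12 (load-≤ A S) ⟩
        12 * total                  ≡⟨ sym (∑-*ˡ A 12 inc) ⟩
        ∑[ a ∈ A ] (12 * inc a)     ≤⟨ ∑-≤-const∈ A (p ^ 3) (λ {(_ , x)} a∈ → sparse (All.lookup free a∈) x) ⟩
        length A * p ^ 3            ≤⟨ *-monoˡ-≤ (p ^ 3) short ⟩
        3 * p ^ 3                   ∎)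
        where
        inc : Pin → ℕ
        inc (u , x) = ∑[ B ∈ S ] (weight B * incidence u x B)
        total : ℕ
        total = ∑ A inc
      nonzero : 0 < LL.# []
      nonzero = ≤-trans (≤-reflexive (sym (⟦⟧-yes (baseGood? φ₀ ×-dec LL.avoids? [] φ₀) (good₀ , []))))
                (∈⇒≤∑ (λ φ → ⟦ baseGood? φ ×-dec LL.avoids? [] φ ⟧) (∈-allVecs φ₀))
      found : ∃ λ φ → 0 < ⟦ baseGood? φ ×-dec LL.avoids? S φ ⟧
      found = ∑-pos (allVecs n) (LL.local-lemma valid⇒conf negative-dependence S vS sparse′ nonzero)
      φ : Embedding
      φ = proj₁ found

-- Cherries at an end, at a centre, and high vertices

sq-cancel-≤ : ∀ {a b} → a * a ≤ b * b → a ≤ b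
sq-cancel-≤ {a} {b} h with a ≤? b
... | yes p = p
... | no ¬p = contradiction h (<⇒≱ (*-mono-< (≰⇒> ¬p) (≰⇒> ¬p)))

m≤m² : ∀ m → m ≤ m * m
m≤m² zero    = z≤n
m≤m² (suc m) = m≤m*n (suc m) (suc m)

2ab≤a²+b² : ∀ a b → 2 * (a * b) ≤ a * a + b * b
2ab≤a²+b² zero    b       = z≤n
2ab≤a²+b² (suc a) zero    = subst (_≤ suc a * suc a + 0) (sym (cong (2 *_) (*-zeroʳ (suc a)))) z≤n
2ab≤a²+b² (suc a) (suc b) = begin
  2 * (suc a * suc b)                          ≡⟨ lhs a b ⟩
  2 * (a * b) + (2 * a + 2 * b + 2)            ≤⟨ +-monoˡ-≤ _ (2ab≤a²+b² a b) ⟩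
  a * a + b * b + (2 * a + 2 * b + 2)          ≡⟨ rhs a b ⟩
  suc a * suc a + suc b * suc b                ∎
  where
  open ≤-Reasoning
  lhs : ∀ a b → 2 * ((1 + a) * (1 + b)) ≡ 2 * (a * b) + (2 * a + 2 * b + 2)
  lhs = solve-∀
  rhs : ∀ a b → a * a + b * b + (2 * a + 2 * b + 2) ≡ (1 + a) * (1 + a) + (1 + b) * (1 + b)
  rhs = solve-∀

-- Sums 2 f(x) f(y) ≤ f(x)² + f(y)² over all pairs with the weights w(x) w(y).
cauchy-schwarz : ∀ (xs : List A) (w f : A → ℕ) →
  (∑[ x ∈ xs ] (w x * f x)) * (∑[ x ∈ xs ] (w x * f x)) ≤ ∑ xs w * (∑[ x ∈ xs ] (w x * (f x * f x)))
cauchy-schwarz xs w f = *-cancelˡ-≤ 2 (begin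
  2 * (wf * wf)                                              ≡⟨ cong (2 *_) (expand wfs wfs) ⟩
  2 * (∑[ x ∈ xs ] ∑[ y ∈ xs ] (wfs x * wfs y))              ≡⟨ sym (∑∑-*ˡ 2 (λ x y → wfs x * wfs y)) ⟩
  ∑[ x ∈ xs ] ∑[ y ∈ xs ] (2 * (wfs x * wfs y))              ≤⟨ ∑-mono xs (λ x → ∑-mono xs (pointwise x)) ⟩
  ∑[ x ∈ xs ] ∑[ y ∈ xs ] (w x * wff y + wff x * w y)        ≡⟨ ∑-cong xs (λ x → ∑-+ xs (λ y → w x * wff y) (λ y → wff x * w y)) ⟩
  ∑[ x ∈ xs ] ((∑[ y ∈ xs ] (w x * wff y)) + (∑[ y ∈ xs ] (wff x * w y)))
    ≡⟨ ∑-+ xs (λ x → ∑[ y ∈ xs ] (w x * wff y)) (λ x → ∑[ y ∈ xs ] (wff x * w y)) ⟩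
  (∑[ x ∈ xs ] ∑[ y ∈ xs ] (w x * wff y)) + (∑[ x ∈ xs ] ∑[ y ∈ xs ] (wff x * w y))
    ≡⟨ cong₂ _+_ (sym (expand w wff)) (sym (expand wff w)) ⟩
  ∑ xs w * ∑ xs wff + ∑ xs wff * ∑ xs w                      ≡⟨ double (∑ xs w) (∑ xs wff) ⟩
  2 * (∑ xs w * ∑ xs wff)                                    ∎)
  where
  open ≤-Reasoning
  wfs wff : _ → ℕ
  wfs x = w x * f x
  wff x = w x * (f x * f x)
  wf : ℕ
  wf = ∑ xs wfs
  double : ∀ a b → a * b + b * a ≡ 2 * (a * b)
  double = solve-∀
  expand : ∀ (g h : _ → ℕ) → ∑ xs g * ∑ xs h ≡ ∑[ x ∈ xs ] ∑[ y ∈ xs ] (g x * h y)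
  expand g h = sym (trans (∑-cong xs (λ x → ∑-*ˡ xs (g x) h)) (∑-*ʳ xs (∑ xs h) g))
  ∑∑-*ˡ : ∀ c (g : _ → _ → ℕ) → ∑[ x ∈ xs ] ∑[ y ∈ xs ] (c * g x y) ≡ c * (∑[ x ∈ xs ] ∑[ y ∈ xs ] g x y)
  ∑∑-*ˡ c g = trans (∑-cong xs (λ x → ∑-*ˡ xs c (g x))) (∑-*ˡ xs c (λ x → ∑ xs (g x)))
  pointwise : ∀ x y → 2 * (wfs x * wfs y) ≤ w x * wff y + wff x * w y
  pointwise x y = begin
    2 * (wfs x * wfs y)                          ≡⟨ lhs (w x) (f x) (w y) (f y) ⟩
    w x * w y * (2 * (f x * f y))                ≤⟨ *-monoʳ-≤ (w x * w y) (2ab≤a²+b² (f x) (f y)) ⟩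
    w x * w y * (f x * f x + f y * f y)          ≡⟨ rhs (w x) (f x) (w y) (f y) ⟩
    w x * wff y + wff x * w y                    ∎
    where
    lhs : ∀ a b c d → 2 * (a * b * (c * d)) ≡ a * c * (2 * (b * d))
    lhs = solve-∀
    rhs : ∀ a b c d → a * c * (b * b + d * d) ≡ a * (c * (d * d)) + a * (b * b) * c
    rhs = solve-∀

module CherryCount {n : ℕ} (G : Graph n) where

  Edge : Fin n → Fin n → Set
  Edge u v = Adj G u v ≡ true

  edge? : ∀ u v → Dec (Edge u v)
  edge? u v = Adj G u v Bₚ.≟ true

  edge-sym : ∀ {u v} → Edge u v → Edge v u
  edge-sym {u} {v} e = trans (symm G v u) e

  edge-irrefl : ∀ {u v} → Edge u v → u ≢ v
  edge-irrefl {u} e refl with trans (sym e) (irrefl G u)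
  ... | ()

  Cherry : Fin n → Fin n → Fin n → Set
  Cherry a v b = Edge a v × Edge v b × a ≢ b

  cherry? : ∀ a v b → Dec (Cherry a v b)
  cherry? a v b = edge? a v ×-dec (edge? v b ×-dec ¬? (a F.≟ b))

  χ : Fin n → Fin n → Fin n → ℕ
  χ a v b = ⟦ cherry? a v b ⟧

  χ-sym : ∀ a v b → χ a v b ≤ χ b v a
  χ-sym a v b = ⟦⟧-mono (cherry? a v b) (cherry? b v a) (λ (p , q , a≢b) → edge-sym q , edge-sym p , a≢b ∘ sym)

  degree : Fin n → ℕ
  degree v = Σᶠ[ b ] ⟦ edge? v b ⟧

  centred : Fin n → ℕ
  centred v = Σᶠ[ a ] Σᶠ[ b ] χ a v b

  ended : Fin n → ℕ
  ended a = Σᶠ[ v ] Σᶠ[ b ] χ a v b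

  2R : ℕ
  2R = 2 * cherries G

  -- Each cherry is listed twice, once for every order of its ends.
  Σ-centred : Σᶠ[ v ] centred v ≤ 2R
  Σ-centred = begin
    Σᶠ[ v ] Σᶠ[ a ] Σᶠ[ b ] χ a v b
      ≤⟨ ∑-mono V (λ v → ∑-mono V (λ a → ∑-mono V (split v a))) ⟩
    Σᶠ[ v ] Σᶠ[ a ] Σᶠ[ b ] (lt v a b + lt v b a)
      ≡⟨ ∑-cong V (λ v → trans (∑-cong V (λ a → ∑-+ V (lt v a) (λ b → lt v b a)))
                               (∑-+ V (λ a → Σᶠ (lt v a)) (λ a → Σᶠ[ b ] lt v b a))) ⟩
    Σᶠ[ v ] ((Σᶠ[ a ] Σᶠ[ b ] lt v a b) + (Σᶠ[ a ] Σᶠ[ b ] lt v b a))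
      ≡⟨ ∑-cong V (λ v → cong (Σᶠ (λ a → Σᶠ (lt v a)) +_)
           (trans (∑-swap V V (λ a b → lt v b a)) (sym (+-identityʳ _)))) ⟩
    Σᶠ[ v ] (2 * (Σᶠ[ a ] Σᶠ[ b ] lt v a b))
      ≡⟨ ∑-*ˡ V 2 (λ v → Σᶠ[ a ] Σᶠ[ b ] lt v a b) ⟩
    2R ∎
    where
    open ≤-Reasoning
    V : List (Fin n)
    V = allFin n
    lt : Fin n → Fin n → Fin n → ℕ
    lt v a b = if ⌊ toℕ a <? toℕ b ⌋ ∧ Adj G a v ∧ Adj G v b then 1 else 0
    lt≥1 : ∀ {v a b} → toℕ a < toℕ b → Edge a v → Edge v b → 1 ≤ lt v a b
    lt≥1 {v} {a} {b} a<b av vb with toℕ a <? toℕ b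
    ... | yes _ rewrite av | vb = ≤-refl
    ... | no ¬p = contradiction a<b ¬p
    split : ∀ v a b → χ a v b ≤ lt v a b + lt v b a
    split v a b = ⟦⟧-≤ (cherry? a v b) cases
      where
      cases : Cherry a v b → 1 ≤ lt v a b + lt v b a
      cases (av , vb , a≢b) with <-cmp (toℕ a) (toℕ b)
      ... | tri< a<b _ _ = ≤-trans (lt≥1 a<b av vb) (m≤m+n _ _)
      ... | tri≈ _ a≡b _ = contradiction (Fₚ.toℕ-injective a≡b) a≢b
      ... | tri> _ _ b<a = ≤-trans (lt≥1 b<a (edge-sym vb) (edge-sym av)) (m≤n+m _ (lt v a b))

  χ-partners-< : ∀ {a v} → Edge a v → suc (Σᶠ[ b ] χ a v b) ≤ degree v
  χ-partners-< {a} {v} av = begin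
    1 + (Σᶠ[ b ] χ a v b)                   ≤⟨ +-monoˡ-≤ _ (≤-trans (≤-reflexive (sym (⟦⟧-yes (a F.≟ a) refl))) (≤Σᶠ (λ b → ⟦ b F.≟ a ⟧) a)) ⟩
    (Σᶠ[ b ] ⟦ b F.≟ a ⟧) + (Σᶠ[ b ] χ a v b) ≡⟨ sym (∑-+ (allFin n) (λ b → ⟦ b F.≟ a ⟧) (χ a v)) ⟩
    Σᶠ[ b ] (⟦ b F.≟ a ⟧ + χ a v b)          ≤⟨ ∑-mono (allFin n) (λ b → pointwise b (b F.≟ a)) ⟩
    degree v ∎
    where
    open ≤-Reasoning
    pointwise : ∀ b → (d : Dec (b ≡ a)) → ⟦ d ⟧ + χ a v b ≤ ⟦ edge? v b ⟧
    pointwise b (yes refl) = begin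
      1 + χ a v a    ≡⟨ cong suc (⟦⟧-no (cherry? a v a) (λ (_ , _ , a≢a) → a≢a refl)) ⟩
      1              ≡⟨ sym (⟦⟧-yes (edge? v a) (edge-sym av)) ⟩
      ⟦ edge? v a ⟧  ∎
    pointwise b (no _) = ⟦⟧-mono (cherry? a v b) (edge? v b) (proj₁ ∘ proj₂)

  degree-≤ : ∀ {a v} → Edge a v → degree v ≤ (Σᶠ[ b ] χ a v b) + 1
  degree-≤ {a} {v} av = begin
    degree v                                    ≤⟨ ∑-mono (allFin n) (λ b → ⟦⟧-⊎ (edge? v b) (cherry? a v b) (b F.≟ a) (cases b)) ⟩
    Σᶠ[ b ] (χ a v b + ⟦ b F.≟ a ⟧)             ≡⟨ ∑-+ (allFin n) (χ a v) (λ b → ⟦ b F.≟ a ⟧) ⟩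
    (Σᶠ[ b ] χ a v b) + (Σᶠ[ b ] ⟦ b F.≟ a ⟧)   ≤⟨ +-monoʳ-≤ _ (Σᶠ-≤1 (F._≟ a) (λ p q → trans p (sym q))) ⟩
    (Σᶠ[ b ] χ a v b) + 1                       ∎
    where
    open ≤-Reasoning
    cases : ∀ b → Edge v b → Cherry a v b ⊎ b ≡ a
    cases b vb with b F.≟ a
    ... | yes p = inj₂ p
    ... | no ¬p = inj₁ (av , vb , ¬p ∘ sym)

  -- Each of the d neighbours, taken as one end, leaves d - 1 choices for the other, so d(d - 1) ≤
  -- `centred v`; this is written without subtraction.
  degree²-≤ : ∀ v → degree v * degree v ≤ centred v + degree v
  degree²-≤ v = begin
    degree v * degree v                               ≡⟨ sym (∑-*ʳ V (degree v) (λ a → ⟦ edge? v a ⟧)) ⟩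
    Σᶠ[ a ] (⟦ edge? v a ⟧ * degree v)                ≤⟨ ∑-mono V (λ a → pointwise a (edge? v a)) ⟩
    Σᶠ[ a ] ((Σᶠ[ b ] χ a v b) + ⟦ edge? v a ⟧)       ≡⟨ ∑-+ V (λ a → Σᶠ[ b ] χ a v b) (λ a → ⟦ edge? v a ⟧) ⟩
    centred v + degree v                              ∎
    where
    open ≤-Reasoning
    V : List (Fin n)
    V = allFin n
    pointwise : ∀ a (d : Dec (Edge v a)) → ⟦ d ⟧ * degree v ≤ (Σᶠ[ b ] χ a v b) + ⟦ d ⟧
    pointwise a (yes va) = ≤-trans (≤-reflexive (*-identityˡ _)) (degree-≤ (edge-sym va))
    pointwise a (no _)   = z≤n

  pred-degree² : ∀ v → pred (degree v) * pred (degree v) ≤ centred v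
  pred-degree² v = go (degree v) (degree²-≤ v)
    where
    expand : ∀ m → (1 + m) * (1 + m) ≡ m * m + m + (1 + m)
    expand = solve-∀
    go : ∀ d → d * d ≤ centred v + d → pred d * pred d ≤ centred v
    go zero    _ = z≤n
    go (suc m) h = ≤-trans (m≤m+n (m * m) m)
      (+-cancelʳ-≤ (suc m) _ _ (subst (_≤ centred v + suc m) (expand m) h))

  -- `ended a` is at most the sum of deg v - 1 over the neighbours v of `a`, and the squares of
  -- these terms sum to at most the number of ordered cherries. Cauchy-Schwarz weighted by the edge
  -- indicator joins the two.
  ended²-≤ : ∀ a → ended a * ended a ≤ degree a * 2R
  ended²-≤ a = begin
    ended a * ended a        ≤⟨ *-mono-≤ ended≤ ended≤ ⟩
    S * S                    ≤⟨ cauchy-schwarz V (λ v → ⟦ edge? a v ⟧) f ⟩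
    degree a * (Σᶠ[ v ] (⟦ edge? a v ⟧ * (f v * f v)))
      ≤⟨ *-monoʳ-≤ (degree a) (≤-trans (∑-mono V (λ v → ≤-trans (⟦⟧*≤ (edge? a v) _) (pred-degree² v))) Σ-centred) ⟩
    degree a * 2R            ∎
    where
    open ≤-Reasoning
    V : List (Fin n)
    V = allFin n
    f : Fin n → ℕ
    f v = pred (degree v)
    S : ℕ
    S = Σᶠ[ v ] (⟦ edge? a v ⟧ * f v)
    pointwise : ∀ v (d : Dec (Edge a v)) → Σᶠ[ b ] χ a v b ≤ ⟦ d ⟧ * f v
    pointwise v (yes av) = ≤-trans (pred-mono-≤ (χ-partners-< av)) (≤-reflexive (sym (*-identityˡ _)))
    pointwise v (no ¬av) = ≤-reflexive (trans (∑-cong V (λ b → ⟦⟧-no (cherry? a v b) (¬av ∘ proj₁))) (∑-zero V))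
    ended≤ : ended a ≤ S
    ended≤ = ∑-mono V (λ v → pointwise v (edge? a v))

  centred≤2R : ∀ v → centred v ≤ 2R
  centred≤2R v = ≤-trans (≤Σᶠ centred v) Σ-centred

  module Bounds (t : ℕ) (t>0 : 0 < t) (R>0 : 0 < cherries G)
    (R³≤t⁴ : cherries G * cherries G * cherries G ≤ t * t * (t * t)) where

    private
      R : ℕ
      R = cherries G

    R≤t² : R ≤ t * t
    R≤t² = sq-cancel-≤ (≤-trans (m≤m*n (R * R) R {{>-nonZero R>0}}) R³≤t⁴)

    -- Starts from d² ≤ 2R + d. For d ≥ 2 the term d is at most half of d² and is absorbed; d = 1 is
    -- where R > 0 enters.
    degree²≤4R : ∀ v → degree v * degree v ≤ 4 * R
    degree²≤4R v = go (degree v) (≤-trans (degree²-≤ v) (+-monoˡ-≤ _ (centred≤2R v)))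
      where
      open ≤-Reasoning
      2d≤d² : ∀ e → 2 * (2 + e) ≤ (2 + e) * (2 + e)
      2d≤d² e = *-monoˡ-≤ (2 + e) (s≤s (s≤s (z≤n {e})))
      4R≥1 : 1 ≤ 4 * R
      4R≥1 = ≤-trans R>0 (m≤m+n R _)
      four : ∀ R → 2 * (2 * R) ≡ 4 * R
      four = solve-∀
      go : ∀ d → d * d ≤ 2R + d → d * d ≤ 4 * R
      go zero          h = z≤n
      go (suc zero)    h = 4R≥1
      go (suc (suc e)) h = +-cancelʳ-≤ (d * d) _ _ (begin
        d * d + d * d       ≤⟨ +-mono-≤ h h ⟩
        2R + d + (2R + d)   ≡⟨ regroup 2R d ⟩
        2 * 2R + 2 * d      ≤⟨ +-mono-≤ (≤-reflexive (four R)) (2d≤d² e) ⟩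
        4 * R + d * d       ∎)
        where
        d : ℕ
        d = 2 + e
        regroup : ∀ a b → a + b + (a + b) ≡ 2 * a + 2 * b
        regroup = solve-∀

    -- The fourth power is at most (2R · deg)² ≤ 4R² · 4R = 16R³, which is why `t` has the size
    -- R^(3/4).
    ended≤2t : ∀ a → ended a ≤ 2 * t
    ended≤2t a = sq-cancel-≤ (sq-cancel-≤ (begin
      X * X * (X * X)                  ≤⟨ *-mono-≤ (ended²-≤ a) (ended²-≤ a) ⟩
      degree a * 2R * (degree a * 2R)  ≡⟨ regroup (degree a) R ⟩
      degree a * degree a * (4 * (R * R)) ≤⟨ *-monoˡ-≤ (4 * (R * R)) (degree²≤4R a) ⟩
      4 * R * (4 * (R * R))            ≡⟨ regroup₂ R ⟩
      16 * (R * R * R)                 ≤⟨ *-monoʳ-≤ 16 R³≤t⁴ ⟩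
      16 * (t * t * (t * t))           ≡⟨ regroup₃ t ⟩
      2 * t * (2 * t) * (2 * t * (2 * t)) ∎))
      where
      open ≤-Reasoning
      X : ℕ
      X = ended a
      regroup : ∀ d R → d * (2 * R) * (d * (2 * R)) ≡ d * d * (4 * (R * R))
      regroup = solve-∀
      regroup₂ : ∀ R → 4 * R * (4 * (R * R)) ≡ 16 * (R * R * R)
      regroup₂ = solve-∀
      regroup₃ : ∀ t → 16 * (t * t * (t * t)) ≡ 2 * t * (2 * t) * (2 * t * (2 * t))
      regroup₃ = solve-∀

    High : Fin n → Set
    High v = 2 * t < centred v

    high? : Decidable High
    high? v = 2 * t <? centred v

    highs : List (Fin n)
    highs = filter high? (allFin n)

    h : ℕ
    h = length highs

    h*t≤R : h * t ≤ R
    h*t≤R = *-cancelˡ-≤ 2 (begin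
      2 * (h * t)                           ≡⟨ regroup h t ⟩
      h * (2 * t)                           ≡⟨ sym (∑-const highs (2 * t)) ⟩
      ∑[ _ ∈ highs ] (2 * t)                ≡⟨ ∑-filter high? (allFin n) (λ _ → 2 * t) ⟩
      Σᶠ[ v ] (⟦ high? v ⟧ * (2 * t))       ≤⟨ ∑-mono (allFin n) (λ v → ⟦⟧*-≤ (high? v) <⇒≤) ⟩
      Σᶠ[ v ] centred v                     ≤⟨ Σ-centred ⟩
      2 * R                                 ∎)
      where
      open ≤-Reasoning
      regroup : ∀ a b → 2 * (a * b) ≡ a * (2 * b)
      regroup = solve-∀

    -- The fourth power of the Markov bound ht ≤ R, divided by R³ ≤ t⁴.
    h⁴≤R : h * h * (h * h) ≤ R
    h⁴≤R = *-cancelʳ-≤ _ _ (R * R * R) {{>-nonZero (*-mono-< (*-mono-< R>0 R>0) R>0)}} (begin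
      h * h * (h * h) * (R * R * R)                  ≤⟨ *-monoʳ-≤ (h * h * (h * h)) R³≤t⁴ ⟩
      h * h * (h * h) * (t * t * (t * t))            ≡⟨ regroup h t ⟩
      h * t * (h * t) * (h * t * (h * t))            ≤⟨ *-mono-≤ (*-mono-≤ h*t≤R h*t≤R) (*-mono-≤ h*t≤R h*t≤R) ⟩
      R * R * (R * R)                                ≡⟨ regroup₂ R ⟩
      R * (R * R * R)                                ∎)
      where
      open ≤-Reasoning
      regroup : ∀ h t → h * h * (h * h) * (t * t * (t * t)) ≡ h * t * (h * t) * (h * t * (h * t))
      regroup = solve-∀
      regroup₂ : ∀ R → R * R * (R * R) ≡ R * (R * R * R)
      regroup₂ = solve-∀

    h²≤t : h * h ≤ t
    h²≤t = sq-cancel-≤ (≤-trans h⁴≤R R≤t²)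

    -- Serves to bound the number of neighbours of high vertices, which are the vertices with
    -- forbidden images. The factors h⁴ ≤ R and deg⁴ ≤ 16R² multiply to 16R³.
    h*degree≤2t : ∀ a → h * degree a ≤ 2 * t
    h*degree≤2t a = sq-cancel-≤ (sq-cancel-≤ (begin
      h * d * (h * d) * (h * d * (h * d))       ≡⟨ regroup h d ⟩
      h * h * (h * h) * (d * d * (d * d))       ≤⟨ *-mono-≤ h⁴≤R (*-mono-≤ (degree²≤4R a) (degree²≤4R a)) ⟩
      R * (4 * R * (4 * R))                     ≡⟨ regroup₂ R ⟩
      16 * (R * R * R)                          ≤⟨ *-monoʳ-≤ 16 R³≤t⁴ ⟩
      16 * (t * t * (t * t))                    ≡⟨ regroup₃ t ⟩
      2 * t * (2 * t) * (2 * t * (2 * t))       ∎))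
      where
      open ≤-Reasoning
      d : ℕ
      d = degree a
      regroup : ∀ h d → h * d * (h * d) * (h * d * (h * d)) ≡ h * h * (h * h) * (d * d * (d * d))
      regroup = solve-∀
      regroup₂ : ∀ R → R * (4 * R * (4 * R)) ≡ 16 * (R * R * R)
      regroup₂ = solve-∀
      regroup₃ : ∀ t → 16 * (t * t * (t * t)) ≡ 2 * t * (2 * t) * (2 * t * (2 * t))
      regroup₃ = solve-∀

-- Monochromatic cherries in a locally bounded colouring

colorDeg-term : ∀ {n C} (_≟C_ : DecidableEquality C) (c : Coloring n C) {v u a} → u ≢ v → col c v u ≡ a →
                1 ≤ (if ⌊ ¬? (u F.≟ v) ⌋ ∧ ⌊ col c v u ≟C a ⌋ then 1 else 0)
colorDeg-term _≟C_ c {v} {u} {a} u≢v e with ¬? (u F.≟ v) | col c v u ≟C a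
... | yes _ | yes _ = ≤-refl
... | no ¬p | _     = contradiction u≢v ¬p
... | yes _ | no ¬e = contradiction e ¬e

module BoundedColoring {n : ℕ} {C : Set} (_≟C_ : DecidableEquality C) (c : Coloring n C)
  (k : ℕ) (bounded : ∀ v a → colorDeg _≟C_ c v a ≤ k) where

  Mono : Fin n → Fin n → Fin n → Set
  Mono x y z = x ≢ y × y ≢ z × x ≢ z × col c x y ≡ col c y z

  mono? : ∀ x y z → Dec (Mono x y z)
  mono? x y z = ¬? (x F.≟ y) ×-dec (¬? (y F.≟ z) ×-dec (¬? (x F.≟ z) ×-dec (col c x y ≟C col c y z)))

  Mono-sym : ∀ {x y z} → Mono x y z → Mono z y x
  Mono-sym {x} {y} {z} (x≢y , y≢z , x≢z , e) =
    y≢z ∘ sym , x≢y ∘ sym , x≢z ∘ sym , trans (csym c z y) (trans (sym e) (csym c x y))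

  μ : Fin n → Fin n → Fin n → ℕ
  μ x y z = ⟦ mono? x y z ⟧

  μ-sym : ∀ x y z → μ x y z ≤ μ z y x
  μ-sym x y z = ⟦⟧-mono (mono? x y z) (mono? z y x) Mono-sym

  Σ-μ-last : ∀ x y → Σᶠ[ z ] μ x y z ≤ k
  Σ-μ-last x y = ≤-trans (∑-mono (allFin n) (λ z → ⟦⟧-≤ (mono? x y z) (λ (_ , y≢z , _ , e) → colorDeg-term _≟C_ c (y≢z ∘ sym) (sym e))))
                         (bounded y (col c x y))

  common : Fin n → Fin n → ℕ
  common x y = Σᶠ[ w ] μ x w y

  common-sym : ∀ x y → common x y ≤ common y x
  common-sym x y = ∑-mono (allFin n) (λ w → μ-sym x w y)

  common-refl : ∀ x → common x x ≡ 0
  common-refl x = trans (∑-cong (allFin n) (λ w → ⟦⟧-no (mono? x w x) (λ (_ , _ , x≢x , _) → x≢x refl))) (∑-zero (allFin n))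

  Σ-common : ∀ x → Σᶠ[ y ] common x y ≤ n * k
  Σ-common x = ≤-trans (≤-reflexive (∑-swap (allFin n) (allFin n) (λ y w → μ x w y)))
                       (Σᶠ-≤-const k (Σ-μ-last x))

  -- A further point `w` can complete a monochromatic cherry over `xs` as its centre or as an end;
  -- the opposite end is covered by `Mono-sym`.
  Bad : List (Fin n) → Fin n → Set
  Bad xs w = Any (λ x → Any (λ y → Mono x w y ⊎ Mono x y w) xs) xs

  bad? : ∀ xs → Decidable (Bad xs)
  bad? xs w = Any.any? (λ x → Any.any? (λ y → mono? x w y ⊎-dec mono? x y w) xs) xs

  Proper : List (Fin n) → Set
  Proper xs = ∀ {x y z} → x ∈ xs → y ∈ xs → z ∈ xs → ¬ Mono x y z

  pairCommon : List (Fin n) → ℕ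
  pairCommon xs = ∑[ x ∈ xs ] ∑[ y ∈ xs ] common x y

  -- For each ordered pair, `w` as a centre is counted by `common`, while `w` as an end lies in a
  -- single colour class; hence one extra `k` per pair.
  bad-count : ∀ xs → Σᶠ[ w ] ⟦ bad? xs w ⟧ ≤ pairCommon xs + length xs * length xs * k
  bad-count xs = begin
    Σᶠ[ w ] ⟦ bad? xs w ⟧
      ≤⟨ ∑-mono V (λ w → ⟦⟧-≤ (bad? xs w) (bad⇒ w)) ⟩
    Σᶠ[ w ] ∑[ x ∈ xs ] ∑[ y ∈ xs ] (μ x w y + μ x y w)
      ≡⟨ ∑-swap V xs (λ w x → ∑[ y ∈ xs ] (μ x w y + μ x y w)) ⟩
    ∑[ x ∈ xs ] Σᶠ[ w ] ∑[ y ∈ xs ] (μ x w y + μ x y w)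
      ≡⟨ ∑-cong xs (λ x → ∑-swap V xs (λ w y → μ x w y + μ x y w)) ⟩
    ∑[ x ∈ xs ] ∑[ y ∈ xs ] Σᶠ[ w ] (μ x w y + μ x y w)
      ≤⟨ ∑-mono xs (λ x → ∑-mono xs (λ y → ≤-trans (≤-reflexive (∑-+ V (λ w → μ x w y) (μ x y)))
           (+-monoʳ-≤ (common x y) (Σ-μ-last x y)))) ⟩
    ∑[ x ∈ xs ] ∑[ y ∈ xs ] (common x y + k)
      ≡⟨ ∑-cong xs (λ x → trans (∑-+ xs (common x) (λ _ → k)) (cong (∑ xs (common x) +_) (∑-const xs k))) ⟩
    ∑[ x ∈ xs ] (∑ xs (common x) + length xs * k)
      ≡⟨ trans (∑-+ xs (λ x → ∑ xs (common x)) (λ _ → length xs * k))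
           (cong (pairCommon xs +_) (trans (∑-const xs (length xs * k)) (sym (*-assoc (length xs) (length xs) k)))) ⟩
    pairCommon xs + length xs * length xs * k ∎
    where
    open ≤-Reasoning
    V : List (Fin n)
    V = allFin n
    bad⇒ : ∀ w → Bad xs w → 1 ≤ ∑[ x ∈ xs ] ∑[ y ∈ xs ] (μ x w y + μ x y w)
    bad⇒ w b with find b
    ... | x , x∈ , b′ with find b′
    ...   | y , y∈ , m = begin
      1                                                 ≤⟨ ⟦⟧-⊎ (yes m) (mono? x w y) (mono? x y w) id ⟩
      μ x w y + μ x y w                                 ≤⟨ ∈⇒≤∑ (λ y → μ x w y + μ x y w) y∈ ⟩
      ∑[ y ∈ xs ] (μ x w y + μ x y w)                   ≤⟨ ∈⇒≤∑ (λ x → ∑[ y ∈ xs ] (μ x w y + μ x y w)) x∈ ⟩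
      ∑[ x ∈ xs ] ∑[ y ∈ xs ] (μ x w y + μ x y w)       ∎

  Proper-∷ : ∀ {w xs} → Proper xs → ¬ Bad xs w → Proper (w ∷ xs)
  Proper-∷ pr ¬b (here refl) (here refl) _           (x≢y , _)         = x≢y refl
  Proper-∷ pr ¬b (here refl) (there y∈)  (here refl) (_ , _ , x≢z , _) = x≢z refl
  Proper-∷ pr ¬b (there x∈)  (here refl) (here refl) (_ , y≢z , _)     = y≢z refl
  Proper-∷ pr ¬b (here refl) (there y∈)  (there z∈)  m = ¬b (lose z∈ (lose y∈ (inj₂ (Mono-sym m))))
  Proper-∷ pr ¬b (there x∈)  (here refl) (there z∈)  m = ¬b (lose x∈ (lose z∈ (inj₁ m)))
  Proper-∷ pr ¬b (there x∈)  (there y∈)  (here refl) m = ¬b (lose x∈ (lose y∈ (inj₂ m)))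
  Proper-∷ pr ¬b (there x∈)  (there y∈)  (there z∈)  m = pr x∈ y∈ z∈ m

  pairCommon-∷ : ∀ w xs → pairCommon (w ∷ xs) ≤ 2 * (∑[ x ∈ xs ] common x w) + pairCommon xs
  pairCommon-∷ w xs = begin
    common w w + ∑ xs (common w) + (∑[ x ∈ xs ] (common x w + ∑ xs (common x)))
      ≡⟨ cong₂ _+_ (cong (_+ ∑ xs (common w)) (common-refl w)) (∑-+ xs (λ x → common x w) (λ x → ∑ xs (common x))) ⟩
    ∑ xs (common w) + (s + pairCommon xs)
      ≤⟨ +-monoˡ-≤ _ (∑-mono xs (common-sym w)) ⟩
    s + (s + pairCommon xs)
      ≡⟨ regroup s (pairCommon xs) ⟩
    2 * s + pairCommon xs ∎
    where
    open ≤-Reasoning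
    s : ℕ
    s = ∑[ x ∈ xs ] common x w
    regroup : ∀ a b → a + (a + b) ≡ 2 * a + b
    regroup = solve-∀

  -- The quadratic bound is what the greedy choice maintains: a new point with at most 2lk common
  -- neighbours to the l old ones adds at most 4lk, and 2(l + 1)² - 2l² = 4l + 2.
  record Spread (xs : List (Fin n)) : Set where
    field
      unique : Unique xs
      proper : Proper xs
      sparse : pairCommon xs ≤ 2 * (length xs * length xs) * k

    bad-≤ : Σᶠ[ w ] ⟦ bad? xs w ⟧ ≤ 3 * (length xs * length xs * k)
    bad-≤ = ≤-trans (bad-count xs) (≤-trans (+-monoˡ-≤ _ sparse) (≤-reflexive (three (length xs * length xs) k)))
      where
      three : ∀ a b → 2 * a * b + a * b ≡ 3 * (a * b)
      three = solve-∀

  -- Greedy choice of images for the high vertices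

  module Greedy (t : ℕ) (t>0 : 0 < t) (k>0 : 0 < k) (room : 8 * (t * k) ≤ n) where

    module Step (xs : List (Fin n)) (spr : Spread xs) (l²≤t : length xs * length xs ≤ t) where
      open ≤-Reasoning
      open Spread spr
      l bads pen : ℕ
      l = length xs
      bads = Σᶠ[ w ] ⟦ bad? xs w ⟧
      pen = 1 + 2 * (l * k)
      V : List (Fin n)
      V = allFin n
      -- The penalty makes every w of cost below pen unused and not bad.
      near used cost : Fin n → ℕ
      near w = ∑[ x ∈ xs ] common x w
      used w = ∑[ x ∈ xs ] ⟦ w F.≟ x ⟧
      cost w = near w + pen * (used w + ⟦ bad? xs w ⟧)

      square : ∀ l k → 2 * (2 * (l * k)) + 2 * (l * l) * k + 2 * k ≡ 2 * ((1 + l) * (1 + l)) * k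
      square = solve-∀

      Σ-near : Σᶠ near ≤ l * (n * k)
      Σ-near = ≤-trans (≤-reflexive (∑-swap V xs (λ w x → common x w))) (∑-≤-const xs (n * k) Σ-common)

      Σ-used : Σᶠ used ≤ l
      Σ-used = ≤-trans (≤-reflexive (∑-swap V xs (λ w x → ⟦ w F.≟ x ⟧)))
        (≤-trans (∑-≤-const xs 1 (λ x → Σᶠ-≤1 (F._≟ x) (λ p q → trans p (sym q)))) (≤-reflexive (*-identityʳ l)))

      l+bads≤ : 2 * (l + bads) ≤ n
      l+bads≤ = begin
        2 * (l + bads)                  ≤⟨ *-monoʳ-≤ 2 (+-mono-≤ l≤tk (≤-trans bad-≤ (*-monoʳ-≤ 3 (*-monoˡ-≤ k l²≤t)))) ⟩
        2 * (t * k + 3 * (t * k))    ≡⟨ eight (t * k) ⟩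
        8 * (t * k)                  ≤⟨ room ⟩
        n                            ∎
        where
        eight : ∀ a → 2 * (a + 3 * a) ≡ 8 * a
        eight = solve-∀
        l≤tk : l ≤ t * k
        l≤tk = ≤-trans (m≤m² l) (≤-trans l²≤t (m≤m*n t k {{>-nonZero k>0}}))

      n>0 : 0 < n
      n>0 = ≤-trans (*-mono-< (s≤s (z≤n {7})) (*-mono-< t>0 k>0)) room

      -- `near` averages at most lk, and used and bad points together number at most n/2, so the
      -- mean cost is at most lk + `pen`/2. With `pen` = 1 + 2lk this is strictly below `pen`.
      Σ-cost : Σᶠ cost < length V * pen
      Σ-cost = *-cancelˡ-< 2 _ _ (begin-strict
        2 * Σᶠ cost                                      ≡⟨ cong (2 *_) (∑-+ V near (λ w → pen * (used w + ⟦ bad? xs w ⟧))) ⟩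
        2 * (Σᶠ near + Σᶠ[ w ] (pen * (used w + ⟦ bad? xs w ⟧)))
          ≡⟨ cong (λ s → 2 * (Σᶠ near + s)) (trans (∑-*ˡ V pen (λ w → used w + ⟦ bad? xs w ⟧))
               (cong (pen *_) (∑-+ V used (λ w → ⟦ bad? xs w ⟧)))) ⟩
        2 * (Σᶠ near + pen * (Σᶠ used + bads))              ≤⟨ *-monoʳ-≤ 2 (+-mono-≤ Σ-near (*-monoʳ-≤ pen (+-monoˡ-≤ bads Σ-used))) ⟩
        2 * (l * (n * k) + pen * (l + bads))                ≡⟨ regroup₁ (l * (n * k)) pen (l + bads) ⟩
        2 * (l * (n * k)) + pen * (2 * (l + bads))          ≤⟨ +-monoʳ-≤ (2 * (l * (n * k))) (*-monoʳ-≤ pen l+bads≤) ⟩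
        2 * (l * (n * k)) + pen * n                      <⟨ m<n+m _ n>0 ⟩
        n + (2 * (l * (n * k)) + pen * n)                ≡⟨ regroup₂ l n k ⟩
        2 * (n * pen)                                    ≡⟨ cong (λ z → 2 * (z * pen)) (sym (length-allFin n)) ⟩
        2 * (length V * pen)                             ∎)
        where
        regroup₁ : ∀ a b c → 2 * (a + b * c) ≡ 2 * a + b * (2 * c)
        regroup₁ = solve-∀
        regroup₂ : ∀ l n k → n + (2 * (l * (n * k)) + (1 + 2 * (l * k)) * n) ≡ 2 * (n * (1 + 2 * (l * k)))
        regroup₂ = solve-∀

      module _ (w : Fin n) (w-cheap : cost w ≤ 2 * (l * k)) where

        penalised : 1 ≤ used w + ⟦ bad? xs w ⟧ → cost w < cost w
        penalised h = begin-strict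
          cost w                                     ≤⟨ w-cheap ⟩
          2 * (l * k)                                <⟨ n<1+n (2 * (l * k)) ⟩
          pen                                        ≡⟨ sym (*-identityʳ pen) ⟩
          pen * 1                                    ≤⟨ *-monoʳ-≤ pen h ⟩
          pen * (used w + ⟦ bad? xs w ⟧)             ≤⟨ m≤n+m _ (near w) ⟩
          cost w                                     ∎

        w-unused : All (w ≢_) xs
        w-unused = All.tabulate λ {x} x∈ w≡x → <-irrefl refl (penalised (begin
          1                            ≡⟨ sym (⟦⟧-yes (w F.≟ x) w≡x) ⟩
          ⟦ w F.≟ x ⟧                  ≤⟨ ∈⇒≤∑ (λ x → ⟦ w F.≟ x ⟧) x∈ ⟩
          used w                       ≤⟨ m≤m+n (used w) ⟦ bad? xs w ⟧ ⟩
          used w + ⟦ bad? xs w ⟧       ∎))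

        w-not-bad : ¬ Bad xs w
        w-not-bad b = <-irrefl refl (penalised (begin
          1                            ≡⟨ sym (⟦⟧-yes (bad? xs w) b) ⟩
          ⟦ bad? xs w ⟧                ≤⟨ m≤n+m ⟦ bad? xs w ⟧ (used w) ⟩
          used w + ⟦ bad? xs w ⟧       ∎))

        spread-∷ : Spread (w ∷ xs)
        spread-∷ = record
          { unique = w-unused ∷ unique
          ; proper = Proper-∷ {w} {xs} proper w-not-bad
          ; sparse = begin
              pairCommon (w ∷ xs)                         ≤⟨ pairCommon-∷ w xs ⟩
              2 * near w + pairCommon xs                  ≤⟨ +-mono-≤ (*-monoʳ-≤ 2 (≤-trans (m≤m+n (near w) (pen * (used w + ⟦ bad? xs w ⟧))) w-cheap)) sparse ⟩
              2 * (2 * (l * k)) + 2 * (l * l) * k         ≤⟨ m≤m+n (2 * (2 * (l * k)) + 2 * (l * l) * k) (2 * k) ⟩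
              2 * (2 * (l * k)) + 2 * (l * l) * k + 2 * k ≡⟨ square l k ⟩
              2 * (suc l * suc l) * k                     ∎
          }

      extend : ∃ λ w → Spread (w ∷ xs)
      extend = finish (∑-average V {cost} pen Σ-cost)
        where
        finish : (∃ λ w → cost w < pen) → ∃ λ w → Spread (w ∷ xs)
        finish (w , w-cheap) = w , spread-∷ w (s≤s⁻¹ {cost w} {2 * (l * k)} w-cheap)

    spread-list : ∀ l → l * l ≤ t → ∃ λ xs → length xs ≡ l × Spread xs
    spread-list zero    _ = [] , refl , record { unique = [] ; proper = λ () ; sparse = z≤n }
    spread-list (suc l) sl²≤t = grow (spread-list l l²≤t)
      where
      l²≤t : l * l ≤ t
      l²≤t = ≤-trans (*-mono-≤ (n≤1+n l) (n≤1+n l)) sl²≤t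
      grow : (∃ λ xs → length xs ≡ l × Spread xs) → ∃ λ xs → length xs ≡ suc l × Spread xs
      grow (xs , |xs|≡l , spr) = let w , spr′ = Step.extend xs spr (subst (λ l → l * l ≤ t) (sym |xs|≡l) l²≤t)
                                 in w ∷ xs , cong suc |xs|≡l , spr′

-- Triple sums and the final numerical estimate

∑-cartesianProduct : ∀ (xs : List A) (ys : List B) (f : A × B → ℕ) →
                     ∑ (cartesianProduct xs ys) f ≡ ∑[ x ∈ xs ] ∑[ y ∈ ys ] f (x , y)
∑-cartesianProduct []       ys f = refl
∑-cartesianProduct (x ∷ xs) ys f = trans (∑-++ (map (x ,_) ys) _ f)
  (cong₂ _+_ (∑-map ys (x ,_) f) (∑-cartesianProduct xs ys f))

Σᶠ-weighted : ∀ (w f : Fin n → ℕ) {N M} → Σᶠ w ≤ N → (∀ i → f i ≤ M) → Σᶠ[ i ] (w i * f i) ≤ N * M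
Σᶠ-weighted {n} w f {N} {M} w≤ f≤ = begin
  Σᶠ[ i ] (w i * f i)   ≤⟨ ∑-mono (allFin n) (λ i → *-monoʳ-≤ (w i) (f≤ i)) ⟩
  Σᶠ[ i ] (w i * M)     ≡⟨ ∑-*ʳ (allFin n) M w ⟩
  Σᶠ w * M              ≤⟨ *-monoˡ-≤ M w≤ ⟩
  N * M                 ∎
  where open ≤-Reasoning

Σ³ : (Fin n → Fin n → Fin n → ℕ) → ℕ
Σ³ f = Σᶠ[ i ] Σᶠ[ j ] Σᶠ[ l ] f i j l

Σ³-cong : ∀ {f g : Fin n → Fin n → Fin n → ℕ} → (∀ i j l → f i j l ≡ g i j l) → Σ³ f ≡ Σ³ g
Σ³-cong {n} h = ∑-cong (allFin n) (λ i → ∑-cong (allFin n) (λ j → ∑-cong (allFin n) (h i j)))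

Σ³-mono : ∀ {f g : Fin n → Fin n → Fin n → ℕ} → (∀ i j l → f i j l ≤ g i j l) → Σ³ f ≤ Σ³ g
Σ³-mono {n} h = ∑-mono (allFin n) (λ i → ∑-mono (allFin n) (λ j → ∑-mono (allFin n) (h i j)))

Σ³-+ : ∀ (f g : Fin n → Fin n → Fin n → ℕ) → Σ³ (λ i j l → f i j l + g i j l) ≡ Σ³ f + Σ³ g
Σ³-+ {n} f g = trans (∑-cong V (λ i → trans (∑-cong V (λ j → ∑-+ V (f i j) (g i j)))
                                            (∑-+ V (λ j → Σᶠ (f i j)) (λ j → Σᶠ (g i j)))))
                     (∑-+ V (λ i → Σᶠ[ j ] Σᶠ (f i j)) (λ i → Σᶠ[ j ] Σᶠ (g i j)))
  where
  V : List (Fin n)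
  V = allFin n

Σ³-*ʳ : ∀ (f : Fin n → Fin n → Fin n → ℕ) c → Σ³ (λ i j l → f i j l * c) ≡ Σ³ f * c
Σ³-*ʳ {n} f c = trans (∑-cong V (λ i → trans (∑-cong V (λ j → ∑-*ʳ V c (f i j)))
                                             (∑-*ʳ V c (λ j → Σᶠ (f i j)))))
                      (∑-*ʳ V c (λ i → Σᶠ[ j ] Σᶠ (f i j)))
  where
  V : List (Fin n)
  V = allFin n

Σ³-rev : ∀ (f : Fin n → Fin n → Fin n → ℕ) → Σ³ f ≡ Σ³ (λ i j l → f l j i)
Σ³-rev {n} f = begin
  Σᶠ[ i ] Σᶠ[ j ] Σᶠ[ l ] f i j l   ≡⟨ ∑-cong V (λ i → ∑-swap V V (f i)) ⟩
  Σᶠ[ i ] Σᶠ[ l ] Σᶠ[ j ] f i j l   ≡⟨ ∑-swap V V (λ i l → Σᶠ[ j ] f i j l) ⟩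
  Σᶠ[ l ] Σᶠ[ i ] Σᶠ[ j ] f i j l   ≡⟨ ∑-cong V (λ l → ∑-swap V V (λ i j → f i j l)) ⟩
  Σᶠ[ l ] Σᶠ[ j ] Σᶠ[ i ] f i j l   ∎
  where
  open ≡-Reasoning
  V : List (Fin n)
  V = allFin n

cube-mono : ∀ {a b} → a ≤ b → a * a * a ≤ b * b * b
cube-mono h = *-mono-≤ (*-mono-≤ h h) h

cube-* : ∀ a b → a * b * (a * b) * (a * b) ≡ a * a * a * (b * b * b)
cube-* = solve-∀

-- The bracket is at most 16 t k n², and 12 · 16 t k n² ≤ p³ follows from n ≥ 280 t k and p ≥ 9n/10.
total-load-≤ : ∀ {n p t k r} → 0 < k → p ≤ n → 9 * n ≤ 10 * p → 280 * (t * k) ≤ n → r ≤ 2 * (t * t) →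
  12 * (p ^ 2 * (3 * (t * k) + 2 * t)
        + (6 * t * (n * (n * k)) + (r * (n * k) + 2 * t * (n * n)) + r * (n * k) + (r * (n * k) + 2 * t * (n * n))))
  ≤ p ^ 3
total-load-≤ {n} {p} {t} {k} {r} k>0 p≤n 9n≤10p room r≤ = *-cancelˡ-≤ 35 (begin
  35 * (12 * (p ^ 2 * (3 * (t * k) + 2 * t)
        + (6 * t * (n * (n * k)) + (r * (n * k) + 2 * t * (n * n)) + r * (n * k) + (r * (n * k) + 2 * t * (n * n)))))
    ≤⟨ *-monoʳ-≤ 35 (*-monoʳ-≤ 12 (≤-trans (+-monoˡ-≤ _ (*-monoˡ-≤ (3 * (t * k) + 2 * t) p²≤)) (≤-reflexive (collect n t k r)))) ⟩
  35 * (12 * (n * n * (9 * (t * k) + 6 * t) + 3 * (r * (n * k))))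
    ≤⟨ *-monoʳ-≤ 35 (*-monoʳ-≤ 12 (≤-trans (+-monoʳ-≤ (n * n * (9 * (t * k) + 6 * t)) r-part)
         (≤-trans (≤-reflexive (collect₂ n t k)) (≤-trans (*-monoʳ-≤ (n * n) (+-monoʳ-≤ (9 * (t * k)) (*-monoʳ-≤ 7 t≤tk)))
           (≤-reflexive (collect₃ n (t * k))))))) ⟩
  35 * (12 * (16 * (n * n * (t * k))))
    ≡⟨ collect₄ n (t * k) ⟩
  24 * (n * n * (280 * (t * k)))
    ≤⟨ *-monoʳ-≤ 24 (*-monoʳ-≤ (n * n) room) ⟩
  24 * (n * n * n)
    ≤⟨ cubes ⟩
  35 * p ^ 3 ∎)
  where
  open ≤-Reasoning
  p²≤ : p ^ 2 ≤ n * n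
  p²≤ = ≤-trans (≤-reflexive (cong (p *_) (*-identityʳ p))) (*-mono-≤ p≤n p≤n)
  t≤tk : t ≤ t * k
  t≤tk = m≤m*n t k {{>-nonZero k>0}}
  collect : ∀ n t k r → n * n * (3 * (t * k) + 2 * t)
      + (6 * t * (n * (n * k)) + (r * (n * k) + 2 * t * (n * n)) + r * (n * k) + (r * (n * k) + 2 * t * (n * n)))
    ≡ n * n * (9 * (t * k) + 6 * t) + 3 * (r * (n * k))
  collect = solve-∀
  collect₂ : ∀ n t k → n * n * (9 * (t * k) + 6 * t) + n * n * t ≡ n * n * (9 * (t * k) + 7 * t)
  collect₂ = solve-∀
  collect₃ : ∀ n s → n * n * (9 * s + 7 * s) ≡ 16 * (n * n * s)
  collect₃ = solve-∀
  collect₄ : ∀ n s → 35 * (12 * (16 * (n * n * s))) ≡ 24 * (n * n * (280 * s))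
  collect₄ = solve-∀
  regroup : ∀ n t k → 3 * (2 * (t * t) * (n * k)) ≡ n * t * (6 * (t * k))
  regroup = solve-∀
  regroup₂ : ∀ n t → n * t * n ≡ n * n * t
  regroup₂ = solve-∀
  r-part : 3 * (r * (n * k)) ≤ n * n * t
  r-part = begin
    3 * (r * (n * k))             ≤⟨ *-monoʳ-≤ 3 (*-monoˡ-≤ (n * k) r≤) ⟩
    3 * (2 * (t * t) * (n * k))   ≡⟨ regroup n t k ⟩
    n * t * (6 * (t * k))         ≤⟨ *-monoʳ-≤ (n * t) (≤-trans (*-monoˡ-≤ (t * k) (m≤m+n 6 274)) room) ⟩
    n * t * n                     ≡⟨ regroup₂ n t ⟩
    n * n * t                     ∎
  -- (9/10)³ = 729/1000 exceeds 24/35; below, 24000 + 1515 = 729 · 35.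
  cubes : 24 * (n * n * n) ≤ 35 * p ^ 3
  cubes = *-cancelˡ-≤ 729 (begin
    729 * (24 * (n * n * n))              ≡⟨ swap 729 24 (n * n * n) ⟩
    24 * (729 * (n * n * n))              ≡⟨ cong (24 *_) (sym (cube-* 9 n)) ⟩
    24 * (9 * n * (9 * n) * (9 * n))      ≤⟨ *-monoʳ-≤ 24 (cube-mono 9n≤10p) ⟩
    24 * (10 * p * (10 * p) * (10 * p))   ≡⟨ cong (24 *_) (cube-* 10 p) ⟩
    24 * (1000 * (p * p * p))             ≡⟨ sym (*-assoc 24 1000 (p * p * p)) ⟩
    24000 * (p * p * p)                   ≤⟨ *-monoˡ-≤ (p * p * p) (m≤m+n 24000 1515) ⟩
    729 * 35 * (p * p * p)                ≡⟨ *-assoc 729 35 (p * p * p) ⟩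
    729 * (35 * (p * p * p))              ≡⟨ cong (λ q → 729 * (35 * q)) (power p) ⟩
    729 * (35 * p ^ 3)                    ∎)
    where
    swap : ∀ a b c → a * (b * c) ≡ b * (a * c)
    swap = solve-∀
    power : ∀ p → p * p * p ≡ p * (p * (p * 1))
    power = solve-∀

-- Bad events of the random embedding and their weights

module Threats {n : ℕ} (G : Graph n) {C : Set} (_≟C_ : DecidableEquality C) (c : Coloring n C)
  (k : ℕ) (bounded : ∀ v a → colorDeg _≟C_ c v a ≤ k)
  {High : Fin n → Set} (high? : Decidable High)
  (ψ : Fin n → Fin n) (ψ-inj : ∀ {i j} → ψ i ≡ ψ j → i ≡ j)
  (xs : List (Fin n)) (ψ∈xs : ∀ {a} → High a → ψ a ∈ xs)
  (p : ℕ) (p>0 : 0 < p) (p≤n : p ≤ n)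
  where

  open CherryCount G
  open BoundedColoring _≟C_ c k bounded

  private
    V : List (Fin n)
    V = allFin n

  NearHigh : Fin n → Set
  NearHigh u = Any (λ a → High a × Edge a u) V

  nearHigh? : Decidable NearHigh
  nearHigh? u = Any.any? (λ a → high? a ×-dec edge? a u) V

  -- The images that remain for `u` once `ψ` has placed the high vertices and the one-pin events are
  -- avoided.
  Allowed : Fin n → Fin n → Set
  Allowed u x = (High u → x ≡ ψ u) × (¬ High u → NearHigh u → ¬ Bad xs x)

  allowed? : ∀ u x → Dec (Allowed u x)
  allowed? u x = (high? u →-dec (x F.≟ ψ u)) ×-dec (¬? (high? u) →-dec (nearHigh? u →-dec ¬? (bad? xs x)))

  -- Other images are already excluded by the fixed pins or by a one-pin event. The restriction
  -- leaves no threat with two high vertices (`no-threat-ends`, `no-threat-arm`); cherries with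
  -- three are settled by the properly coloured clique.
  Threat : Fin n → Fin n → Fin n → Fin n → Fin n → Fin n → Set
  Threat a v b x y z = Cherry a v b × Mono x y z × Allowed a x × Allowed v y × Allowed b z × ¬ (High a × High v × High b)

  threat? : ∀ a v b x y z → Dec (Threat a v b x y z)
  threat? a v b x y z = cherry? a v b ×-dec (mono? x y z ×-dec (allowed? a x ×-dec (allowed? v y ×-dec (allowed? b z
    ×-dec ¬? (high? a ×-dec (high? v ×-dec high? b))))))

  Threat-sym : ∀ {a v b x y z} → Threat a v b x y z → Threat b v a z y x
  Threat-sym ((av , vb , a≢b) , m , oka , okv , okb , nh) =
    (edge-sym vb , edge-sym av , a≢b ∘ sym) , Mono-sym m , okb , okv , oka , λ (hb , hv , ha) → nh (ha , hv , hb)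

  near : ∀ {a u} → High a → Edge a u → NearHigh u
  near {a} ha au = lose (∈-allFin a) (ha , au)

  -- Not all three are high, so `v` is low, and it is a neighbour of the high `a`. A monochromatic
  -- cherry between two points of `xs` would make the image of `v` bad, hence forbidden.
  no-threat-ends : ∀ {a v b x y z} → High a → High b → ¬ Threat a v b x y z
  no-threat-ends {a} {v} {b} {x} {y} {z} ha hb ((av , _) , m , (oka , _) , (_ , okv) , (okb , _) , nh) =
    okv (λ hv → nh (ha , hv , hb)) (near ha av)
      (lose (subst (_∈ xs) (sym (oka ha)) (ψ∈xs ha)) (lose (subst (_∈ xs) (sym (okb hb)) (ψ∈xs hb)) (inj₁ m)))

  no-threat-arm : ∀ {a v b x y z} → High a → High v → ¬ Threat a v b x y z
  no-threat-arm {a} {v} {b} {x} {y} {z} ha hv ((_ , vb , _) , m , (oka , _) , (okv , _) , (_ , okb) , nh) =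
    okb (λ hb → nh (ha , hv , hb)) (near hv vb)
      (lose (subst (_∈ xs) (sym (oka ha)) (ψ∈xs ha)) (lose (subst (_∈ xs) (sym (okv hv)) (ψ∈xs hv)) (inj₂ m)))

  -- A high vertex takes no pin, which saves a factor `p`; the product over the vertices of a cherry
  -- is the weight of its event (`wt-pins`).
  ωᵈ : ∀ {u} → Dec (High u) → ℕ
  ωᵈ (yes _) = p
  ωᵈ (no _)  = 1

  ω : Fin n → ℕ
  ω u = ωᵈ (high? u)

  low : Fin n → ℕ
  low u = ⟦ ¬? (high? u) ⟧

  ν : Fin n → Fin n → ℕ
  ν u x = ω u * ⟦ allowed? u x ⟧

  -- Either one image of weight `p` ≤ `n` or at most `n` images of weight 1, so high and low
  -- vertices obey the same bound.
  Σ-ν : ∀ u → Σᶠ (ν u) ≤ n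
  Σ-ν u = ≤-trans (≤-reflexive (∑-*ˡ V (ω u) (λ x → ⟦ allowed? u x ⟧))) (cases (high? u))
    where
    open ≤-Reasoning
    total : ℕ
    total = Σᶠ[ x ] ⟦ allowed? u x ⟧
    cases : ∀ (d : Dec (High u)) → ωᵈ d * total ≤ n
    cases (yes hu) = begin
      p * total   ≤⟨ *-mono-≤ p≤n (Σᶠ-≤1 (allowed? u) (λ (e , _) (e′ , _) → trans (e hu) (sym (e′ hu)))) ⟩
      n * 1       ≡⟨ *-identityʳ n ⟩
      n           ∎
    cases (no _) = begin
      1 * total   ≡⟨ *-identityˡ total ⟩
      total       ≤⟨ Σᶠ-≤-const 1 (λ x → ⟦⟧≤1 (allowed? u x)) ⟩
      n * 1       ≡⟨ *-identityʳ n ⟩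
      n           ∎

  ν-low : ∀ {u} x → ¬ High u → ν u x ≤ 1
  ν-low {u} x ¬hu = cases (high? u)
    where
    cases : ∀ (d : Dec (High u)) → ωᵈ d * ⟦ allowed? u x ⟧ ≤ 1
    cases (yes hu) = contradiction hu ¬hu
    cases (no _)   = ≤-trans (≤-reflexive (*-identityˡ _)) (⟦⟧≤1 (allowed? u x))

  θ : Fin n → Fin n → Fin n → Fin n → Fin n → Fin n → ℕ
  θ a v b x y z = ⟦ threat? a v b x y z ⟧ * (ω a * ω v * ω b)

  θ-sym : ∀ a v b x y z → θ a v b x y z ≤ θ b v a z y x
  θ-sym a v b x y z = *-mono-≤ (⟦⟧-mono (threat? a v b x y z) (threat? b v a z y x) Threat-sym)
                               (≤-reflexive (rev (ω a) (ω v) (ω b)))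
    where
    rev : ∀ a v b → a * v * b ≡ b * v * a
    rev = solve-∀

  θ-zero : ∀ {a v b x y z} → ¬ Threat a v b x y z → ∀ {m} → θ a v b x y z ≤ m
  θ-zero {a} {v} {b} {x} {y} {z} ¬τ = ⟦⟧*-≤ (threat? a v b x y z) (λ τ → contradiction τ ¬τ)

  θ-≤ : ∀ a v b x y z → θ a v b x y z ≤ χ a v b * (ν a x * (ν v y * (ν b z * μ x y z)))
  θ-≤ a v b x y z = ⟦⟧*-≤ (threat? a v b x y z) bound
    where
    open ≤-Reasoning
    shape : ∀ A V B → A * V * B ≡ 1 * (A * 1 * (V * 1 * (B * 1 * 1)))
    shape = solve-∀
    bound : Threat a v b x y z → ω a * ω v * ω b ≤ χ a v b * (ν a x * (ν v y * (ν b z * μ x y z)))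
    bound (ch , m , oka , okv , okb , _) = begin
      ω a * ω v * ω b ≡⟨ shape (ω a) (ω v) (ω b) ⟩
      1 * (ω a * 1 * (ω v * 1 * (ω b * 1 * 1)))
        ≡⟨ cong₂ _*_ (sym (⟦⟧-yes (cherry? a v b) ch)) (cong₂ _*_ (one a x oka) (cong₂ _*_ (one v y okv)
             (cong₂ _*_ (one b z okb) (sym (⟦⟧-yes (mono? x y z) m))))) ⟩
      χ a v b * (ν a x * (ν v y * (ν b z * μ x y z))) ∎
      where
      one : ∀ u x → Allowed u x → ω u * 1 ≡ ν u x
      one u x ok = cong (ω u *_) (sym (⟦⟧-yes (allowed? u x) ok))

  Σ-ν-μ-last : ∀ {b} → ¬ High b → ∀ x y → Σᶠ[ z ] (ν b z * μ x y z) ≤ k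
  Σ-ν-μ-last {b} ¬hb x y = ≤-trans
    (∑-mono V (λ z → ≤-trans (*-monoˡ-≤ (μ x y z) (ν-low z ¬hb)) (≤-reflexive (*-identityˡ (μ x y z)))))
    (Σ-μ-last x y)

  Σ-ν-μ-first : ∀ {a} → ¬ High a → ∀ y z → Σᶠ[ x ] (ν a x * μ x y z) ≤ k
  Σ-ν-μ-first {a} ¬ha y z = ≤-trans (∑-mono V (λ x → *-monoʳ-≤ (ν a x) (μ-sym x y z))) (Σ-ν-μ-last ¬ha z y)

  pull : ∀ a b (f : Fin n → ℕ) → Σᶠ[ z ] (a * (b * f z)) ≡ a * (b * Σᶠ f)
  pull a b f = trans (∑-*ˡ V a (λ z → b * f z)) (cong (a *_) (∑-*ˡ V b f))

  -- `x` and `y` contribute weight at most `n` each, and then `z` is confined to one colour class. A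
  -- high `b` would instead count its one image with weight `p`.
  images-low : ∀ a v b → ¬ High b → Σ³ (θ a v b) ≤ χ a v b * (n * (n * k))
  images-low a v b ¬hb = begin
    Σ³ (θ a v b)
      ≤⟨ Σ³-mono (θ-≤ a v b) ⟩
    Σᶠ[ x ] Σᶠ[ y ] Σᶠ[ z ] (χ a v b * (ν a x * (ν v y * (ν b z * μ x y z))))
      ≡⟨ ∑-cong V (λ x → ∑-cong V (λ y → trans (pull (χ a v b) (ν a x) (λ z → ν v y * (ν b z * μ x y z)))
           (cong (λ s → χ a v b * (ν a x * s)) (∑-*ˡ V (ν v y) (λ z → ν b z * μ x y z))))) ⟩
    Σᶠ[ x ] Σᶠ[ y ] (χ a v b * (ν a x * (ν v y * inner x y)))
      ≡⟨ trans (∑-cong V (λ x → pull (χ a v b) (ν a x) (λ y → ν v y * inner x y)))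
           (∑-*ˡ V (χ a v b) (λ x → ν a x * (Σᶠ[ y ] (ν v y * inner x y)))) ⟩
    χ a v b * (Σᶠ[ x ] (ν a x * (Σᶠ[ y ] (ν v y * inner x y))))
      ≤⟨ *-monoʳ-≤ (χ a v b) (Σᶠ-weighted (ν a) (λ x → Σᶠ[ y ] (ν v y * inner x y)) (Σ-ν a)
           (λ x → Σᶠ-weighted (ν v) (inner x) (Σ-ν v) (Σ-ν-μ-last ¬hb x))) ⟩
    χ a v b * (n * (n * k)) ∎
    where
    open ≤-Reasoning
    inner : Fin n → Fin n → ℕ
    inner x y = Σᶠ[ z ] (ν b z * μ x y z)

  Σ³-zero : ∀ {f : Fin n → Fin n → Fin n → ℕ} → (∀ i j l → f i j l ≤ 0) → ∀ {m} → Σ³ f ≤ m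
  Σ³-zero h = ≤-trans (Σ³-mono h) (≤-trans (≤-reflexive
    (trans (∑-cong V (λ _ → trans (∑-cong V (λ _ → ∑-zero V)) (∑-zero V))) (∑-zero V))) z≤n)

  -- Two high ends admit no threat, so some end is low, and reversing the cherry brings it last.
  images : ∀ a v b → Σ³ (θ a v b) ≤ χ a v b * (n * (n * k))
  images a v b = cases (high? a) (high? b)
    where
    open ≤-Reasoning
    cases : Dec (High a) → Dec (High b) → Σ³ (θ a v b) ≤ χ a v b * (n * (n * k))
    cases _        (no ¬hb) = images-low a v b ¬hb
    cases (yes ha) (yes hb) = Σ³-zero (λ x y z → θ-zero {a} {v} {b} {x} {y} {z} (no-threat-ends ha hb))
    cases (no ¬ha) (yes _)  = begin
      Σ³ (θ a v b)                             ≤⟨ Σ³-mono (θ-sym a v b) ⟩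
      Σ³ (λ x y z → θ b v a z y x)             ≡⟨ sym (Σ³-rev (θ b v a)) ⟩
      Σ³ (θ b v a)                             ≤⟨ images-low b v a ¬ha ⟩
      χ b v a * (n * (n * k))                  ≤⟨ *-monoˡ-≤ (n * (n * k)) (χ-sym b v a) ⟩
      χ a v b * (n * (n * k))                  ∎

  δ : Fin n → Fin n → ℕ
  δ u v = ⟦ u F.≟ v ⟧

  δ-pick : ∀ u (f : Fin n → ℕ) → Σᶠ[ i ] (δ u i * f i) ≤ f u
  δ-pick u f = Σᶠ-pick f (u F.≟_) u (λ _ → sym)

  -- Events through a fixed vertex: `u` is either end or the centre, with at most 2t ordered
  -- cherries in each of the three roles.
  domain-part : ∀ {t} u → ended u ≤ 2 * t → centred u ≤ 2 * t →
    Σ³ (λ a v b → Σ³ (λ x y z → θ a v b x y z * (δ u a + δ u v + δ u b))) ≤ 6 * t * (n * (n * k))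
  domain-part {t} u end≤ cen≤ = begin
    Σ³ (λ a v b → Σ³ (λ x y z → θ a v b x y z * (δ u a + δ u v + δ u b)))
      ≡⟨ Σ³-cong (λ a v b → Σ³-*ʳ (θ a v b) (δ u a + δ u v + δ u b)) ⟩
    Σ³ (λ a v b → Σ³ (θ a v b) * (δ u a + δ u v + δ u b))
      ≤⟨ Σ³-mono (λ a v b → ≤-trans (*-monoˡ-≤ (δ u a + δ u v + δ u b) (images a v b))
           (≤-reflexive (split (χ a v b) (n * (n * k)) (δ u a) (δ u v) (δ u b)))) ⟩
    Σ³ (λ a v b → (δ u a * χ a v b + δ u v * χ a v b + δ u b * χ a v b) * (n * (n * k)))
      ≡⟨ trans (Σ³-*ʳ (λ a v b → δ u a * χ a v b + δ u v * χ a v b + δ u b * χ a v b) (n * (n * k)))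
           (cong (_* (n * (n * k))) (trans (Σ³-+ (λ a v b → δ u a * χ a v b + δ u v * χ a v b) (λ a v b → δ u b * χ a v b))
             (cong (_+ S₃) (Σ³-+ (λ a v b → δ u a * χ a v b) (λ a v b → δ u v * χ a v b))))) ⟩
    (S₁ + S₂ + S₃) * (n * (n * k))
      ≤⟨ *-monoˡ-≤ (n * (n * k)) (+-mono-≤ (+-mono-≤ (≤-trans S₁≤ end≤) (≤-trans S₂≤ cen≤)) (≤-trans S₃≤ end≤)) ⟩
    (2 * t + 2 * t + 2 * t) * (n * (n * k))
      ≡⟨ cong (_* (n * (n * k))) (six t) ⟩
    6 * t * (n * (n * k)) ∎
    where
    open ≤-Reasoning
    six : ∀ t → 2 * t + 2 * t + 2 * t ≡ 6 * t
    six = solve-∀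
    split : ∀ c m x y z → c * m * (x + y + z) ≡ (x * c + y * c + z * c) * m
    split = solve-∀
    S₁ S₂ S₃ : ℕ
    S₁ = Σ³ (λ a v b → δ u a * χ a v b)
    S₂ = Σ³ (λ a v b → δ u v * χ a v b)
    S₃ = Σ³ (λ a v b → δ u b * χ a v b)
    S₁≤ : S₁ ≤ ended u
    S₁≤ = ≤-trans (≤-reflexive (∑-cong V (λ a → trans (∑-cong V (λ v → ∑-*ˡ V (δ u a) (χ a v)))
            (∑-*ˡ V (δ u a) (λ v → Σᶠ (χ a v)))))) (δ-pick u ended)
    S₂≤ : S₂ ≤ centred u
    S₂≤ = ∑-mono V (λ a → ≤-trans (≤-reflexive (∑-cong V (λ v → ∑-*ˡ V (δ u v) (χ a v)))) (δ-pick u (λ v → Σᶠ (χ a v))))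
    S₃≤ : S₃ ≤ ended u
    S₃≤ = begin
      S₃                                      ≡⟨ Σ³-rev (λ a v b → δ u b * χ a v b) ⟩
      Σ³ (λ b v a → δ u b * χ a v b)          ≤⟨ Σ³-mono (λ b v a → *-monoʳ-≤ (δ u b) (χ-sym a v b)) ⟩
      S₁                                      ≤⟨ S₁≤ ⟩
      ended u                                 ∎

  low-∙ : ∀ {m m′} u → (¬ High u → m ≤ m′) → low u * m ≤ m′
  low-∙ u h = ⟦⟧*-≤ (¬? (high? u)) h

  Σ³-χ : Σ³ χ ≤ 2R
  Σ³-χ = ≤-trans (≤-reflexive (∑-swap V V (λ a v → Σᶠ (χ a v)))) Σ-centred

  centre-images-low : ∀ a v b w → ¬ High v → ¬ High b →
    Σᶠ[ x ] Σᶠ[ z ] θ a v b x w z ≤ χ a v b * (n * k)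
  centre-images-low a v b w ¬hv ¬hb = begin
    Σᶠ[ x ] Σᶠ[ z ] θ a v b x w z
      ≤⟨ ∑-mono V (λ x → ∑-mono V (λ z → ≤-trans (θ-≤ a v b x w z)
           (*-monoʳ-≤ (χ a v b) (*-monoʳ-≤ (ν a x) (≤-trans (*-monoˡ-≤ (ν b z * μ x w z) (ν-low w ¬hv))
             (≤-reflexive (*-identityˡ (ν b z * μ x w z)))))))) ⟩
    Σᶠ[ x ] Σᶠ[ z ] (χ a v b * (ν a x * (ν b z * μ x w z)))
      ≡⟨ trans (∑-cong V (λ x → pull (χ a v b) (ν a x) (λ z → ν b z * μ x w z)))
           (∑-*ˡ V (χ a v b) (λ x → ν a x * (Σᶠ[ z ] (ν b z * μ x w z)))) ⟩
    χ a v b * (Σᶠ[ x ] (ν a x * (Σᶠ[ z ] (ν b z * μ x w z))))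
      ≤⟨ *-monoʳ-≤ (χ a v b) (Σᶠ-weighted (ν a) (λ x → Σᶠ[ z ] (ν b z * μ x w z)) (Σ-ν a) (λ x → Σ-ν-μ-last ¬hb x w)) ⟩
    χ a v b * (n * k) ∎
    where open ≤-Reasoning

  centre-images : ∀ a v b w → ¬ High v → Σᶠ[ x ] Σᶠ[ z ] θ a v b x w z ≤ χ a v b * (n * k)
  centre-images a v b w ¬hv = cases (high? a) (high? b)
    where
    open ≤-Reasoning
    cases : Dec (High a) → Dec (High b) → Σᶠ[ x ] Σᶠ[ z ] θ a v b x w z ≤ χ a v b * (n * k)
    cases _        (no ¬hb) = centre-images-low a v b w ¬hv ¬hb
    cases (yes ha) (yes hb) = ≤-trans (∑-mono V (λ x → ∑-mono V (λ z → θ-zero {a} {v} {b} {x} {w} {z} (no-threat-ends ha hb) {0})))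
      (≤-trans (≤-reflexive (trans (∑-cong V (λ _ → ∑-zero V)) (∑-zero V))) z≤n)
    cases (no ¬ha) (yes _)  = begin
      Σᶠ[ x ] Σᶠ[ z ] θ a v b x w z     ≤⟨ ∑-mono V (λ x → ∑-mono V (λ z → θ-sym a v b x w z)) ⟩
      Σᶠ[ x ] Σᶠ[ z ] θ b v a z w x     ≡⟨ ∑-swap V V (λ x z → θ b v a z w x) ⟩
      Σᶠ[ z ] Σᶠ[ x ] θ b v a z w x     ≤⟨ centre-images-low b v a w ¬hv ¬ha ⟩
      χ b v a * (n * k)                 ≤⟨ *-monoˡ-≤ (n * k) (χ-sym b v a) ⟩
      χ a v b * (n * k)                 ∎

  -- Fixing the image of a low centre saves a factor `n` against `images`, but any of the ordered
  -- cherries may be involved.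
  centre-part : ∀ w → Σ³ (λ a v b → Σ³ (λ x y z → θ a v b x y z * (low v * δ w y))) ≤ 2R * (n * k)
  centre-part w = begin
    Σ³ (λ a v b → Σ³ (λ x y z → θ a v b x y z * (low v * δ w y)))
      ≤⟨ Σ³-mono pointwise ⟩
    Σ³ (λ a v b → χ a v b * (n * k))
      ≡⟨ Σ³-*ʳ χ (n * k) ⟩
    Σ³ χ * (n * k)
      ≤⟨ *-monoˡ-≤ (n * k) Σ³-χ ⟩
    2R * (n * k) ∎
    where
    open ≤-Reasoning
    comm : ∀ a b c → a * (b * c) ≡ c * (b * a)
    comm = solve-∀
    pointwise : ∀ a v b → Σ³ (λ x y z → θ a v b x y z * (low v * δ w y)) ≤ χ a v b * (n * k)
    pointwise a v b = begin
      Σᶠ[ x ] Σᶠ[ y ] Σᶠ[ z ] (θ a v b x y z * (low v * δ w y))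
        ≡⟨ ∑-cong V (λ x → ∑-cong V (λ y → trans (∑-cong V (λ z → comm (θ a v b x y z) (low v) (δ w y)))
             (pull (δ w y) (low v) (θ a v b x y)))) ⟩
      Σᶠ[ x ] Σᶠ[ y ] (δ w y * (low v * (Σᶠ[ z ] θ a v b x y z)))
        ≤⟨ ∑-mono V (λ x → δ-pick w (λ y → low v * (Σᶠ[ z ] θ a v b x y z))) ⟩
      Σᶠ[ x ] (low v * (Σᶠ[ z ] θ a v b x w z))
        ≡⟨ ∑-*ˡ V (low v) (λ x → Σᶠ[ z ] θ a v b x w z) ⟩
      low v * (Σᶠ[ x ] Σᶠ[ z ] θ a v b x w z)
        ≤⟨ low-∙ v (centre-images a v b w) ⟩
      χ a v b * (n * k) ∎

  -- For a fixed y, different high ends a cannot both satisfy this (Lone-unique): otherwise y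
  -- would be bad.  So the events with a high end a and image w for the other end add up to
  -- one choice of a for each y, not to one for each pair (a , y).
  Lone : Fin n → Fin n → Fin n → Set
  Lone w y a = High a × Mono (ψ a) y w × ¬ Bad xs y

  lone? : ∀ w y a → Dec (Lone w y a)
  lone? w y a = high? a ×-dec (mono? (ψ a) y w ×-dec ¬? (bad? xs y))

  Lone-unique : ∀ {w y a a′} → Lone w y a → Lone w y a′ → a ≡ a′
  Lone-unique {w} {y} {a} {a′} (ha , (ay , _ , _ , e) , ¬bad) (ha′ , (a′y , _ , _ , e′) , _) with ψ a F.≟ ψ a′
  ... | yes p = ψ-inj p
  ... | no ¬p = contradiction (lose (ψ∈xs ha) (lose (ψ∈xs ha′)
                  (inj₁ (ay , a′y ∘ sym , ¬p , trans e (trans (sym e′) (csym c (ψ a′) y)))))) ¬bad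

  -- If `a` is low, `y` is free and `x` lies in a colour class at `y`. If `a` is high, `x` is forced
  -- to be `ψ a` and every admissible `y` weighs `p`; these are kept as a `Lone` count, to be
  -- estimated only after summing over `a`.
  end-images : ∀ a v b w → ¬ High b →
    Σᶠ[ x ] Σᶠ[ y ] θ a v b x y w ≤ χ a v b * (n * k) + χ a v b * (p * (Σᶠ[ y ] ⟦ lone? w y a ⟧))
  end-images a v b w ¬hb = cases (high? a)
    where
    open ≤-Reasoning
    goal : ℕ
    goal = χ a v b * (n * k) + χ a v b * (p * (Σᶠ[ y ] ⟦ lone? w y a ⟧))
    cases : Dec (High a) → Σᶠ[ x ] Σᶠ[ y ] θ a v b x y w ≤ goal
    cases (no ¬ha) = begin
      Σᶠ[ x ] Σᶠ[ y ] θ a v b x y w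
        ≡⟨ ∑-swap V V (λ x y → θ a v b x y w) ⟩
      Σᶠ[ y ] Σᶠ[ x ] θ a v b x y w
        ≤⟨ ∑-mono V (λ y → ∑-mono V (λ x → ≤-trans (θ-≤ a v b x y w) (*-monoʳ-≤ (χ a v b) (drop x y)))) ⟩
      Σᶠ[ y ] Σᶠ[ x ] (χ a v b * (ν v y * (ν a x * μ x y w)))
        ≡⟨ trans (∑-cong V (λ y → pull (χ a v b) (ν v y) (λ x → ν a x * μ x y w)))
             (∑-*ˡ V (χ a v b) (λ y → ν v y * (Σᶠ[ x ] (ν a x * μ x y w)))) ⟩
      χ a v b * (Σᶠ[ y ] (ν v y * (Σᶠ[ x ] (ν a x * μ x y w))))
        ≤⟨ *-monoʳ-≤ (χ a v b) (Σᶠ-weighted (ν v) (λ y → Σᶠ[ x ] (ν a x * μ x y w)) (Σ-ν v) (λ y → Σ-ν-μ-first ¬ha y w)) ⟩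
      χ a v b * (n * k)
        ≤⟨ m≤m+n _ _ ⟩
      goal ∎
      where
      shuffle : ∀ A B D → A * (B * (1 * D)) ≡ B * (A * D)
      shuffle = solve-∀
      drop : ∀ x y → ν a x * (ν v y * (ν b w * μ x y w)) ≤ ν v y * (ν a x * μ x y w)
      drop x y = ≤-trans (*-monoʳ-≤ (ν a x) (*-monoʳ-≤ (ν v y) (*-monoˡ-≤ (μ x y w) (ν-low w ¬hb))))
                         (≤-reflexive (shuffle (ν a x) (ν v y) (μ x y w)))
    cases (yes ha) = begin
      Σᶠ[ x ] Σᶠ[ y ] θ a v b x y w
        ≤⟨ ∑-mono V (λ x → ∑-mono V (λ y → lonely x y)) ⟩
      Σᶠ[ x ] Σᶠ[ y ] (δ (ψ a) x * (χ a v b * (p * ⟦ lone? w y a ⟧)))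
        ≡⟨ ∑-cong V (λ x → ∑-*ˡ V (δ (ψ a) x) (λ y → χ a v b * (p * ⟦ lone? w y a ⟧))) ⟩
      Σᶠ[ x ] (δ (ψ a) x * (Σᶠ[ y ] (χ a v b * (p * ⟦ lone? w y a ⟧))))
        ≤⟨ δ-pick (ψ a) (λ _ → Σᶠ[ y ] (χ a v b * (p * ⟦ lone? w y a ⟧))) ⟩
      Σᶠ[ y ] (χ a v b * (p * ⟦ lone? w y a ⟧))
        ≡⟨ pull (χ a v b) p (λ y → ⟦ lone? w y a ⟧) ⟩
      χ a v b * (p * (Σᶠ[ y ] ⟦ lone? w y a ⟧))
        ≤⟨ m≤n+m _ (χ a v b * (n * k)) ⟩
      goal ∎
      where
      ωs : ¬ High v → ω a * ω v * ω b ≡ p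
      ωs ¬hv = trans (cong₂ _*_ (cong₂ _*_ (ω-high (high? a)) (ω-low (high? v) ¬hv)) (ω-low (high? b) ¬hb))
                     (trans (*-identityʳ (p * 1)) (*-identityʳ p))
        where
        ω-high : (d : Dec (High a)) → ωᵈ d ≡ p
        ω-high (yes _) = refl
        ω-high (no ¬h) = contradiction ha ¬h
        ω-low : ∀ {u} (d : Dec (High u)) → ¬ High u → ωᵈ d ≡ 1
        ω-low (yes h) ¬h = contradiction h ¬h
        ω-low (no _)  _  = refl
      lonely : ∀ x y → θ a v b x y w ≤ δ (ψ a) x * (χ a v b * (p * ⟦ lone? w y a ⟧))
      lonely x y = ⟦⟧*-≤ (threat? a v b x y w) bound
        where
        bound : Threat a v b x y w → ω a * ω v * ω b ≤ δ (ψ a) x * (χ a v b * (p * ⟦ lone? w y a ⟧))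
        bound τ@(ch@(av , _) , m , (oka , _) , (_ , okv) , _) = begin
          ω a * ω v * ω b                                        ≡⟨ ωs ¬hv ⟩
          p                                                      ≡⟨ shape p ⟩
          1 * (1 * (p * 1))                                      ≡⟨ cong₂ _*_ (sym (⟦⟧-yes (ψ a F.≟ x) (sym (oka ha))))
                                                                      (cong₂ _*_ (sym (⟦⟧-yes (cherry? a v b) ch))
                                                                        (cong (p *_) (sym (⟦⟧-yes (lone? w y a)
                                                                          (ha , subst (λ x → Mono x y w) (oka ha) m , okv ¬hv (near ha av)))))) ⟩
          δ (ψ a) x * (χ a v b * (p * ⟦ lone? w y a ⟧))          ∎
          where
          ¬hv : ¬ High v
          ¬hv hv = no-threat-arm ha hv τ
          shape : ∀ p → p ≡ 1 * (1 * (p * 1))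
          shape = solve-∀

  -- After `ended a` ≤ 2t is taken out, the `Lone` counts are summed over all `a` at once: each `y`
  -- serves at most one `a`, so they total at most `n`.
  end-part : ∀ {t} w → (∀ a → ended a ≤ 2 * t) →
    Σ³ (λ a v b → Σ³ (λ x y z → θ a v b x y z * (low b * δ w z))) ≤ 2R * (n * k) + 2 * t * (n * n)
  end-part {t} w end≤ = begin
    Σ³ (λ a v b → Σ³ (λ x y z → θ a v b x y z * (low b * δ w z)))
      ≤⟨ Σ³-mono pointwise ⟩
    Σ³ (λ a v b → χ a v b * (n * k) + χ a v b * L a)
      ≡⟨ Σ³-+ (λ a v b → χ a v b * (n * k)) (λ a v b → χ a v b * L a) ⟩
    Σ³ (λ a v b → χ a v b * (n * k)) + Σ³ (λ a v b → χ a v b * L a)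
      ≤⟨ +-mono-≤ (≤-trans (≤-reflexive (Σ³-*ʳ χ (n * k))) (*-monoˡ-≤ (n * k) Σ³-χ)) lone-part ⟩
    2R * (n * k) + 2 * t * (n * n) ∎
    where
    open ≤-Reasoning
    L : Fin n → ℕ
    L a = p * (Σᶠ[ y ] ⟦ lone? w y a ⟧)
    comm : ∀ a b c → a * (b * c) ≡ c * (b * a)
    comm = solve-∀
    lone-part : Σ³ (λ a v b → χ a v b * L a) ≤ 2 * t * (n * n)
    lone-part = begin
      Σᶠ[ a ] Σᶠ[ v ] Σᶠ[ b ] (χ a v b * L a)
        ≡⟨ ∑-cong V (λ a → trans (∑-cong V (λ v → ∑-*ʳ V (L a) (χ a v))) (∑-*ʳ V (L a) (λ v → Σᶠ (χ a v)))) ⟩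
      Σᶠ[ a ] (ended a * L a)
        ≤⟨ ∑-mono V (λ a → *-monoˡ-≤ (L a) (end≤ a)) ⟩
      Σᶠ[ a ] (2 * t * L a)
        ≡⟨ trans (∑-*ˡ V (2 * t) L) (cong (2 * t *_) (∑-*ˡ V p (λ a → Σᶠ[ y ] ⟦ lone? w y a ⟧))) ⟩
      2 * t * (p * (Σᶠ[ a ] Σᶠ[ y ] ⟦ lone? w y a ⟧))
        ≡⟨ cong (λ s → 2 * t * (p * s)) (∑-swap V V (λ a y → ⟦ lone? w y a ⟧)) ⟩
      2 * t * (p * (Σᶠ[ y ] Σᶠ[ a ] ⟦ lone? w y a ⟧))
        ≤⟨ *-monoʳ-≤ (2 * t) (*-mono-≤ p≤n (≤-trans (Σᶠ-≤-const 1 (λ y → Σᶠ-≤1 (lone? w y) Lone-unique))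
             (≤-reflexive (*-identityʳ n)))) ⟩
      2 * t * (n * n) ∎
    pointwise : ∀ a v b → Σ³ (λ x y z → θ a v b x y z * (low b * δ w z)) ≤ χ a v b * (n * k) + χ a v b * L a
    pointwise a v b = begin
      Σᶠ[ x ] Σᶠ[ y ] Σᶠ[ z ] (θ a v b x y z * (low b * δ w z))
        ≤⟨ ∑-mono V (λ x → ∑-mono V (λ y → ≤-trans (≤-reflexive (∑-cong V (λ z → comm (θ a v b x y z) (low b) (δ w z))))
             (δ-pick w (λ z → low b * θ a v b x y z)))) ⟩
      Σᶠ[ x ] Σᶠ[ y ] (low b * θ a v b x y w)
        ≡⟨ trans (∑-cong V (λ x → ∑-*ˡ V (low b) (λ y → θ a v b x y w))) (∑-*ˡ V (low b) (λ x → Σᶠ[ y ] θ a v b x y w)) ⟩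
      low b * (Σᶠ[ x ] Σᶠ[ y ] θ a v b x y w)
        ≤⟨ low-∙ b (end-images a v b w) ⟩
      χ a v b * (n * k) + χ a v b * L a ∎

  start-part : ∀ {t} w → (∀ a → ended a ≤ 2 * t) →
    Σ³ (λ a v b → Σ³ (λ x y z → θ a v b x y z * (low a * δ w x))) ≤ 2R * (n * k) + 2 * t * (n * n)
  start-part {t} w end≤ = begin
    Σ³ (λ a v b → Σ³ (λ x y z → θ a v b x y z * (low a * δ w x)))
      ≡⟨ Σ³-rev (λ a v b → Σ³ (λ x y z → θ a v b x y z * (low a * δ w x))) ⟩
    Σ³ (λ a v b → Σ³ (λ x y z → θ b v a x y z * (low b * δ w x)))
      ≡⟨ Σ³-cong (λ a v b → Σ³-rev (λ x y z → θ b v a x y z * (low b * δ w x))) ⟩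
    Σ³ (λ a v b → Σ³ (λ x y z → θ b v a z y x * (low b * δ w z)))
      ≤⟨ Σ³-mono (λ a v b → Σ³-mono (λ x y z → *-monoˡ-≤ (low b * δ w z) (θ-sym b v a z y x))) ⟩
    Σ³ (λ a v b → Σ³ (λ x y z → θ a v b x y z * (low b * δ w z)))
      ≤⟨ end-part {t} w end≤ ⟩
    2R * (n * k) + 2 * t * (n * n) ∎
    where open ≤-Reasoning

  near-count : Σᶠ[ u ] ⟦ nearHigh? u ⟧ ≤ ∑ (filter high? V) degree
  near-count = begin
    Σᶠ[ u ] ⟦ nearHigh? u ⟧                             ≤⟨ ∑-mono V (λ u → ⟦⟧-≤ (nearHigh? u) (witness u)) ⟩
    Σᶠ[ u ] Σᶠ[ a ] (⟦ high? a ⟧ * ⟦ edge? a u ⟧)       ≡⟨ ∑-swap V V (λ u a → ⟦ high? a ⟧ * ⟦ edge? a u ⟧) ⟩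
    Σᶠ[ a ] Σᶠ[ u ] (⟦ high? a ⟧ * ⟦ edge? a u ⟧)       ≡⟨ ∑-cong V (λ a → ∑-*ˡ V ⟦ high? a ⟧ (λ u → ⟦ edge? a u ⟧)) ⟩
    Σᶠ[ a ] (⟦ high? a ⟧ * degree a)                    ≡⟨ sym (∑-filter high? V degree) ⟩
    ∑ (filter high? V) degree                           ∎
    where
    open ≤-Reasoning
    witness : ∀ u → NearHigh u → 1 ≤ Σᶠ[ a ] (⟦ high? a ⟧ * ⟦ edge? a u ⟧)
    witness u nr = let a , _ , ha , au = find nr in begin
      1                                               ≡⟨ sym (cong₂ _*_ (⟦⟧-yes (high? a) ha) (⟦⟧-yes (edge? a u) au)) ⟩
      ⟦ high? a ⟧ * ⟦ edge? a u ⟧                     ≤⟨ ≤Σᶠ (λ a → ⟦ high? a ⟧ * ⟦ edge? a u ⟧) a ⟩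
      Σᶠ[ a ] (⟦ high? a ⟧ * ⟦ edge? a u ⟧)           ∎

  -- The list of events and its total load

  open Pins n

  P₀ : List Pin
  P₀ = map (λ a → a , ψ a) (filter high? V)

  pinᵈ : ∀ {u} → Dec (High u) → Fin n → List Pin
  pinᵈ     (yes _) x = []
  pinᵈ {u} (no _)  x = (u , x) ∷ []

  pins : (Fin n × Fin n × Fin n) × (Fin n × Fin n × Fin n) → List Pin
  pins ((a , v , b) , (x , y , z)) = pinᵈ (high? a) x ++ pinᵈ (high? v) y ++ pinᵈ (high? b) z

  threatAt? : Decidable (λ (((a , v , b) , (x , y , z)) : (Fin n × Fin n × Fin n) × (Fin n × Fin n × Fin n)) → Threat a v b x y z)
  threatAt? ((a , v , b) , (x , y , z)) = threat? a v b x y z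

  Single : Pin → Set
  Single (u , x) = ¬ High u × NearHigh u × Bad xs x

  single? : Decidable Single
  single? (u , x) = ¬? (high? u) ×-dec (nearHigh? u ×-dec bad? xs x)

  triples : List (Fin n × Fin n × Fin n)
  triples = cartesianProduct V (cartesianProduct V V)

  ∈-triples : ∀ a v b → (a , v , b) ∈ triples
  ∈-triples a v b = ∈-cartesianProduct⁺ (∈-allFin a) (∈-cartesianProduct⁺ (∈-allFin v) (∈-allFin b))

  singles mixed events : List (List Pin)
  singles = map (_∷ []) (filter single? (cartesianProduct V V))
  mixed   = map pins (filter threatAt? (cartesianProduct triples triples))
  events  = singles ++ mixed

  -- `wt` and `inc` unfold to `weight` and `incidence`; restated here, they do not depend on the
  -- fixed pins and the room condition.
  wt : List Pin → ℕ
  wt B = p ^ (3 ∸ length B)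

  inc : Fin n → Fin n → List Pin → ℕ
  inc u w B = ∑[ (v , y) ∈ B ] (δ u v + δ w y)

  wt-pins : ∀ {a v b x y z} (da : Dec (High a)) (dv : Dec (High v)) (db : Dec (High b)) →
            wt (pinᵈ da x ++ pinᵈ dv y ++ pinᵈ db z) ≡ ωᵈ da * ωᵈ dv * ωᵈ db
  wt-pins (yes _) (yes _) (yes _) = ppp p
    where
    ppp : ∀ p → p * (p * (p * 1)) ≡ p * p * p
    ppp = solve-∀
  wt-pins (yes _) (yes _) (no _)  = pp p
    where
    pp : ∀ p → p * (p * 1) ≡ p * p * 1
    pp = solve-∀
  wt-pins (yes _) (no _)  (yes _) = pp p
    where
    pp : ∀ p → p * (p * 1) ≡ p * 1 * p
    pp = solve-∀
  wt-pins (no _)  (yes _) (yes _) = pp p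
    where
    pp : ∀ p → p * (p * 1) ≡ 1 * p * p
    pp = solve-∀
  wt-pins (yes _) (no _)  (no _)  = sym (*-identityʳ (p * 1))
  wt-pins (no _)  (yes _) (no _)  = pp p
    where
    pp : ∀ p → p * 1 ≡ 1 * p * 1
    pp = solve-∀
  wt-pins (no _)  (no _)  (yes _) = pp p
    where
    pp : ∀ p → p * 1 ≡ 1 * 1 * p
    pp = solve-∀
  wt-pins (no _)  (no _)  (no _)  = refl

  inc-pin : ∀ {a} u w x (d : Dec (High a)) → inc u w (pinᵈ d x) ≤ δ u a + ⟦ ¬? d ⟧ * δ w x
  inc-pin {a} u w x (yes _) = z≤n
  inc-pin {a} u w x (no _)  = ≤-reflexive (trans (+-identityʳ _) (cong (δ u a +_) (sym (*-identityˡ (δ w x)))))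

  inc-pins : ∀ u w a v b x y z → inc u w (pins ((a , v , b) , (x , y , z))) ≤
    (δ u a + δ u v + δ u b) + low a * δ w x + low v * δ w y + low b * δ w z
  inc-pins u w a v b x y z = begin
    inc u w (pins ((a , v , b) , (x , y , z)))
      ≡⟨ trans (∑-++ Pa (Pv ++ Pb) f) (cong (inc u w Pa +_) (∑-++ Pv Pb f)) ⟩
    inc u w Pa + (inc u w Pv + inc u w Pb)
      ≤⟨ +-mono-≤ (inc-pin u w x (high? a)) (+-mono-≤ (inc-pin u w y (high? v)) (inc-pin u w z (high? b))) ⟩
    δ u a + low a * δ w x + (δ u v + low v * δ w y + (δ u b + low b * δ w z))
      ≡⟨ regroup (δ u a) (low a * δ w x) (δ u v) (low v * δ w y) (δ u b) (low b * δ w z) ⟩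
    (δ u a + δ u v + δ u b) + low a * δ w x + low v * δ w y + low b * δ w z ∎
    where
    open ≤-Reasoning
    Pa Pv Pb : List Pin
    Pa = pinᵈ (high? a) x
    Pv = pinᵈ (high? v) y
    Pb = pinᵈ (high? b) z
    f : Pin → ℕ
    f (v , y) = δ u v + δ w y
    regroup : ∀ a b c d e f → a + b + (c + d + (e + f)) ≡ (a + c + e) + b + d + f
    regroup = solve-∀

  module _ {t : ℕ} (end≤ : ∀ a → ended a ≤ 2 * t) (cen≤ : ∀ {u} → ¬ High u → centred u ≤ 2 * t) where

    ∑-triples : ∀ (f : (Fin n × Fin n × Fin n) → ℕ) → ∑ triples f ≡ Σ³ (λ a v b → f (a , v , b))
    ∑-triples f = trans (∑-cartesianProduct V (cartesianProduct V V) f)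
      (∑-cong V (λ a → ∑-cartesianProduct V V (λ vb → f (a , vb))))

    -- The summands are, in order: the vertex `u` in any role, then the image `w` at the first end,
    -- at the centre and at the last end of the cherry.
    mixed-load : ∀ {u} → ¬ High u → ∀ w → ∑[ B ∈ mixed ] (wt B * inc u w B) ≤
      6 * t * (n * (n * k)) + (2R * (n * k) + 2 * t * (n * n)) + 2R * (n * k) + (2R * (n * k) + 2 * t * (n * n))
    mixed-load {u} ¬hu w = begin
      ∑[ B ∈ mixed ] (wt B * inc u w B)
        ≡⟨ ∑-map (filter threatAt? (cartesianProduct triples triples)) pins (λ B → wt B * inc u w B) ⟩
      ∑[ τ ∈ filter threatAt? (cartesianProduct triples triples) ] (wt (pins τ) * inc u w (pins τ))
        ≡⟨ ∑-filter threatAt? (cartesianProduct triples triples) (λ τ → wt (pins τ) * inc u w (pins τ)) ⟩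
      ∑[ τ ∈ cartesianProduct triples triples ] g τ
        ≡⟨ trans (∑-cartesianProduct triples triples g)
             (trans (∑-triples (λ q → ∑[ r ∈ triples ] g (q , r)))
               (Σ³-cong (λ a v b → ∑-triples (λ r → g ((a , v , b) , r))))) ⟩
      Σ³ (λ a v b → Σ³ (λ x y z → g ((a , v , b) , (x , y , z))))
        ≤⟨ Σ³-mono (λ a v b → Σ³-mono (g≤ a v b)) ⟩
      Σ³ (λ a v b → Σ³ (λ x y z → I a v b x y z + S a v b x y z + M a v b x y z + E a v b x y z))
        ≡⟨ Σ⁶-+ (λ a v b x y z → I a v b x y z + S a v b x y z + M a v b x y z) E ⟩
      Σ⁶ (λ a v b x y z → I a v b x y z + S a v b x y z + M a v b x y z) + Σ⁶ E
        ≡⟨ cong (_+ Σ⁶ E) (trans (Σ⁶-+ (λ a v b x y z → I a v b x y z + S a v b x y z) M)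
             (cong (_+ Σ⁶ M) (Σ⁶-+ I S))) ⟩
      Σ⁶ I + Σ⁶ S + Σ⁶ M + Σ⁶ E
        ≤⟨ +-mono-≤ (+-mono-≤ (+-mono-≤ (domain-part {t} u (end≤ u) (cen≤ ¬hu)) (start-part {t} w end≤)) (centre-part w)) (end-part {t} w end≤) ⟩
      6 * t * (n * (n * k)) + (2R * (n * k) + 2 * t * (n * n)) + 2R * (n * k) + (2R * (n * k) + 2 * t * (n * n)) ∎
      where
      open ≤-Reasoning
      g : (Fin n × Fin n × Fin n) × (Fin n × Fin n × Fin n) → ℕ
      g τ = ⟦ threatAt? τ ⟧ * (wt (pins τ) * inc u w (pins τ))
      Hex : Set
      Hex = Fin n → Fin n → Fin n → Fin n → Fin n → Fin n → ℕ
      Σ⁶ : Hex → ℕ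
      Σ⁶ f = Σ³ (λ a v b → Σ³ (f a v b))
      Σ⁶-+ : ∀ (f g : Hex) → Σ⁶ (λ a v b x y z → f a v b x y z + g a v b x y z) ≡ Σ⁶ f + Σ⁶ g
      Σ⁶-+ f g = trans (Σ³-cong (λ a v b → Σ³-+ (f a v b) (g a v b))) (Σ³-+ (λ a v b → Σ³ (f a v b)) (λ a v b → Σ³ (g a v b)))
      I S M E : Hex
      I a v b x y z = θ a v b x y z * (δ u a + δ u v + δ u b)
      S a v b x y z = θ a v b x y z * (low a * δ w x)
      M a v b x y z = θ a v b x y z * (low v * δ w y)
      E a v b x y z = θ a v b x y z * (low b * δ w z)
      distrib : ∀ θ a b c d → θ * (a + b + c + d) ≡ θ * a + θ * b + θ * c + θ * d
      distrib = solve-∀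
      g≤ : ∀ a v b x y z → g ((a , v , b) , (x , y , z)) ≤ I a v b x y z + S a v b x y z + M a v b x y z + E a v b x y z
      g≤ a v b x y z = begin
        ⟦ threat? a v b x y z ⟧ * (wt τ * inc u w τ)
          ≡⟨ sym (*-assoc ⟦ threat? a v b x y z ⟧ (wt τ) (inc u w τ)) ⟩
        ⟦ threat? a v b x y z ⟧ * wt τ * inc u w τ
          ≡⟨ cong (λ q → ⟦ threat? a v b x y z ⟧ * q * inc u w τ) (wt-pins (high? a) (high? v) (high? b)) ⟩
        θ a v b x y z * inc u w τ
          ≤⟨ *-monoʳ-≤ (θ a v b x y z) (inc-pins u w a v b x y z) ⟩
        θ a v b x y z * ((δ u a + δ u v + δ u b) + low a * δ w x + low v * δ w y + low b * δ w z)
          ≡⟨ distrib (θ a v b x y z) (δ u a + δ u v + δ u b) (low a * δ w x) (low v * δ w y) (low b * δ w z) ⟩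
        I a v b x y z + S a v b x y z + M a v b x y z + E a v b x y z ∎
        where
        τ : List Pin
        τ = pins ((a , v , b) , (x , y , z))

  -- A one-pin event meets the pair `u`, `w` either at the vertex `u`, through one of the bad
  -- images, or at the image `w`, through one of the neighbours of high vertices.
  single-load : ∀ u w → ∑[ B ∈ singles ] (wt B * inc u w B) ≤
    p ^ 2 * ((Σᶠ[ x ] ⟦ bad? xs x ⟧) + (Σᶠ[ v ] ⟦ nearHigh? v ⟧))
  single-load u w = begin
    ∑[ B ∈ singles ] (wt B * inc u w B)
      ≡⟨ ∑-map (filter single? (cartesianProduct V V)) (_∷ []) (λ B → wt B * inc u w B) ⟩
    ∑[ b ∈ filter single? (cartesianProduct V V) ] (p ^ 2 * inc u w (b ∷ []))
      ≡⟨ ∑-*ˡ (filter single? (cartesianProduct V V)) (p ^ 2) (λ b → inc u w (b ∷ [])) ⟩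
    p ^ 2 * (∑[ b ∈ filter single? (cartesianProduct V V) ] inc u w (b ∷ []))
      ≤⟨ *-monoʳ-≤ (p ^ 2) (begin
      ∑[ b ∈ filter single? (cartesianProduct V V) ] inc u w (b ∷ [])
        ≡⟨ trans (∑-filter single? (cartesianProduct V V) (λ b → inc u w (b ∷ []))) (∑-cartesianProduct V V _) ⟩
      Σᶠ[ v ] Σᶠ[ x ] (⟦ single? (v , x) ⟧ * (δ u v + δ w x + 0))
        ≤⟨ ∑-mono V (λ v → ∑-mono V (λ x → ⟦⟧*-≤ (single? (v , x)) (bound v x))) ⟩
      Σᶠ[ v ] Σᶠ[ x ] (δ u v * ⟦ bad? xs x ⟧ + δ w x * ⟦ nearHigh? v ⟧)
        ≡⟨ trans (∑-cong V (λ v → trans (∑-+ V (λ x → δ u v * ⟦ bad? xs x ⟧) (λ x → δ w x * ⟦ nearHigh? v ⟧))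
                    (cong (_+ (Σᶠ[ x ] (δ w x * ⟦ nearHigh? v ⟧))) (∑-*ˡ V (δ u v) (λ x → ⟦ bad? xs x ⟧)))))
             (∑-+ V (λ v → δ u v * (Σᶠ[ x ] ⟦ bad? xs x ⟧)) (λ v → Σᶠ[ x ] (δ w x * ⟦ nearHigh? v ⟧))) ⟩
      (Σᶠ[ v ] (δ u v * (Σᶠ[ x ] ⟦ bad? xs x ⟧))) + (Σᶠ[ v ] Σᶠ[ x ] (δ w x * ⟦ nearHigh? v ⟧))
        ≤⟨ +-mono-≤ (δ-pick u (λ _ → Σᶠ[ x ] ⟦ bad? xs x ⟧)) (∑-mono V (λ v → δ-pick w (λ _ → ⟦ nearHigh? v ⟧))) ⟩
      (Σᶠ[ x ] ⟦ bad? xs x ⟧) + (Σᶠ[ v ] ⟦ nearHigh? v ⟧) ∎) ⟩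
    p ^ 2 * ((Σᶠ[ x ] ⟦ bad? xs x ⟧) + (Σᶠ[ v ] ⟦ nearHigh? v ⟧)) ∎
    where
    open ≤-Reasoning
    bound : ∀ v x → Single (v , x) → δ u v + δ w x + 0 ≤ δ u v * ⟦ bad? xs x ⟧ + δ w x * ⟦ nearHigh? v ⟧
    bound v x (_ , nr , bd) = ≤-reflexive (trans (+-identityʳ _) (cong₂ _+_
      (trans (sym (*-identityʳ (δ u v))) (cong (δ u v *_) (sym (⟦⟧-yes (bad? xs x) bd))))
      (trans (sym (*-identityʳ (δ w x))) (cong (δ w x *_) (sym (⟦⟧-yes (nearHigh? v) nr))))))

  low⇒free : ∀ {u} → ¬ High u → All (λ (v , _) → u ≢ v) P₀
  low⇒free ¬hu = Allₚ.map⁺ (All.tabulate λ a∈ u≡a →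
    ¬hu (subst High (sym u≡a) (proj₂ (∈-filter⁻ high? {xs = V} a∈))))

  high⇒pin : ∀ {a} → High a → (a , ψ a) ∈ P₀
  high⇒pin {a} ha = ∈-map⁺ (λ a → a , ψ a) (∈-filter⁺ high? (∈-allFin a) ha)

  free⇒low : ∀ {u} → All (λ (v , _) → u ≢ v) P₀ → ¬ High u
  free⇒low free hu = All.lookup free (high⇒pin hu) refl

  -- Application of the local lemma

  module Conclusion (t : ℕ) (k>0 : 0 < k) (end≤ : ∀ a → ended a ≤ 2 * t)
    (cen≤ : ∀ {u} → ¬ High u → centred u ≤ 2 * t) (near≤ : ∑ (filter high? V) degree ≤ 2 * t)
    (bad≤ : Σᶠ[ x ] ⟦ bad? xs x ⟧ ≤ 3 * (t * k)) (2R≤ : 2R ≤ 2 * (t * t))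
    (9n≤10p : 9 * n ≤ 10 * p) (280tk≤n : 280 * (t * k) ≤ n)
    (room : p + (3 + length P₀) ≤ suc n) (proper : Proper xs) where

    IsValid : List Pin → Set
    IsValid = Valid P₀ p p>0 room

    valid-single : ∀ {u x} → ¬ High u → IsValid ((u , x) ∷ [])
    valid-single ¬hu = valid (s≤s z≤n) (s≤s z≤n) ([] ∷ []) (low⇒free ¬hu ∷ [])

    valid-pins : ∀ {a v b} x y z → a ≢ v → v ≢ b → a ≢ b → ¬ (High a × High v × High b) →
      (da : Dec (High a)) (dv : Dec (High v)) (db : Dec (High b)) → IsValid (pinᵈ da x ++ pinᵈ dv y ++ pinᵈ db z)
    valid-pins x y z a≢v v≢b a≢b nh (yes ha) (yes hv) (yes hb) = contradiction (ha , hv , hb) nh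
    valid-pins x y z a≢v v≢b a≢b nh (yes _)  (yes _)  (no ¬b)  = valid-single ¬b
    valid-pins x y z a≢v v≢b a≢b nh (yes _)  (no ¬v)  (yes _)  = valid-single ¬v
    valid-pins x y z a≢v v≢b a≢b nh (no ¬a)  (yes _)  (yes _)  = valid-single ¬a
    valid-pins x y z a≢v v≢b a≢b nh (yes _)  (no ¬v)  (no ¬b)  =
      valid (s≤s z≤n) (s≤s (s≤s z≤n)) ((v≢b ∷ []) ∷ [] ∷ []) (low⇒free ¬v ∷ low⇒free ¬b ∷ [])
    valid-pins x y z a≢v v≢b a≢b nh (no ¬a)  (yes _)  (no ¬b)  =
      valid (s≤s z≤n) (s≤s (s≤s z≤n)) ((a≢b ∷ []) ∷ [] ∷ []) (low⇒free ¬a ∷ low⇒free ¬b ∷ [])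
    valid-pins x y z a≢v v≢b a≢b nh (no ¬a)  (no ¬v)  (yes _)  =
      valid (s≤s z≤n) (s≤s (s≤s z≤n)) ((a≢v ∷ []) ∷ [] ∷ []) (low⇒free ¬a ∷ low⇒free ¬v ∷ [])
    valid-pins x y z a≢v v≢b a≢b nh (no ¬a)  (no ¬v)  (no ¬b)  =
      valid (s≤s z≤n) (s≤s (s≤s (s≤s z≤n))) ((a≢v ∷ a≢b ∷ []) ∷ (v≢b ∷ []) ∷ [] ∷ [])
        (low⇒free ¬a ∷ low⇒free ¬v ∷ low⇒free ¬b ∷ [])

    valid-threat : ∀ {a v b x y z} → Threat a v b x y z → IsValid (pins ((a , v , b) , (x , y , z)))
    valid-threat {a} {v} {b} {x} {y} {z} ((av , vb , a≢b) , _ , _ , _ , _ , nh) =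
      valid-pins x y z (edge-irrefl av) (edge-irrefl vb) a≢b nh (high? a) (high? v) (high? b)

    valid-singles : All IsValid singles
    valid-singles = Allₚ.map⁺ (All.tabulate λ {b} b∈ →
      valid-single {proj₁ b} {proj₂ b} (proj₁ (proj₂ (∈-filter⁻ single? {xs = cartesianProduct V V} b∈))))

    valid-mixed : All IsValid mixed
    valid-mixed = Allₚ.map⁺ (All.tabulate λ τ∈ →
      valid-threat (proj₂ (∈-filter⁻ threatAt? {xs = cartesianProduct triples triples} τ∈)))

    valid-events : All IsValid events
    valid-events = Allₚ.++⁺ valid-singles valid-mixed

    load≤ : ∀ {u} → All (λ (v , _) → u ≢ v) P₀ → ∀ w → 12 * ∑[ B ∈ events ] (wt B * inc u w B) ≤ p ^ 3
    load≤ {u} free w = begin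
      12 * ∑[ B ∈ events ] (wt B * inc u w B)
        ≡⟨ cong (12 *_) (∑-++ singles mixed (λ B → wt B * inc u w B)) ⟩
      12 * (∑[ B ∈ singles ] (wt B * inc u w B) + ∑[ B ∈ mixed ] (wt B * inc u w B))
        ≤⟨ *-monoʳ-≤ 12 (+-mono-≤
             (≤-trans (single-load u w) (*-monoʳ-≤ (p ^ 2) (+-mono-≤ bad≤ (≤-trans near-count near≤))))
             (mixed-load {t} end≤ cen≤ {u} (free⇒low free) w)) ⟩
      12 * (p ^ 2 * (3 * (t * k) + 2 * t)
        + (6 * t * (n * (n * k)) + (2R * (n * k) + 2 * t * (n * n)) + 2R * (n * k) + (2R * (n * k) + 2 * t * (n * n))))
        ≤⟨ total-load-≤ {n} {p} {t} {k} {2R} k>0 p≤n 9n≤10p 280tk≤n 2R≤ ⟩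
      p ^ 3 ∎
      where open ≤-Reasoning

    φ₀ : Embedding
    φ₀ = Vec.tabulate ψ

    φ₀-good : Inj φ₀ × Holds P₀ φ₀
    φ₀-good = (λ i j e → ψ-inj (trans (sym (lookup∘tabulate ψ i)) (trans e (lookup∘tabulate ψ j)))) ,
              Allₚ.map⁺ (All.tabulate λ {a} _ → lookup∘tabulate ψ a)

    module _ (φ : Embedding) (φ-inj : Inj φ) (φ-P₀ : Holds P₀ φ) (φ-avoids : All (λ B → ¬ Holds B φ) events) where

      allowed : ∀ u → Allowed u (lookup φ u)
      allowed u = (λ hu → All.lookup φ-P₀ (high⇒pin hu)) ,
        λ ¬hu nr bd → All.lookup φ-avoids
          (∈-++⁺ˡ (∈-map⁺ (_∷ []) (∈-filter⁺ single? (∈-cartesianProduct⁺ (∈-allFin u) (∈-allFin (lookup φ u))) (¬hu , nr , bd))))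
          (refl ∷ [])

      holds-pin : ∀ {u} (d : Dec (High u)) → Holds (pinᵈ d (lookup φ u)) φ
      holds-pin (yes _) = []
      holds-pin (no _)  = refl ∷ []

      -- If all three vertices are high, the clique is proper. Otherwise the cherry with its actual
      -- images is a listed threat, and its pins hold by `refl`.
      not-mono : ∀ {a v b} → Cherry a v b → ¬ Mono (lookup φ a) (lookup φ v) (lookup φ b)
      not-mono {a} {v} {b} ch m = cases (high? a ×-dec (high? v ×-dec high? b))
        where
        in-xs : ∀ {u} → High u → lookup φ u ∈ xs
        in-xs {u} hu = subst (_∈ xs) (sym (proj₁ (allowed u) hu)) (ψ∈xs hu)
        cases : ¬ Dec (High a × High v × High b)
        cases (yes (ha , hv , hb)) = proper (in-xs ha) (in-xs hv) (in-xs hb) m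
        cases (no nh) = All.lookup φ-avoids
          (∈-++⁺ʳ singles (∈-map⁺ pins (∈-filter⁺ threatAt? (∈-cartesianProduct⁺ (∈-triples a v b)
            (∈-triples (lookup φ a) (lookup φ v) (lookup φ b))) (ch , m , allowed a , allowed v , allowed b , nh))))
          (Allₚ.++⁺ (holds-pin (high? a)) (Allₚ.++⁺ (holds-pin (high? v)) (holds-pin (high? b))))

      proper-embedding : GProper G c
      proper-embedding = lookup φ , (λ {i} {j} → φ-inj i j) , λ u v w uv vw u≢w e →
        not-mono (uv , vw , u≢w)
          ((λ q → edge-irrefl uv (φ-inj u v q)) , (λ q → edge-irrefl vw (φ-inj v w q)) , (λ q → u≢w (φ-inj u w q)) , e)

    g-proper : GProper G c
    g-proper = finish (embed P₀ p p>0 room events valid-events load≤ φ₀ φ₀-good)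
      where
      finish : (∃ λ φ → (Inj φ × Holds P₀ φ) × All (λ B → ¬ Holds B φ) events) → GProper G c
      finish (φ , (inj , hP) , av) = proper-embedding φ inj hP av

-- Choice of the parameters

∑-≤-average : ∀ (xs : List A) {f m} → (∀ x → length xs * f x ≤ m) → ∑ xs f ≤ m
∑-≤-average []           h = z≤n
∑-≤-average xs@(_ ∷ _) {f} {m} h = *-cancelˡ-≤ (length xs) (begin
  length xs * ∑ xs f               ≡⟨ sym (∑-*ˡ xs (length xs) f) ⟩
  ∑[ x ∈ xs ] (length xs * f x)    ≤⟨ ∑-≤-const xs m h ⟩
  length xs * m                    ∎)
  where open ≤-Reasoning

module _ {n : ℕ} (G : Graph n) {C : Set} (_≟C_ : DecidableEquality C) (c : Coloring n C)
  (t k : ℕ) (t>0 : 0 < t) (k>0 : 0 < k) (R>0 : 0 < cherries G)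
  (R³≤t⁴ : cherries G * cherries G * cherries G ≤ t * t * (t * t))
  (bounded : ∀ v a → colorDeg _≟C_ c v a ≤ k) (280tk≤n : 280 * (t * k) ≤ n) where

  private
    open CherryCount G
    open Bounds t t>0 R>0 R³≤t⁴
    open BoundedColoring _≟C_ c k bounded

    -- The number of images left for the last of three pins, after the `h` high vertices and the two
    -- other pins.
    p : ℕ
    p = n ∸ (h + 2)

    -- Makes `p` at least 9n/10. Since h ≤ h² ≤ t and t ≥ 1, it reduces to 30t ≤ n.
    10h+20≤n : 10 * (h + 2) ≤ n
    10h+20≤n = begin
      10 * (h + 2)              ≤⟨ *-monoʳ-≤ 10 (+-mono-≤ (≤-trans (m≤m² h) h²≤t) (*-monoʳ-≤ 2 t>0)) ⟩
      10 * (t + 2 * t)          ≡⟨ thirty t ⟩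
      30 * t                    ≤⟨ *-mono-≤ (m≤m+n 30 250) (m≤m*n t k {{>-nonZero k>0}}) ⟩
      280 * (t * k)             ≤⟨ 280tk≤n ⟩
      n                         ∎
      where
      open ≤-Reasoning
      thirty : ∀ t → 10 * (t + 2 * t) ≡ 30 * t
      thirty = solve-∀

    p+h+2≡n : p + (h + 2) ≡ n
    p+h+2≡n = m∸n+n≡m (≤-trans (m≤m+n (h + 2) (9 * (h + 2))) 10h+20≤n)

    9n≤10p : 9 * n ≤ 10 * p
    9n≤10p = +-cancelʳ-≤ n _ _ (begin
      9 * n + n                    ≡⟨ ten n ⟩
      10 * n                       ≡⟨ cong (10 *_) (sym p+h+2≡n) ⟩
      10 * (p + (h + 2))           ≡⟨ *-distribˡ-+ 10 p (h + 2) ⟩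
      10 * p + 10 * (h + 2)        ≤⟨ +-monoʳ-≤ (10 * p) 10h+20≤n ⟩
      10 * p + n                   ∎)
      where
      open ≤-Reasoning
      ten : ∀ n → 9 * n + n ≡ 10 * n
      ten = solve-∀

    n>0 : 0 < n
    n>0 = ≤-trans (*-mono-< (s≤s (z≤n {279})) (*-mono-< t>0 k>0)) 280tk≤n

    p>0 : 0 < p
    p>0 = *-cancelˡ-< 10 0 p (≤-trans (*-mono-< (s≤s (z≤n {8})) n>0) 9n≤10p)

    room : ∀ {l} → l ≡ h → p + (3 + l) ≤ suc n
    room refl = ≤-reflexive (trans (shift p h) (cong suc p+h+2≡n))
      where
      shift : ∀ p h → p + (3 + h) ≡ 1 + (p + (h + 2))
      shift = solve-∀

    8tk≤n : 8 * (t * k) ≤ n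
    8tk≤n = ≤-trans (*-monoˡ-≤ (t * k) (m≤m+n 8 272)) 280tk≤n

    from-spread : (xs : List (Fin n)) → length xs ≡ h → Spread xs →
      (∃ λ (ψ : Fin n → Fin n) → (∀ {i j} → ψ i ≡ ψ j → i ≡ j) × map ψ highs ≡ xs) → GProper G c
    from-spread xs |xs|≡h spr (ψ , ψ-inj , map≡) = T.Conclusion.g-proper t k>0 ended≤2t ≮⇒≥
      (∑-≤-average highs h*degree≤2t)
      (≤-trans (Spread.bad-≤ spr) (*-monoʳ-≤ 3 (*-monoˡ-≤ k (subst (λ l → l * l ≤ t) (sym |xs|≡h) h²≤t))))
      (*-monoʳ-≤ 2 R≤t²) 9n≤10p 280tk≤n (room (length-map _ highs)) (Spread.proper spr)
      where
      module T = Threats G _≟C_ c k bounded high? ψ ψ-inj xs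
        (λ {a} ha → subst (ψ a ∈_) map≡ (∈-map⁺ ψ (∈-filter⁺ high? (∈-allFin a) ha))) p p>0 (m∸n≤m n (h + 2))

  g-proper-bounded : GProper G c
  g-proper-bounded = start (Greedy.spread-list t t>0 k>0 8tk≤n h h²≤t)
    where
    start : (∃ λ xs → length xs ≡ h × Spread xs) → GProper G c
    start (xs , |xs|≡h , spr) = from-spread xs |xs|≡h spr
      (extend-injection (filter⁺ high? (allFin⁺ n)) (Spread.unique spr) (sym |xs|≡h))

-- When `m` outgrows t⁴, the step from t to t + 1 ≤ 2t multiplies the fourth power by at most 16.
-- This rounding loss is the factor 2 between 280 and 560.
fourth-root : ∀ m → 0 < m → ∃ λ t → 0 < t × m ≤ t * t * (t * t) × t * t * (t * t) ≤ 16 * m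
fourth-root (suc zero)    _ = 1 , s≤s z≤n , s≤s z≤n , s≤s z≤n
fourth-root (suc (suc m)) _ with fourth-root (suc m) (s≤s z≤n)
... | t , t>0 , lo , hi with suc (suc m) ≤? t * t * (t * t)
...   | yes q = t , t>0 , q , ≤-trans hi (*-monoʳ-≤ 16 (n≤1+n (suc m)))
...   | no ¬q = suc t , s≤s z≤n , ≤-<-trans lo (*-mono-< sq< sq<) , (begin
    suc t * suc t * (suc t * suc t)        ≤⟨ *-mono-≤ (*-mono-≤ st≤2t st≤2t) (*-mono-≤ st≤2t st≤2t) ⟩
    2 * t * (2 * t) * (2 * t * (2 * t))    ≡⟨ sixteen t ⟩
    16 * (t * t * (t * t))                 ≤⟨ *-monoʳ-≤ 16 (<⇒≤ (≰⇒> ¬q)) ⟩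
    16 * suc (suc m)                       ∎)
  where
  open ≤-Reasoning
  sq< : t * t < suc t * suc t
  sq< = *-mono-< (n<1+n t) (n<1+n t)
  st≤2t : suc t ≤ 2 * t
  st≤2t = ≤-trans (+-monoˡ-≤ t t>0) (≤-reflexive (cong (t +_) (sym (+-identityʳ t))))
  sixteen : ∀ t → 2 * t * (2 * t) * (2 * t * (2 * t)) ≡ 16 * (t * t * (t * t))
  sixteen = solve-∀

-- In fourth powers, (qdt)⁴ ≤ 16R³ (qd)⁴ = (2qd)⁴ R³ ≤ n⁴. `q` and `e` stand for 280 and 560, so
-- that the ring identities contain no large numerals.
rescale : ∀ {q e d t R n} → e ≡ 2 * q → t * t * (t * t) ≤ 16 * (R * R * R) →
  e * d * (e * d) * (e * d) * (e * d) * (R * R * R) ≤ n * n * n * n → d * (q * t) ≤ n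
rescale {q} {_} {d} {t} {R} {n} refl t⁴≤16R³ h = sq-cancel-≤ (sq-cancel-≤ (begin
  X * X * (X * X)                  ≡⟨ split d q t ⟩
  d⁴ * (t * t * (t * t))           ≤⟨ *-monoʳ-≤ d⁴ t⁴≤16R³ ⟩
  d⁴ * (16 * (R * R * R))          ≡⟨ gather d q (R * R * R) ⟩
  m * m * m * m * (R * R * R)      ≤⟨ h ⟩
  n * n * n * n                    ≡⟨ *-assoc (n * n) n n ⟩
  n * n * (n * n)                  ∎))
  where
  open ≤-Reasoning
  X d⁴ m : ℕ
  X = d * (q * t)
  d⁴ = q * d * (q * d) * (q * d * (q * d))
  m = 2 * q * d
  split : ∀ d q t → d * (q * t) * (d * (q * t)) * (d * (q * t) * (d * (q * t))) ≡ q * d * (q * d) * (q * d * (q * d)) * (t * t * (t * t))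
  split = solve-∀
  gather : ∀ d q s → q * d * (q * d) * (q * d * (q * d)) * (16 * s) ≡ 2 * q * d * (2 * q * d) * (2 * q * d) * (2 * q * d) * s
  gather = solve-∀

-- From the rational hypothesis to natural numbers

ℕtoℚ≡mkℚ : ∀ m → ℕtoℚ m ≡ mkℚ (ℤ.+ m) 0 (Coprimality.sym (1-coprimeTo m))
ℕtoℚ≡mkℚ m = Qₚ.normalize-coprime (Coprimality.sym (1-coprimeTo m))

ℕtoℚ-* : ∀ a b → ℕtoℚ a Q.* ℕtoℚ b ≡ ℕtoℚ (a * b)
ℕtoℚ-* a b rewrite ℕtoℚ≡mkℚ a | ℕtoℚ≡mkℚ b | sym (ℤₚ.pos-* a b) = refl

ℕtoℚ-cancel-≤ : ∀ {a b} → ℕtoℚ a Q.≤ ℕtoℚ b → a ≤ b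
ℕtoℚ-cancel-≤ {a} {b} h rewrite ℕtoℚ≡mkℚ a | ℕtoℚ≡mkℚ b =
  ℤₚ.drop‿+≤+ (subst₂ ℤ._≤_ (ℤₚ.*-identityʳ (ℤ.+ a)) (ℤₚ.*-identityʳ (ℤ.+ b)) (Qₚ.drop-*≤* h))

ℕtoℚ-nonNeg : ∀ m → Q.NonNegative (ℕtoℚ m)
ℕtoℚ-nonNeg m = Qₚ.normalize-nonNeg m 1

pow4-ℕtoℚ : ∀ m → pow4 (ℕtoℚ m) ≡ ℕtoℚ (m * m * m * m)
pow4-ℕtoℚ m = trans (cong (λ q → q Q.* ℕtoℚ m Q.* ℕtoℚ m) (ℕtoℚ-* m m))
  (trans (cong (Q._* ℕtoℚ m) (ℕtoℚ-* (m * m) m)) (ℕtoℚ-* (m * m * m) m))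

cube-mono-ℚ : ∀ {x y} → Q.NonNegative x → Q.NonNegative y → x Q.≤ y → x Q.* x Q.* x Q.≤ y Q.* y Q.* y
cube-mono-ℚ {x} {y} x≥0 y≥0 x≤y = begin
  x Q.* x Q.* x   ≤⟨ Qₚ.*-monoʳ-≤-nonNeg x {{x≥0}} (Qₚ.*-monoʳ-≤-nonNeg x {{x≥0}} x≤y) ⟩
  y Q.* x Q.* x   ≤⟨ Qₚ.*-monoʳ-≤-nonNeg x {{x≥0}} (Qₚ.*-monoˡ-≤-nonNeg y {{y≥0}} x≤y) ⟩
  y Q.* y Q.* x   ≤⟨ Qₚ.*-monoˡ-≤-nonNeg (y Q.* y) {{Qₚ.nonNeg*nonNeg⇒nonNeg y {{y≥0}} y {{y≥0}}}} x≤y ⟩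
  y Q.* y Q.* y   ∎
  where open Qₚ.≤-Reasoning

-- Cubing is monotone on nonnegative rationals, so the cherry count may replace its upper bound `r`.
bound-ℕ : ∀ {m R n} {r : ℚ} → Positive r → ℕtoℚ R Q.≤ r →
  pow4 (ℕtoℚ m) Q.* (r Q.* r Q.* r) Q.≤ pow4 (ℕtoℚ n) → m * m * m * m * (R * R * R) ≤ n * n * n * n
bound-ℕ {m} {R} {n} {r} r>0 R≤r h = ℕtoℚ-cancel-≤ (begin
  ℕtoℚ (m * m * m * m * (R * R * R))                ≡⟨ sym (ℕtoℚ-* (m * m * m * m) (R * R * R)) ⟩
  ℕtoℚ (m * m * m * m) Q.* ℕtoℚ (R * R * R)         ≡⟨ cong₂ Q._*_ (sym (pow4-ℕtoℚ m)) (sym R³) ⟩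
  pow4 (ℕtoℚ m) Q.* (ℕtoℚ R Q.* ℕtoℚ R Q.* ℕtoℚ R)  ≤⟨ Qₚ.*-monoˡ-≤-nonNeg (pow4 (ℕtoℚ m)) {{m⁴≥0}}
                                                         (cube-mono-ℚ (ℕtoℚ-nonNeg R) (Qₚ.pos⇒nonNeg r {{r>0}}) R≤r) ⟩
  pow4 (ℕtoℚ m) Q.* (r Q.* r Q.* r)                 ≤⟨ h ⟩
  pow4 (ℕtoℚ n)                                     ≡⟨ pow4-ℕtoℚ n ⟩
  ℕtoℚ (n * n * n * n)                              ∎)
  where
  open Qₚ.≤-Reasoning
  R³ : ℕtoℚ R Q.* ℕtoℚ R Q.* ℕtoℚ R ≡ ℕtoℚ (R * R * R)
  R³ = trans (cong (Q._* ℕtoℚ R) (ℕtoℚ-* R R)) (ℕtoℚ-* (R * R) R)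
  m⁴≥0 : Q.NonNegative (pow4 (ℕtoℚ m))
  m⁴≥0 = subst Q.NonNegative (sym (pow4-ℕtoℚ m)) (ℕtoℚ-nonNeg (m * m * m * m))

some-edge : ∀ (G : Graph n) → 0 < cherries G → ∃ λ a → ∃ λ v → Adj G a v ≡ true
some-edge {n} G R>0 = go (∑-pos (allFin n) R>0)
  where
  edge : ∀ s a v e → 0 < (if s ∧ Adj G a v ∧ e then 1 else 0) → ∃ λ a → ∃ λ v → Adj G a v ≡ true
  edge true a v e h with Adj G a v in eq
  ... | true = a , v , eq
  go : (∃ λ v → 0 < Σᶠ[ a ] Σᶠ[ b ] (if ⌊ toℕ a <? toℕ b ⌋ ∧ Adj G a v ∧ Adj G v b then 1 else 0)) → _
  go (v , h) = let a , h′ = ∑-pos (allFin n) h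
                   b , h″ = ∑-pos (allFin n) h′
               in edge ⌊ toℕ a <? toℕ b ⌋ a v (Adj G v b) h″

trivial-embedding : ∀ (G : Graph n) {C : Set} (c : Coloring n C) → cherries G ≡ 0 → GProper G c
trivial-embedding G c R≡0 = id , id , λ u v w uv vw u≢w _ → contradiction
  (begin
    1                ≡⟨ sym (⟦⟧-yes (cherry? u v w) (uv , vw , u≢w)) ⟩
    χ u v w          ≤⟨ ≤Σᶠ (χ u v) w ⟩
    Σᶠ (χ u v)       ≤⟨ ≤Σᶠ (λ u → Σᶠ (χ u v)) u ⟩
    centred v        ≤⟨ centred≤2R v ⟩
    2 * cherries G   ≡⟨ cong (2 *_) R≡0 ⟩
    0                ∎)
  λ ()
  where
  open CherryCount G
  open ≤-Reasoning

floor-quotient : ∀ n s → 0 < s → ∃ λ k → k * s ≤ n × (∀ d → d * s ≤ n → d ≤ k)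
floor-quotient n s@(suc _) _ = n / s , m/n*n≤m n s , λ d ds≤n → subst (_≤ n / s) (m*n/n≡m d s) (/-monoˡ-≤ s ds≤n)

module _ {n : ℕ} {r : ℚ} (r>0 : Positive r) (G : Graph n) (R≤r : ℕtoℚ (cherries G) Q.≤ r)
  {C : Set} (dec : DecidableEquality C) (c : Coloring n C) (bounded : LocallyBoundedBy dec n r c)
  (R>0 : 0 < cherries G) where

  private
    R : ℕ
    R = cherries G

  module _ (t : ℕ) (t>0 : 0 < t) (R³≤t⁴ : R * R * R ≤ t * t * (t * t)) (t⁴≤16R³ : t * t * (t * t) ≤ 16 * (R * R * R)) where

    scaled : ∀ v a → colorDeg dec c v a * (280 * t) ≤ n
    scaled v a = rescale {280} {560} {colorDeg dec c v a} {t} {R} {n} refl t⁴≤16R³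
      (bound-ℕ {560 * colorDeg dec c v a} {R} {n} r>0 R≤r (bounded v a))

    -- Guarantees that the quotient `k` below is positive, which the estimates use in the form t ≤
    -- tk.
    some-degree : ∃ λ v → ∃ λ a → 0 < colorDeg dec c v a
    some-degree = let a , v , av = some-edge G R>0 in
      v , col c v a , ≤-trans (colorDeg-term dec c (CherryCount.edge-irrefl G av) refl)
        (∈⇒≤∑ (λ u → if ⌊ ¬? (u F.≟ v) ⌋ ∧ ⌊ dec (col c v u) (col c v a) ⌋ then 1 else 0) (∈-allFin a))

    -- The floor `k` of n/(280t) bounds every colour degree, as these are integers, and still
    -- satisfies 280tk ≤ n.
    from-quotient : (∃ λ k → k * (280 * t) ≤ n × (∀ d → d * (280 * t) ≤ n → d ≤ k)) → GProper G c
    from-quotient (k , k≤ , k-max) = g-proper-bounded G dec c t k t>0 k>0 R>0 R³≤t⁴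
      (λ v a → k-max _ (scaled v a)) (≤-trans (≤-reflexive (reorder 280 t k)) k≤)
      where
      reorder : ∀ q t k → q * (t * k) ≡ k * (q * t)
      reorder = solve-∀
      k>0 : 0 < k
      k>0 = let v , a , d>0 = some-degree in ≤-trans d>0 (k-max _ (scaled v a))

    g-proper-root : GProper G c
    g-proper-root = from-quotient (floor-quotient n (280 * t) (*-mono-< (s≤s (z≤n {279})) t>0))

  g-proper-cherries : GProper G c
  g-proper-cherries = finish (fourth-root (R * R * R) (*-mono-< (*-mono-< R>0 R>0) R>0))
    where
    finish : (∃ λ t → 0 < t × R * R * R ≤ t * t * (t * t) × t * t * (t * t) ≤ 16 * (R * R * R)) → GProper G c
    finish (t , t>0 , lo , hi) = g-proper-root t t>0 lo hi

theorem1p2 : (n : ℕ) → 1 ≤ n → (r : ℚ) → Positive r →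
    (G : Graph n) → ℕtoℚ (cherries G) Q.≤ r →
    {C : Set} (dec : DecidableEquality C) (c : Coloring n C) →
    LocallyBoundedBy dec n r c → GProper G c
theorem1p2 n _ r r>0 G R≤r dec c bounded = cases (cherries G ≟ 0)
  where
  cases : Dec (cherries G ≡ 0) → GProper G c
  -- Without cherries the identity is proper vacuously; the estimates for the other case rest on R >
  -- 0.
  cases (yes R≡0) = trivial-embedding G c R≡0
  cases (no R≢0)  = g-proper-cherries r>0 G R≤r dec c bounded (n≢0⇒n>0 R≢0)
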